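{- For any integers $s,t,k\geq 2$ there exists a constant $C=C(s,t,k)>0$ such that for all $n$, $\mathrm{ex}(n,K_{s,t}^k)\leq C\,n^{1+\frac{s-1}{sk}}$.
   Context: $\mathrm{ex}(n,H)$ denotes the maximum number of edges in a graph on $n$ vertices not containing $H$ as a subgraph. For a graph $F$, the $k$-subdivision $F^k$ is the graph obtained by replacing each edge of $F$ by a path of length $k$, these paths being internally vertex-disjoint. $K_{s,t}$ is the complete bipartite graph with parts of sizes $s$ and $t$. -}

module Defs where

open import Data.Nat using (ℕ; zero; suc; _+_; _∸_; _<ᵇ_)
open import Data.Bool using (Bool; true; false; _∧_; if_then_else_)
open import Data.Fin using (Fin; toℕ)
open import Data.List using (List; allFin; map)
open import Data.Nat.ListAction using (sum)
open import Data.Product using (Σ; _×_; ∃-syntax)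
open import Relation.Binary.PropositionalEquality using (_≡_)
open import Function.Definitions using (Injective)

record SimpleGraph (n : ℕ) : Set where
  field
    adj    : Fin n → Fin n → Bool
    sym    : ∀ i j → adj i j ≡ adj j i
    irrefl : ∀ i → adj i i ≡ false
open SimpleGraph public

edgeCount : ∀ {n} → SimpleGraph n → ℕ
edgeCount {n} G =
  sum (map (λ i → sum (map (λ j → if (toℕ i <ᵇ toℕ j) ∧ adj G i j then 1 else 0)
                           (allFin n)))
           (allFin n))

-- Vertices of the k-subdivision of K_{s,t} (intended for k ≥ 2):
-- the s + t branch vertices, and for each pair (i , j) the k - 1 internal
-- vertices  inner i j 0, …, inner i j (k-2)  of the path from left i to right j.
data SubdivVertex (s t k : ℕ) : Set where
  left  : Fin s → SubdivVertex s t k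
  right : Fin t → SubdivVertex s t k
  inner : Fin s → Fin t → Fin (k ∸ 1) → SubdivVertex s t k

-- Edges of K_{s,t}^k (each undirected edge listed once, in one orientation):
-- the path  left i — inner i j 0 — … — inner i j (k-2) — right j  of length k.
data SubdivEdge (s t k : ℕ) : SubdivVertex s t k → SubdivVertex s t k → Set where
  e-left  : ∀ i j (l : Fin (k ∸ 1)) → toℕ l ≡ 0 →
            SubdivEdge s t k (left i) (inner i j l)
  e-mid   : ∀ i j (l l′ : Fin (k ∸ 1)) → suc (toℕ l) ≡ toℕ l′ →
            SubdivEdge s t k (inner i j l) (inner i j l′)
  e-right : ∀ i j (l : Fin (k ∸ 1)) → suc (toℕ l) ≡ k ∸ 1 →
            SubdivEdge s t k (inner i j l) (right j)

ContainsSubdivKst : ∀ {n} → SimpleGraph n → (s t k : ℕ) → Set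
ContainsSubdivKst {n} G s t k =
  Σ (SubdivVertex s t k → Fin n) λ f →
    Injective _≡_ _≡_ f ×
    (∀ u v → SubdivEdge s t k u v → adj G (f u) (f v) ≡ true)

-- After passing to a subgraph whose degrees lie between d and K d (a counterexample that is minimal in the number of
-- vertices has no room for many edges at its vertices of high degree), one counts embeddings of the spider with s legs
-- of length k. There are at least about n dˢᵏ of them, far more than the nˢ possible s-tuples of leaves. Hence there is a
-- maximal set W of spider positions, containing the leaves, such that for a positive proportion of the embeddings the
-- number of embeddings with the same values on W is large; by maximality few of these share a further vertex, so one
-- can move all positions outside W off any bounded set of vertices. Discarding sparse fibres makes the family flexible
-- also in a second way: the values on certain subtrees R can be kept while all others are moved off a bounded set.
--
-- If the centre is not in W, let z i be the first position on leg i that is in W. Alternating the two moves, one walks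
-- from z i to a fresh vertex that can replace it, two edges at a time, and so lengthens the legs to k, as often as one
-- likes and with fixed ends (if the missing length is odd, the end is the neighbour of z i instead). If the centre is in
-- W, or if two of these neighbours coincide in the centre, then two positions of W are joined by a path of the spider
-- outside W. The pairs of vertices joined robustly by such a path are dense, so as in the Kővári–Sós–Turán theorem some
-- p₁, …, p_s are joined to the same many q; lengthening at the pᵢ gives the legs, with centre q or, depending on the
-- parity, a common neighbour of several q.
module Submission where

open import Defs renaming (sym to adj-sym)
open import Data.Bool using (Bool; true; false; _∧_; _∨_; not; if_then_else_)
open import Data.Bool.Properties using () renaming (_≟_ to _≟B_)
open import Data.Empty using (⊥; ⊥-elim)
open import Data.Fin using (Fin; zero; suc; toℕ; fromℕ; fromℕ<; inject₁)
open import Data.Fin.Properties using (toℕ-injective; toℕ-inject₁) renaming (_≟_ to _≟F_)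
open import Data.List using (List; []; _∷_; _++_; length; map; filterᵇ; allFin; concatMap; cartesianProduct; reverse; tabulate; concat; lookup; take; drop)
open import Data.List.Membership.DecPropositional using () renaming (_∈?_ to memberOf)
open import Data.List.Membership.Propositional using (_∈_; _∉_; lose) renaming (find to find∈)
open import Data.List.Membership.Propositional.Properties using (∈-allFin; ∈-lookup; ∈-map⁺; ∈-map⁻; ∈-++⁺ˡ; ∈-++⁺ʳ; ∈-++⁻; ∈-concat⁺′; ∈-concat⁻′; ∈-concatMap⁺; ∈-concatMap⁻; ∈-tabulate⁺; ∈-tabulate⁻; ∈-cartesianProduct⁺; ∈-cartesianProduct⁻)
open import Data.List.Properties using (length-tabulate; length-++; length-reverse; length-take; length-drop; take++drop≡id; map-tabulate; map-++; tabulate-lookup; unfold-reverse; ++-assoc; ∷-injectiveˡ; ∷-injectiveʳ; ≡-dec) renaming (length-map to length-map′)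
open import Data.List.Relation.Unary.All as All using ([]; _∷_)
open import Data.List.Relation.Unary.AllPairs as AllPairs using ([]; _∷_)
open import Data.List.Relation.Unary.Any using (here; there)
open import Data.List.Relation.Unary.Unique.Propositional using (Unique)
open import Data.List.Relation.Unary.Unique.Propositional.Properties using (allFin⁺; cartesianProduct⁺; tabulate⁺; map⁺; ++⁺)
open import Data.Maybe using (Maybe; just; nothing)
open import Data.Nat hiding (_≟_)
open import Data.Nat.DivMod using (_/_; _%_; m/n*n≤m; m≡m%n+[m/n]*n; m%n<n)
open import Data.Nat.Induction using (<-rec)
open import Data.Nat.ListAction using (sum)
open import Data.Nat.Properties renaming (_≟_ to _≟ℕ_)
open import Data.Nat.Tactic.RingSolver using (solve-∀)
open import Data.Product using (Σ; _×_; _,_; proj₁; proj₂; ∃-syntax)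
open import Data.Sum using (_⊎_; inj₁; inj₂)
open import Function using (_∘_; case_of_)
open import Relation.Binary using (DecidableEquality)
open import Relation.Binary.Definitions using (tri<; tri≈; tri>)
open import Relation.Binary.PropositionalEquality
open import Relation.Nullary using (¬_; yes; no; does; Dec)
open import Relation.Nullary.Decidable using (map′; _→-dec_)

-- The two kinds of flexibility have different sources. On a connected set R of r positions there
-- are at most n (K d)^(r-1) patterns of values, so typical fibres over R have the full order d^m, m
-- being the number of free positions. Fixing one more position costs a factor of order d, which
-- beats any constant once d is large. W need not be connected, and its fibres are only known to
-- exceed a constant. There maximality replaces connectedness: the thresholds grow with the number
-- of free positions, so fixing one more position leaves a far smaller fibre.
--
-- Both properties must hold for one and the same family, as the result of one move is the input of
-- the next. Hence W and all the sets R are cleaned in a single process, whose potential function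
-- charges each of them for its patterns.
--
-- The constants must not be circular. The density constant Γ depends only on s, k and K; it
-- determines the numbers in the Kővári-Sós-Turán step, then the sizes b and B of the sets to be
-- avoided. Only after B come the thresholds for W and the lower bound on d.

private
  variable
    A B : Set

-- Booleans, finite sums and counting in lists

true≢false : ∀ {b} → b ≡ true → b ≡ false → ⊥
true≢false refl ()

not-true : ∀ {b} → not b ≡ true → b ≡ false
not-true {false} _ = refl

not-false⁻ : ∀ {b} → not b ≡ false → b ≡ true
not-false⁻ {true} _ = refl

not-false : ∀ {b} → b ≡ false → not b ≡ true
not-false refl = refl

¬true⇒false : ∀ {b} → ¬ (b ≡ true) → b ≡ false
¬true⇒false {false} _ = refl
¬true⇒false {true} h = ⊥-elim (h refl)

∧-true : ∀ {a b} → a ∧ b ≡ true → a ≡ true × b ≡ true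
∧-true {true} {true} _ = refl , refl

∧-intro : ∀ {a b} → a ≡ true → b ≡ true → a ∧ b ≡ true
∧-intro refl refl = refl

∨-true : ∀ {a b} → a ∨ b ≡ true → a ≡ true ⊎ b ≡ true
∨-true {true} _ = inj₁ refl
∨-true {false} h = inj₂ h

∨-introˡ : ∀ {a b} → a ≡ true → a ∨ b ≡ true
∨-introˡ refl = refl

∨-introʳ : ∀ {a b} → b ≡ true → a ∨ b ≡ true
∨-introʳ {true} _ = refl
∨-introʳ {false} h = h

does-true : ∀ {P : Set} (d : Dec P) → does d ≡ true → P
does-true (yes p) _ = p

true-does : ∀ {P : Set} (d : Dec P) → P → does d ≡ true
true-does (yes _) _ = refl
true-does (no ¬p) p = ⊥-elim (¬p p)

false-does : ∀ {P : Set} (d : Dec P) → ¬ P → does d ≡ false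
false-does (yes p) ¬p = ⊥-elim (¬p p)
false-does (no _) _ = refl

𝟙 : Bool → ℕ
𝟙 b = if b then 1 else 0

𝟙-mono : ∀ {a b} → (a ≡ true → b ≡ true) → 𝟙 a ≤ 𝟙 b
𝟙-mono {false} _ = z≤n
𝟙-mono {true} h rewrite h refl = ≤-refl

𝟙≤1 : ∀ b → 𝟙 b ≤ 1
𝟙≤1 true = ≤-refl
𝟙≤1 false = z≤n

∑ : List A → (A → ℕ) → ℕ
∑ xs f = sum (map f xs)

# : (A → Bool) → List A → ℕ
# P xs = ∑ xs (𝟙 ∘ P)

∑-mono : ∀ (xs : List A) {f g : A → ℕ} → (∀ x → x ∈ xs → f x ≤ g x) → ∑ xs f ≤ ∑ xs g
∑-mono [] h = z≤n
∑-mono (x ∷ xs) h = +-mono-≤ (h x (here refl)) (∑-mono xs (λ y y∈ → h y (there y∈)))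

∑-cong : ∀ (xs : List A) {f g : A → ℕ} → (∀ x → x ∈ xs → f x ≡ g x) → ∑ xs f ≡ ∑ xs g
∑-cong [] h = refl
∑-cong (x ∷ xs) h = cong₂ _+_ (h x (here refl)) (∑-cong xs (λ y y∈ → h y (there y∈)))

∑-+ : ∀ (xs : List A) (f g : A → ℕ) → ∑ xs (λ x → f x + g x) ≡ ∑ xs f + ∑ xs g
∑-+ [] f g = refl
∑-+ (x ∷ xs) f g rewrite ∑-+ xs f g = lem (f x) (g x) (∑ xs f) (∑ xs g)
  where
  lem : ∀ a b c d → a + b + (c + d) ≡ a + c + (b + d)
  lem = solve-∀

∑-*ˡ : ∀ (xs : List A) c (f : A → ℕ) → ∑ xs (λ x → c * f x) ≡ c * ∑ xs f
∑-*ˡ [] c f = sym (*-zeroʳ c)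
∑-*ˡ (x ∷ xs) c f rewrite ∑-*ˡ xs c f = sym (*-distribˡ-+ c (f x) (∑ xs f))

∑-*ʳ : ∀ (xs : List A) (f : A → ℕ) c → ∑ xs (λ x → f x * c) ≡ ∑ xs f * c
∑-*ʳ [] f c = refl
∑-*ʳ (x ∷ xs) f c rewrite ∑-*ʳ xs f c = sym (*-distribʳ-+ c (f x) (∑ xs f))

∑-const : ∀ (xs : List A) c → ∑ xs (λ _ → c) ≡ length xs * c
∑-const [] c = refl
∑-const (x ∷ xs) c = cong (c +_) (∑-const xs c)

∑-≤-const : ∀ (xs : List A) {f : A → ℕ} c → (∀ x → x ∈ xs → f x ≤ c) → ∑ xs f ≤ length xs * c
∑-≤-const xs c h = ≤-trans (∑-mono xs h) (≤-reflexive (∑-const xs c))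

∑-zero : ∀ (xs : List A) → ∑ xs (λ _ → 0) ≡ 0
∑-zero xs = trans (∑-const xs 0) (*-zeroʳ (length xs))

∑-swap : ∀ (xs : List A) (ys : List B) (f : A → B → ℕ) →
         ∑ xs (λ x → ∑ ys (f x)) ≡ ∑ ys (λ y → ∑ xs (λ x → f x y))
∑-swap [] ys f = sym (∑-zero ys)
∑-swap (x ∷ xs) ys f =
  trans (cong (∑ ys (f x) +_) (∑-swap xs ys f)) (sym (∑-+ ys (f x) (λ y → ∑ xs (λ x → f x y))))

∑-∈ : ∀ {xs : List A} (f : A → ℕ) {x} → x ∈ xs → f x ≤ ∑ xs f
∑-∈ f (here refl) = m≤m+n _ _
∑-∈ f (there x∈) = ≤-trans (∑-∈ f x∈) (m≤n+m _ _)

∑-mono-drop : ∀ {xs : List A} (f g : A → ℕ) {x} → x ∈ xs → ∀ c →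
              (∀ y → y ∈ xs → f y ≤ g y) → f x + c ≤ g x → ∑ xs f + c ≤ ∑ xs g
∑-mono-drop {xs = y ∷ ys} f g (here refl) c h hx =
  ≤-trans (≤-reflexive (lem (f y) (∑ ys f) c)) (+-mono-≤ hx (∑-mono ys (λ z z∈ → h z (there z∈))))
  where
  lem : ∀ a b c → a + b + c ≡ a + c + b
  lem = solve-∀
∑-mono-drop {xs = y ∷ ys} f g (there x∈) c h hx =
  ≤-trans (≤-reflexive (+-assoc (f y) (∑ ys f) c))
    (+-mono-≤ (h y (here refl)) (∑-mono-drop f g x∈ c (λ z z∈ → h z (there z∈)) hx))

∑-++ : ∀ (xs ys : List A) (f : A → ℕ) → ∑ (xs ++ ys) f ≡ ∑ xs f + ∑ ys f
∑-++ [] ys f = refl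
∑-++ (x ∷ xs) ys f rewrite ∑-++ xs ys f = sym (+-assoc (f x) _ _)

#-mono : ∀ {P Q : A → Bool} (xs : List A) → (∀ x → x ∈ xs → P x ≡ true → Q x ≡ true) → # P xs ≤ # Q xs
#-mono xs h = ∑-mono xs (λ x x∈ → 𝟙-mono (h x x∈))

#≤length : ∀ (P : A → Bool) xs → # P xs ≤ length xs
#≤length P xs = ≤-trans (∑-≤-const xs 1 (λ x _ → 𝟙≤1 (P x))) (≤-reflexive (*-identityʳ _))

#-∪ : ∀ {P Q R : A → Bool} (xs : List A) →
      (∀ x → x ∈ xs → P x ≡ true → Q x ≡ true ⊎ R x ≡ true) → # P xs ≤ # Q xs + # R xs
#-∪ {P = P} {Q} {R} xs h =
  ≤-trans (∑-mono xs (λ x x∈ → pt x (h x x∈))) (≤-reflexive (∑-+ xs (𝟙 ∘ Q) (𝟙 ∘ R)))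
  where
  pt : ∀ x → (P x ≡ true → Q x ≡ true ⊎ R x ≡ true) → 𝟙 (P x) ≤ 𝟙 (Q x) + 𝟙 (R x)
  pt x k with P x
  ... | false = z≤n
  ... | true with k refl
  ... | inj₁ q rewrite q = s≤s z≤n
  ... | inj₂ r rewrite r = m≤n+m 1 (𝟙 (Q x))

#-split : ∀ (P Q : A → Bool) xs → # P xs ≡ # (λ x → P x ∧ Q x) xs + # (λ x → P x ∧ not (Q x)) xs
#-split P Q xs = trans (∑-cong xs (λ x _ → pt (P x) (Q x))) (∑-+ xs _ _)
  where
  pt : ∀ p q → 𝟙 p ≡ 𝟙 (p ∧ q) + 𝟙 (p ∧ not q)
  pt false q = refl
  pt true false = refl
  pt true true = refl

#-union : ∀ {P : A → Bool} (Q : B → A → Bool) xs (ys : List B) →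
          (∀ x → x ∈ xs → P x ≡ true → ∃[ y ] y ∈ ys × Q y x ≡ true) →
          # P xs ≤ ∑ ys (λ y → # (Q y) xs)
#-union {P = P} Q xs ys h =
  ≤-trans (∑-mono xs (λ x x∈ → pt x (h x x∈))) (≤-reflexive (∑-swap xs ys (λ x y → 𝟙 (Q y x))))
  where
  pt : ∀ x → (P x ≡ true → ∃[ y ] y ∈ ys × Q y x ≡ true) → 𝟙 (P x) ≤ ∑ ys (λ y → 𝟙 (Q y x))
  pt x k with P x
  ... | false = z≤n
  ... | true with k refl
  ... | y , y∈ , q = ≤-trans (≤-reflexive (cong 𝟙 (sym q))) (∑-∈ (λ y → 𝟙 (Q y x)) y∈)

#-false : ∀ {P : A → Bool} xs → (∀ x → x ∈ xs → P x ≡ false) → # P xs ≡ 0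
#-false xs h = trans (∑-cong xs (λ x x∈ → cong 𝟙 (h x x∈))) (∑-zero xs)

#-∈ : ∀ {P : A → Bool} {xs x} → x ∈ xs → P x ≡ true → 0 < # P xs
#-∈ {P = P} x∈ p = ≤-trans (≤-reflexive (cong 𝟙 (sym p))) (∑-∈ (𝟙 ∘ P) x∈)

find : ∀ (P : A → Bool) xs → (∃[ x ] x ∈ xs × P x ≡ true) ⊎ (∀ x → x ∈ xs → P x ≡ false)
find P [] = inj₂ (λ _ ())
find P (x ∷ xs) with P x in eq
... | true = inj₁ (x , here refl , eq)
... | false with find P xs
... | inj₁ (y , y∈ , p) = inj₁ (y , there y∈ , p)
... | inj₂ h = inj₂ (λ { y (here refl) → eq ; y (there y∈) → h y y∈ })

#-pos : ∀ (P : A → Bool) xs → 0 < # P xs → ∃[ x ] x ∈ xs × P x ≡ true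
#-pos P xs h with find P xs
... | inj₁ r = r
... | inj₂ k = ⊥-elim (<-irrefl (sym (#-false xs k)) h)

∑-pigeon : ∀ (xs : List A) (f g : A → ℕ) → ∑ xs g < ∑ xs f → ∃[ x ] x ∈ xs × g x < f x
∑-pigeon xs f g h with find (λ x → does (g x <? f x)) xs
... | inj₁ (x , x∈ , p) = x , x∈ , does-true (g x <? f x) p
... | inj₂ k = ⊥-elim (<-irrefl refl (<-≤-trans h (∑-mono xs (λ x x∈ →
        ≮⇒≥ (λ lt → true≢false (true-does (g x <? f x) lt) (k x x∈))))))

length-filterᵇ : ∀ (P : A → Bool) xs → length (filterᵇ P xs) ≡ # P xs
length-filterᵇ P [] = refl
length-filterᵇ P (x ∷ xs) with P x
... | true = cong suc (length-filterᵇ P xs)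
... | false = length-filterᵇ P xs

∈-filterᵇ⁺ : ∀ (P : A → Bool) {xs x} → x ∈ xs → P x ≡ true → x ∈ filterᵇ P xs
∈-filterᵇ⁺ P {y ∷ ys} (here refl) p rewrite p = here refl
∈-filterᵇ⁺ P {y ∷ ys} (there x∈) p with P y
... | true = there (∈-filterᵇ⁺ P x∈ p)
... | false = ∈-filterᵇ⁺ P x∈ p

∈-filterᵇ⁻ : ∀ (P : A → Bool) xs {x} → x ∈ filterᵇ P xs → x ∈ xs × P x ≡ true
∈-filterᵇ⁻ P (y ∷ ys) x∈ with P y in eq
∈-filterᵇ⁻ P (y ∷ ys) (here refl) | true = here refl , eq
∈-filterᵇ⁻ P (y ∷ ys) (there x∈) | true with ∈-filterᵇ⁻ P ys x∈
... | a , b = there a , b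
∈-filterᵇ⁻ P (y ∷ ys) x∈ | false with ∈-filterᵇ⁻ P ys x∈
... | a , b = there a , b

∑-filterᵇ : ∀ (P : A → Bool) xs (f : A → ℕ) → ∑ (filterᵇ P xs) f ≡ ∑ xs (λ x → 𝟙 (P x) * f x)
∑-filterᵇ P [] f = refl
∑-filterᵇ P (x ∷ xs) f with P x
... | true = cong₂ _+_ (sym (*-identityˡ (f x))) (∑-filterᵇ P xs f)
... | false = ∑-filterᵇ P xs f

module _ {A : Set} (_≟_ : DecidableEquality A) where

  #-point-∉ : ∀ {xs} {a : A} → a ∉ xs → # (λ x → does (x ≟ a)) xs ≡ 0
  #-point-∉ {xs} {a} a∉ = #-false xs (λ x x∈ → false-does (x ≟ a) (λ { refl → a∉ x∈ }))

  #-point : ∀ {xs} {a : A} → Unique xs → a ∈ xs → # (λ x → does (x ≟ a)) xs ≡ 1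
  #-point {x ∷ xs} {a} (x∉ ∷ xs!) (here refl) rewrite true-does (x ≟ x) refl =
    cong suc (#-point-∉ (λ a∈ → All.lookup x∉ a∈ refl))
  #-point {x ∷ xs} {a} (x∉ ∷ xs!) (there a∈)
    rewrite false-does (x ≟ a) (All.lookup x∉ a∈) = #-point xs! a∈

  #-point≤1 : ∀ {xs} (a : A) → Unique xs → # (λ x → does (x ≟ a)) xs ≤ 1
  #-point≤1 a [] = z≤n
  #-point≤1 a (_∷_ {x = x} {xs} x∉ xs!) with x ≟ a
  ... | yes refl = ≤-reflexive (cong suc (#-point-∉ (λ a∈ → All.lookup x∉ a∈ refl)))
  ... | no _ = #-point≤1 a xs!

  filterᵇ! : ∀ (f : A → Bool) {xs} → Unique xs → Unique (filterᵇ f xs)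
  filterᵇ! f [] = []
  filterᵇ! f (_∷_ {x = x} {xs} x∉ xs!) with f x
  ... | true = All.tabulate (λ y∈ → All.lookup x∉ (proj₁ (∈-filterᵇ⁻ f xs y∈))) ∷ filterᵇ! f xs!
  ... | false = filterᵇ! f xs!

∑-map : ∀ {A B : Set} (g : A → B) xs (f : B → ℕ) → ∑ (map g xs) f ≡ ∑ xs (f ∘ g)
∑-map g [] f = refl
∑-map g (x ∷ xs) f = cong (f (g x) +_) (∑-map g xs f)

∑-concatMap : ∀ {A B : Set} (g : A → List B) xs (f : B → ℕ) → ∑ (concatMap g xs) f ≡ ∑ xs (λ x → ∑ (g x) f)
∑-concatMap g [] f = refl
∑-concatMap g (x ∷ xs) f = trans (∑-++ (g x) _ f) (cong (∑ (g x) f +_) (∑-concatMap g xs f))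

length≡∑ : ∀ {A : Set} (xs : List A) → length xs ≡ ∑ xs (λ _ → 1)
length≡∑ xs = sym (trans (∑-const xs 1) (*-identityʳ _))

length-concatMap : ∀ {A B : Set} (g : A → List B) xs → length (concatMap g xs) ≡ ∑ xs (length ∘ g)
length-concatMap g xs = trans (length≡∑ (concatMap g xs))
  (trans (∑-concatMap g xs _) (∑-cong xs (λ x _ → sym (length≡∑ (g x)))))

length-× : ∀ {A B : Set} (xs : List A) (ys : List B) → length (cartesianProduct xs ys) ≡ length xs * length ys
length-× [] ys = refl
length-× (x ∷ xs) ys = trans (length-++ (map (x ,_) ys)) (cong₂ _+_ (length-map′ _ ys) (length-× xs ys))

∈-concatMap : ∀ {A B : Set} (g : A → List B) {xs x y} → x ∈ xs → y ∈ g x → y ∈ concatMap g xs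
∈-concatMap g x∈ y∈ = ∈-concatMap⁺ g (lose x∈ y∈)

∈-concatMap⁻′ : ∀ {A B : Set} (g : A → List B) xs {y} → y ∈ concatMap g xs → ∃[ x ] x ∈ xs × y ∈ g x
∈-concatMap⁻′ g xs y∈ = find∈ (∈-concatMap⁻ g {xs} y∈)

-- Host graphs and rooted trees

module Graph {n} (G : SimpleGraph n) where

  V : Set
  V = Fin n

  vs : List V
  vs = allFin n

  _~_ : V → V → Set
  u ~ v = adj G u v ≡ true

  nbrs : V → List V
  nbrs v = filterᵇ (adj G v) vs

  ∈-nbrs : ∀ {u v} → u ~ v → v ∈ nbrs u
  ∈-nbrs {u} e = ∈-filterᵇ⁺ (adj G u) (∈-allFin _) e

  nbrs-∈ : ∀ {u v} → v ∈ nbrs u → u ~ v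
  nbrs-∈ {u} v∈ = proj₂ (∈-filterᵇ⁻ (adj G u) vs v∈)

  nbrs! : ∀ u → Unique (nbrs u)
  nbrs! u = filterᵇ! _≟F_ (adj G u) (allFin⁺ n)

  ~-sym : ∀ {u v} → u ~ v → v ~ u
  ~-sym {u} {v} e = trans (adj-sym G v u) e

record RootedTree : Set₁ where
  field
    P    : Set
    _≟_  : DecidableEquality P
    all  : List P
    all∈ : ∀ p → p ∈ all
    all! : Unique all
    root : P
    par  : P → P
    -- connectedness: a nonempty set closed under parents and children is everything
    conn : ∀ (S : P → Bool) p₀ → S p₀ ≡ true →
           (∀ p → p ≢ root → S p ≡ true → S (par p) ≡ true) →
           (∀ p → p ≢ root → S (par p) ≡ true → S p ≡ true) → ∀ p → S p ≡ true

record Host : Set where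
  field
    {n}   : ℕ
    G     : SimpleGraph n
    d K   : ℕ
    deg≥  : ∀ v → d ≤ length (Graph.nbrs G v)
    deg≤  : ∀ v → length (Graph.nbrs G v) ≤ K * d

-- Tree homomorphisms and covers of their value patterns

module Tree (T : RootedTree) (Ω : Host) where

  open RootedTree T public
  open Host Ω public
  open Graph G public

  Δ : ℕ
  Δ = K * d

  Emb : Set
  Emb = P → V

  PSet : Set
  PSet = P → Bool

  N : ℕ
  N = length all

  full : PSet
  full _ = true

  add : PSet → P → PSet
  add S p x = S x ∨ does (x ≟ p)

  sing : P → PSet
  sing p x = does (x ≟ p)

  add-∋ : ∀ S p → add S p p ≡ true
  add-∋ S p = ∨-introʳ {S p} (true-does (p ≟ p) refl)

  add-⊇ : ∀ S p {x} → S x ≡ true → add S p x ≡ true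
  add-⊇ S p = ∨-introˡ

  add⁻ : ∀ S p {x} → add S p x ≡ true → S x ≡ true ⊎ x ≡ p
  add⁻ S p {x} h with ∨-true {S x} h
  ... | inj₁ s = inj₁ s
  ... | inj₂ e = inj₂ (does-true (x ≟ p) e)

  data Adj : P → P → Set where
    down : ∀ p → p ≢ root → Adj (par p) p
    up   : ∀ p → p ≢ root → Adj p (par p)

  Adj-sym : ∀ {p q} → Adj p q → Adj q p
  Adj-sym (down p h) = up p h
  Adj-sym (up p h) = down p h

  Adj? : ∀ p q → Dec (Adj p q)
  Adj? p q with q ≟ root | par q ≟ p | p ≟ root | par p ≟ q
  ... | no h | yes refl | _ | _ = yes (down q h)
  ... | _ | _ | no h | yes refl = yes (up p h)
  ... | yes h | _ | yes k | _ = no λ { (down _ x) → x h ; (up _ x) → x k }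
  ... | yes h | _ | no _ | no k = no λ { (down _ x) → x h ; (up _ x) → k refl }
  ... | no _ | no h | yes k | _ = no λ { (down _ x) → h refl ; (up _ x) → x k }
  ... | no _ | no h | no _ | no k = no λ { (down _ x) → h refl ; (up _ x) → k refl }

  Hom : Emb → Set
  Hom σ = ∀ p → p ≢ root → σ (par p) ~ σ p

  Inj : Emb → Set
  Inj σ = ∀ p q → σ p ≡ σ q → p ≡ q

  hom-adj : ∀ {σ} → Hom σ → ∀ {p q} → Adj p q → σ p ~ σ q
  hom-adj h (down p k) = h p k
  hom-adj h (up p k) = ~-sym (h p k)

  Agree : PSet → Emb → Emb → Set
  Agree S σ τ = ∀ p → S p ≡ true → σ p ≡ τ p

  abstract
    agree? : ∀ S σ τ → Dec (Agree S σ τ)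
    agree? S σ τ = map′ (λ a p → All.lookup a (all∈ p)) (λ a → All.tabulate (λ {p} _ → a p))
      (All.all? (λ p → (S p ≟B true) →-dec (σ p ≟F τ p)) all)

  agree : PSet → Emb → Emb → Bool
  agree S σ τ = does (agree? S σ τ)

  Agree-sym : ∀ S {σ τ} → Agree S σ τ → Agree S τ σ
  Agree-sym S a p s = sym (a p s)

  Agree-trans : ∀ S {σ τ υ} → Agree S σ τ → Agree S τ υ → Agree S σ υ
  Agree-trans S a b p s = trans (a p s) (b p s)

  gap : PSet → PSet → ℕ
  gap R S = # (λ p → R p ∧ not (S p)) all

  gap-add : ∀ R S p → S p ≡ false → R p ≡ true → gap R S ≡ suc (gap R (add S p))
  gap-add R S p s r = trans (#-split (λ x → R x ∧ not (S x)) (λ x → does (x ≟ p)) all)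
    (cong₂ _+_
      (trans (∑-cong all (λ x _ → cong 𝟙 (pt₁ x))) (#-point _≟_ all! (all∈ p)))
      (∑-cong all (λ x _ → cong 𝟙 (pt₂ (R x) (S x) (does (x ≟ p))))))
    where
    pt₁ : ∀ x → (R x ∧ not (S x)) ∧ does (x ≟ p) ≡ does (x ≟ p)
    pt₁ x with x ≟ p
    ... | yes refl rewrite s | r = refl
    ... | no _ with R x ∧ not (S x)
    ... | true = refl
    ... | false = refl
    pt₂ : ∀ a b c → (a ∧ not b) ∧ not c ≡ a ∧ not (b ∨ c)
    pt₂ false b c = refl
    pt₂ true false c = refl
    pt₂ true true c = refl

  gap-0 : ∀ R S → gap R S ≡ 0 → ∀ p → R p ≡ true → S p ≡ true
  gap-0 R S g p r with S p in eq
  ... | true = refl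
  ... | false = ⊥-elim (<-irrefl refl (<-≤-trans (#-∈ (all∈ p) (∧-intro r (not-false eq))) (≤-reflexive g)))

  -- S generates R along tree edges that stay inside R.
  Conn : PSet → PSet → Set
  Conn S R = ∀ (S′ : PSet) → (∀ p → S p ≡ true → S′ p ≡ true) →
             (∀ p q → Adj p q → S′ p ≡ true → R q ≡ true → S′ q ≡ true) →
             ∀ p → R p ≡ true → S′ p ≡ true

  Conn-full : ∀ S p₀ → S p₀ ≡ true → Conn S full
  Conn-full S p₀ s S′ sub cl p _ = conn S′ p₀ (sub p₀ s)
    (λ q h k → cl q (par q) (up q h) k refl) (λ q h k → cl (par q) q (down q h) k refl) p

  -- The entries of `Z` only represent patterns on `S`: they need not be homomorphisms, and their
  -- values off `S` are arbitrary.
  Covers : (Emb → Set) → PSet → List Emb → Set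
  Covers Q S Z = ∀ σ → Hom σ → Q σ → ∃[ z ] z ∈ Z × Agree S z σ

  upd : Emb → P → V → Emb
  upd z p v x = if does (x ≟ p) then v else z x

  upd-∋ : ∀ z p v → upd z p v p ≡ v
  upd-∋ z p v rewrite true-does (p ≟ p) refl = refl

  upd-∌ : ∀ z p v {x} → x ≢ p → upd z p v x ≡ z x
  upd-∌ z p v {x} h rewrite false-does (x ≟ p) h = refl

  upd-agree : ∀ S {z σ} p → Agree S z σ → Agree (add S p) (upd z p (σ p)) σ
  upd-agree S {z} {σ} p a x h with x ≟ p
  ... | yes refl = refl
  ... | no x≢p with add⁻ S p {x} (trans (cong (S x ∨_) (false-does (x ≟ p) x≢p)) h)
  ... | inj₁ s = a x s
  ... | inj₂ e = ⊥-elim (x≢p e)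

  cut : PSet → PSet → P × P → Bool
  cut R S (p , q) = does (Adj? p q) ∧ (S p ∧ (R q ∧ not (S q)))

  findEdge : ∀ R S → (∃[ p ] ∃[ q ] Adj p q × S p ≡ true × R q ≡ true × S q ≡ false)
                   ⊎ (∀ p q → Adj p q → S p ≡ true → R q ≡ true → S q ≡ true)
  findEdge R S with find (cut R S) (cartesianProduct all all)
  ... | inj₁ ((p , q) , _ , h) =
    let a , h′ = ∧-true {does (Adj? p q)} h
        s , h″ = ∧-true {S p} h′
        r , s′ = ∧-true {R q} h″
    in inj₁ (p , q , does-true (Adj? p q) a , s , r , not-true s′)
  ... | inj₂ none = inj₂ (λ p q a s r → closed p q a s r (S q) refl)
    where
    closed : ∀ p q → Adj p q → S p ≡ true → R q ≡ true → ∀ b → S q ≡ b → b ≡ true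
    closed p q a s r true eq = refl
    closed p q a s r false eq = ⊥-elim (true≢false
            (∧-intro (true-does (Adj? p q) a) (∧-intro s (∧-intro r (not-false eq))))
            (none (p , q) (∈-cartesianProduct⁺ (all∈ p) (all∈ q))))

  -- A position joined by a tree edge to one whose value is known has at most `Δ` possible values,
  -- so each of the `g` new positions multiplies the number of patterns by at most `Δ`.
  grow : ∀ g S R → gap R S ≡ g → Conn S R → ∀ Q Z → Covers Q S Z →
         ∃[ Z′ ] Covers Q R Z′ × length Z′ ≤ length Z * Δ ^ g
  grow zero S R g≡ _ Q Z c = Z
    , (λ σ h q → let z , z∈ , a = c σ h q in z , z∈ , λ p r → a p (gap-0 R S g≡ p r))
    , ≤-reflexive (sym (*-identityʳ _))
  grow (suc g) S R g≡ cn Q Z c with findEdge R S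
  -- If no tree edge leads from `S` to a position of `R` outside `S`, then `S` itself is closed and
  -- `Conn` puts all of `R` into it.
  ... | inj₂ cl = ⊥-elim (0≢1+n (trans (sym (#-false all (λ p _ → no-gap p))) g≡))
    where
    no-gap : ∀ p → R p ∧ not (S p) ≡ false
    no-gap p with R p in r
    ... | false = refl
    ... | true rewrite cn S (λ _ s → s) cl p r = refl
  ... | inj₁ (p , q , e , s , r , s′) =
    let Z″ , c″ , l″ = grow g (add S q) R (suc-injective (trans (sym (gap-add R S q s′ r)) g≡))
                         (λ S′ sub → cn S′ (λ x sx → sub x (add-⊇ S q sx))) Q Z₁ c₁
    in Z″ , c″ , ≤-trans l″ (≤-trans (*-monoˡ-≤ (Δ ^ g) l₁) (≤-reflexive (*-assoc (length Z) Δ (Δ ^ g))))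
    where
    ext : Emb → List Emb
    ext z = map (upd z q) (nbrs (z p))
    Z₁ : List Emb
    Z₁ = concatMap ext Z
    l₁ : length Z₁ ≤ length Z * Δ
    l₁ = ≤-trans (≤-reflexive (length-concatMap ext Z))
      (∑-≤-const Z Δ (λ z _ → ≤-trans (≤-reflexive (length-map′ _ (nbrs (z p)))) (deg≤ (z p))))
    c₁ : Covers Q (add S q) Z₁
    c₁ σ h qσ with c σ h qσ
    ... | z , z∈ , a = upd z q (σ q)
      , ∈-concatMap ext z∈ (∈-map⁺ (upd z q) (∈-nbrs (subst (_~ σ q) (sym (a p s)) (hom-adj h e))))
      , upd-agree S q a

-- Greedy count of injective homomorphisms

module Embeddings (T : RootedTree) (Ω : Host) where

  open Tree T Ω

  -- A partial embedding is a total function of which only the values on `S` count. `HomOn` is meant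
  -- for sets `S` closed under `par`.
  HomOn : PSet → Emb → Set
  HomOn S σ = ∀ p → p ≢ root → S p ≡ true → σ (par p) ~ σ p

  InjOn : PSet → Emb → Set
  InjOn S σ = ∀ p q → S p ≡ true → S q ≡ true → σ p ≡ σ q → p ≡ q

  -- Absence of repetitions, stated pointwise: embeddings are functions, and they are compared only
  -- through their values on `S`.
  Separated : PSet → List Emb → Set
  Separated S U = ∀ τ → # (agree S τ) U ≤ 1

  fresh : PSet → Emb → V → Bool
  fresh S z v = not (does (0 <? # (λ q → S q ∧ does (z q ≟F v)) all))

  fresh-≢ : ∀ S z v → fresh S z v ≡ true → ∀ q → S q ≡ true → z q ≢ v
  fresh-≢ S z v f q s e = true≢false (true-does (0 <? # (λ q → S q ∧ does (z q ≟F v)) all)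
    (#-∈ (all∈ q) (∧-intro s (true-does (z q ≟F v) e)))) (not-true f)

  #-stale : ∀ S z u → # (λ v → not (fresh S z v)) (nbrs u) ≤ N
  #-stale S z u = ≤-trans
    (#-union (λ q v → does (v ≟F z q)) (nbrs u) all (λ v _ h → stale v h))
    (≤-trans (∑-≤-const all 1 (λ q _ → #-point≤1 _≟F_ (z q) (nbrs! u))) (≤-reflexive (*-identityʳ N)))
    where
    stale : ∀ v → not (fresh S z v) ≡ true → ∃[ q ] q ∈ all × does (v ≟F z q) ≡ true
    stale v h =
      let Q = λ q → S q ∧ does (z q ≟F v)
          q , q∈ , k = #-pos Q all (does-true (0 <? # Q all) (not-false⁻ (not-true h)))
      in q , q∈ , true-does (v ≟F z q) (sym (does-true (z q ≟F v) (proj₂ (∧-true {S q} k))))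

  #-fresh : ∀ S z u → d ∸ N ≤ length (filterᵇ (fresh S z) (nbrs u))
  #-fresh S z u = ≤-trans (∸-monoˡ-≤ N (deg≥ u)) (m≤n+o⇒m∸n≤o (length (nbrs u)) N
    (≤-trans (≤-reflexive (trans (length≡∑ (nbrs u)) (#-split (λ _ → true) (fresh S z) (nbrs u))))
      (≤-trans (+-monoʳ-≤ (# (fresh S z) (nbrs u)) (#-stale S z u))
        (≤-reflexive (trans (+-comm _ N) (cong (N +_) (sym (length-filterᵇ (fresh S z) (nbrs u)))))))))

  -- Some position outside `S` has its parent in `S`. Of the at least `d` neighbours of the parent's
  -- image at most `N` are occupied, whence the factor `d ∸ N`; the value at the new position
  -- separates the extensions of one partial embedding.
  build : ∀ g S → gap full S ≡ g → S root ≡ true → (∀ p → S p ≡ true → S (par p) ≡ true) →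
          ∀ U → (∀ σ → σ ∈ U → HomOn S σ × InjOn S σ) → Separated S U →
          ∃[ U′ ] (∀ σ → σ ∈ U′ → Hom σ × Inj σ) × Separated full U′ × length U * (d ∸ N) ^ g ≤ length U′
  build zero S g≡ r cl U ok sep = U
    , (λ σ σ∈ → let h , i = ok σ σ∈ in
        (λ p k → h p k (gap-0 full S g≡ p refl)) , (λ p q → i p q (gap-0 full S g≡ p refl) (gap-0 full S g≡ q refl)))
    , (λ τ → ≤-trans (#-mono U (λ σ _ e → true-does (agree? S τ σ)
        (λ p _ → does-true (agree? full τ σ) e p refl))) (sep τ))
    , ≤-reflexive (*-identityʳ _)
  build (suc g) S g≡ r cl U ok sep with find (λ p → not (S p) ∧ S (par p)) all
  ... | inj₂ none = ⊥-elim (0≢1+n (trans (sym (#-false all no-gap)) g≡))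
    where
    closed : ∀ p → p ≢ root → S (par p) ≡ true → S p ≡ true
    closed p _ s with S p in eq
    ... | true = refl
    ... | false = ⊥-elim (true≢false (∧-intro (not-false eq) s) (none p (all∈ p)))
    no-gap : ∀ p → p ∈ all → full p ∧ not (S p) ≡ false
    no-gap p _ rewrite conn S root r (λ q _ → cl q) closed p = refl
  ... | inj₁ (p , _ , h) =
    let U″ , ok″ , sep″ , l″ = build g (add S p) (suc-injective (trans (sym (gap-add full S p s refl)) g≡))
                                 (add-⊇ S p r) cl₁ U₁ ok₁ sep₁
    in U″ , ok″ , sep″ , ≤-trans (≤-trans (≤-reflexive (sym (*-assoc (length U) (d ∸ N) ((d ∸ N) ^ g))))
         (*-monoˡ-≤ ((d ∸ N) ^ g) l₁)) l″
    where
    s : S p ≡ false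
    s = not-true (proj₁ (∧-true {not (S p)} h))
    sp : S (par p) ≡ true
    sp = proj₂ (∧-true {not (S p)} h)
    cl₁ : ∀ q → add S p q ≡ true → add S p (par q) ≡ true
    cl₁ q k with add⁻ S p k
    ... | inj₁ sq = add-⊇ S p (cl q sq)
    ... | inj₂ refl = add-⊇ S p sp
    cand : Emb → List V
    cand z = filterᵇ (fresh S z) (nbrs (z (par p)))
    ext : Emb → List Emb
    ext z = map (upd z p) (cand z)
    U₁ : List Emb
    U₁ = concatMap ext U
    l₁ : length U * (d ∸ N) ≤ length U₁
    l₁ = ≤-trans (≤-reflexive (sym (∑-const U (d ∸ N))))
      (≤-trans (∑-mono U (λ z _ → ≤-trans (#-fresh S z (z (par p))) (≤-reflexive (sym (length-map′ (upd z p) (cand z))))))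
        (≤-reflexive (sym (length-concatMap ext U))))
    old : ∀ z v q → S q ≡ true → upd z p v q ≡ z q
    old z v q sq = upd-∌ z p v (λ { refl → true≢false sq s })
    ok₁ : ∀ σ → σ ∈ U₁ → HomOn (add S p) σ × InjOn (add S p) σ
    ok₁ σ σ∈ with ∈-concatMap⁻′ ext U σ∈
    ... | z , z∈ , σ∈z with ∈-map⁻ (upd z p) σ∈z
    ... | v , v∈ , refl with ∈-filterᵇ⁻ (fresh S z) (nbrs (z (par p))) v∈ | ok z z∈
    ... | v∈n , fr | hz , iz = hom , inj
      where
      hom : HomOn (add S p) (upd z p v)
      hom q q≢ k with add⁻ S p k
      ... | inj₂ refl = subst₂ _~_ (sym (old z v (par p) sp)) (sym (upd-∋ z p v)) (nbrs-∈ v∈n)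
      ... | inj₁ sq = subst₂ _~_ (sym (old z v (par q) (cl q sq))) (sym (old z v q sq)) (hz q q≢ sq)
      inj : InjOn (add S p) (upd z p v)
      inj a b ka kb e with add⁻ S p ka | add⁻ S p kb
      ... | inj₂ refl | inj₂ refl = refl
      ... | inj₁ sa | inj₁ sb = iz a b sa sb (trans (sym (old z v a sa)) (trans e (old z v b sb)))
      ... | inj₁ sa | inj₂ refl = ⊥-elim (fresh-≢ S z v fr a sa (trans (sym (old z v a sa)) (trans e (upd-∋ z p v))))
      ... | inj₂ refl | inj₁ sb = ⊥-elim (fresh-≢ S z v fr b sb (trans (sym (old z v b sb)) (trans (sym e) (upd-∋ z p v))))
    sep₁ : Separated (add S p) U₁
    sep₁ τ = ≤-trans (≤-reflexive (∑-concatMap ext U _))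
      (≤-trans (∑-mono U (λ z _ → ≤-trans (≤-reflexive (∑-map (upd z p) (cand z) _)) (pt z))) (sep τ))
      where
      pt : ∀ z → # (agree (add S p) τ ∘ upd z p) (cand z) ≤ 𝟙 (agree S τ z)
      pt z with agree? S τ z
      ... | yes _ = ≤-trans (#-mono (cand z) (λ v _ e → true-does (v ≟F τ p)
              (trans (sym (upd-∋ z p v)) (sym (does-true (agree? (add S p) τ (upd z p v)) e p (add-∋ S p))))))
              (#-point≤1 _≟F_ (τ p) (filterᵇ! _≟F_ (fresh S z) (nbrs! (z (par p)))))
      ... | no ¬a = ≤-reflexive (#-false (cand z) (λ v _ → false-does (agree? (add S p) τ (upd z p v))
              (λ a → ¬a (λ q sq → trans (a q (add-⊇ S p sq)) (old z v q sq)))))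

  edges : ℕ
  edges = gap full (sing root)

  embeddings : par root ≡ root →
    ∃[ U ] (∀ σ → σ ∈ U → Hom σ × Inj σ) × Separated full U × n * (d ∸ N) ^ edges ≤ length U
  embeddings pr = let U , ok , sep , l = build edges (sing root) refl (true-does (root ≟ root) refl) cl consts ok₀ sep₀
    in U , ok , sep , ≤-trans (≤-reflexive (cong (_* (d ∸ N) ^ edges) (sym (trans (length-map′ _ vs) (length-tabulate {n = n} (λ i → i)))))) l
    where
    consts : List Emb
    -- A constant function stands for the placement of the root alone.
    consts = map (λ v _ → v) vs
    cl : ∀ p → sing root p ≡ true → sing root (par p) ≡ true
    cl p k with does-true (p ≟ root) k
    ... | refl = true-does (par root ≟ root) pr
    ok₀ : ∀ σ → σ ∈ consts → HomOn (sing root) σ × InjOn (sing root) σ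
    ok₀ σ _ = (λ p p≢ k → ⊥-elim (p≢ (does-true (p ≟ root) k)))
      , (λ p q k l _ → trans (does-true (p ≟ root) k) (sym (does-true (q ≟ root) l)))
    sep₀ : Separated (sing root) consts
    sep₀ τ = ≤-trans (≤-reflexive (∑-map (λ v _ → v) vs _))
      (≤-trans (#-mono vs (λ v _ k → true-does (v ≟F τ root)
          (sym (does-true (agree? (sing root) τ (λ _ → v)) k root (true-does (root ≟ root) refl)))))
        (#-point≤1 _≟F_ (τ root) (allFin⁺ n)))

record Sample (T : RootedTree) (Ω : Host) : Set where
  open Tree T Ω
  field
    𝒰   : List Emb
    ok  : ∀ σ → σ ∈ 𝒰 → Hom σ × Inj σ
    sep : Embeddings.Separated T Ω full 𝒰

-- Walks as lists, disjointness and greedy choice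

data Walk {A : Set} (R : A → A → Set) : A → List A → Set where
  []  : ∀ {x} → Walk R x []
  _∷_ : ∀ {x y ys} → R x y → Walk R y ys → Walk R x (y ∷ ys)

end : ∀ {A : Set} → A → List A → A
end x [] = x
end x (y ∷ ys) = end y ys

end-∷ʳ : ∀ {A : Set} (x : A) xs {y} → end x (xs ++ y ∷ []) ≡ y
end-∷ʳ x [] = refl
end-∷ʳ x (z ∷ xs) = end-∷ʳ z xs

module _ {A : Set} {R : A → A → Set} where

  Walk-++ : ∀ {x} xs {ys} → Walk R x xs → Walk R (end x xs) ys → Walk R x (xs ++ ys)
  Walk-++ [] [] w = w
  Walk-++ (x ∷ xs) (r ∷ v) w = r ∷ Walk-++ xs v w

  Walk-++⁻ˡ : ∀ {x} xs {ys} → Walk R x (xs ++ ys) → Walk R x xs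
  Walk-++⁻ˡ [] w = []
  Walk-++⁻ˡ (x ∷ xs) (r ∷ w) = r ∷ Walk-++⁻ˡ xs w

  Walk-++⁻ʳ : ∀ {x} xs {ys} → Walk R x (xs ++ ys) → Walk R (end x xs) ys
  Walk-++⁻ʳ [] w = w
  Walk-++⁻ʳ (x ∷ xs) (r ∷ w) = Walk-++⁻ʳ xs w

  walk-head : ∀ {x y ys} → Walk R x (y ∷ ys) → R x y
  walk-head (r ∷ _) = r

  walk-tail : ∀ {x y ys} → Walk R x (y ∷ ys) → Walk R y ys
  walk-tail (_ ∷ w) = w

  Walk-reverse : (∀ {a b} → R a b → R b a) → ∀ {x} ys {z} → Walk R x (ys ++ z ∷ []) →
                 Walk R z (reverse ys ++ x ∷ [])
  Walk-reverse s [] (r ∷ []) = s r ∷ []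
  Walk-reverse s {x} (y ∷ ys) {z} (r ∷ w) =
    subst (Walk R z) (cong (_++ x ∷ []) (sym (unfold-reverse y ys)))
      (Walk-++ (reverse ys ++ y ∷ []) (Walk-reverse s ys w)
        (subst (λ v → Walk R v (x ∷ [])) (sym (end-∷ʳ z (reverse ys))) (s r ∷ [])))

Walk-map : ∀ {A B : Set} {R : A → A → Set} {R′ : B → B → Set} (f : A → B) →
           (∀ {a b} → R a b → R′ (f a) (f b)) → ∀ {x xs} → Walk R x xs → Walk R′ (f x) (map f xs)
Walk-map f h [] = []
Walk-map f h (r ∷ w) = h r ∷ Walk-map f h w

end-++ : ∀ {A : Set} (x : A) xs ys → end x (xs ++ ys) ≡ end (end x xs) ys
end-++ x [] ys = refl
end-++ x (y ∷ xs) ys = end-++ y xs ys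

end-∈ : ∀ {A : Set} (x : A) xs → end x xs ∈ x ∷ xs
end-∈ x [] = here refl
end-∈ x (y ∷ xs) = there (end-∈ y xs)

Disjoint : ∀ {A : Set} → List A → List A → Set
Disjoint xs ys = ∀ {v} → v ∈ xs → v ∉ ys

Unique-++ : ∀ {A : Set} {xs ys : List A} → Unique xs → Unique ys → Disjoint xs ys → Unique (xs ++ ys)
Unique-++ u v d = ++⁺ u v (λ { (a , b) → d a b })

Disjoint-++ˡ : ∀ {A : Set} {xs ys zs : List A} → Disjoint xs zs → Disjoint ys zs → Disjoint (xs ++ ys) zs
Disjoint-++ˡ {xs = xs} d e v∈ with ∈-++⁻ xs v∈
... | inj₁ a = d a
... | inj₂ b = e b

∈-reverse⁻ : ∀ {A : Set} {v : A} xs → v ∈ reverse xs → v ∈ xs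
∈-reverse⁻ (x ∷ xs) v∈ rewrite unfold-reverse x xs with ∈-++⁻ (reverse xs) v∈
... | inj₁ a = there (∈-reverse⁻ xs a)
... | inj₂ (here refl) = here refl

Unique-reverse : ∀ {A : Set} (xs : List A) → Unique xs → Unique (reverse xs)
Unique-reverse [] _ = []
Unique-reverse (x ∷ xs) (x∉ ∷ u) rewrite unfold-reverse x xs =
  Unique-++ (Unique-reverse xs u) ([] ∷ [])
    (λ { v∈ (here refl) → All.lookup x∉ (∈-reverse⁻ xs v∈) refl })

Unique-prefix : ∀ {A : Set} (xs : List A) {ys} → Unique (xs ++ ys) → Unique xs
Unique-prefix [] _ = []
Unique-prefix (x ∷ xs) (h ∷ u) = All.tabulate (λ m → All.lookup h (∈-++⁺ˡ m)) ∷ Unique-prefix xs u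

last∉ : ∀ {A : Set} (xs : List A) {z} → Unique (xs ++ z ∷ []) → z ∉ xs
last∉ (x ∷ xs) (h ∷ u) (here refl) = All.lookup h (∈-++⁺ʳ xs (here refl)) refl
last∉ (x ∷ xs) (h ∷ u) (there m) = last∉ xs u m

Unique-map : ∀ {A B : Set} (f : A → B) → (∀ {x y} → f x ≡ f y → x ≡ y) → ∀ {xs} → Unique xs → Unique (map f xs)
Unique-map f inj = map⁺ inj

-- Each chosen list joins the set to be avoided by the later ones. This set never outgrows
-- `r * c + length X`.
choose : ∀ {A : Set} r (Q : Fin r → List A → Set) c b →
         (∀ i X → length X ≤ b → ∃[ l ] Q i l × length l ≤ c × Disjoint l X) →
         ∀ X → r * c + length X ≤ b →
         Σ (Fin r → List A) λ l → (∀ i → Q i (l i) × Disjoint (l i) X) × (∀ i j → i ≢ j → Disjoint (l i) (l j))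
choose zero Q c b h X bd = (λ ()) , (λ ()) , (λ ())
choose {A} (suc r) Q c b h X bd with h zero X (≤-trans (m≤n+m _ _) bd)
... | l₀ , q₀ , len₀ , dis₀
  with choose r (Q ∘ suc) c b (h ∘ suc) (l₀ ++ X) (≤-trans (≤-reflexive (cong (r * c +_) (length-++ l₀)))
         (≤-trans (+-monoʳ-≤ (r * c) (+-monoˡ-≤ (length X) len₀))
           (≤-trans (≤-reflexive (trans (sym (+-assoc (r * c) c _)) (cong (_+ length X) (+-comm (r * c) c)))) bd)))
... | l , q , dis = l′ , q′ , dis′
  where
  l′ : Fin (suc r) → List A
  l′ zero = l₀
  l′ (suc i) = l i
  q′ : ∀ i → Q i (l′ i) × Disjoint (l′ i) X
  q′ zero = q₀ , dis₀
  q′ (suc i) = proj₁ (q i) , λ v∈ v∈X → proj₂ (q i) v∈ (∈-++⁺ʳ l₀ v∈X)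
  dis′ : ∀ i j → i ≢ j → Disjoint (l′ i) (l′ j)
  dis′ zero zero ne = ⊥-elim (ne refl)
  dis′ zero (suc j) _ v∈ w∈ = proj₂ (q j) w∈ (∈-++⁺ˡ v∈)
  dis′ (suc i) zero _ v∈ w∈ = proj₂ (q i) v∈ (∈-++⁺ˡ w∈)
  dis′ (suc i) (suc j) ne = dis i j (ne ∘ cong suc)

at : ∀ {A : Set} {κ} (l : List A) → length l ≡ κ → Fin κ → A
at l refl i = lookup l i

at-∈ : ∀ {A : Set} {κ} (l : List A) (e : length l ≡ κ) i → at l e i ∈ l
at-∈ l refl i = ∈-lookup i

at-injective : ∀ {A : Set} {κ} (l : List A) (e : length l ≡ κ) → Unique l → ∀ i j → at l e i ≡ at l e j → i ≡ j
at-injective l refl u = go l u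
  where
  go : ∀ {A : Set} (l : List A) → Unique l → ∀ i j → lookup l i ≡ lookup l j → i ≡ j
  go (x ∷ l) _ zero zero _ = refl
  go (x ∷ l) (x∉ ∷ _) zero (suc j) e = ⊥-elim (All.lookup x∉ (∈-lookup {xs = l} j) e)
  go (x ∷ l) (x∉ ∷ _) (suc i) zero e = ⊥-elim (All.lookup x∉ (∈-lookup {xs = l} i) (sym e))
  go (x ∷ l) (_ ∷ u) (suc i) (suc j) e = cong suc (go l u i j e)

module _ {A : Set} {R : A → A → Set} where

  walk-first : ∀ {κ x y} (l : List A) (e : length l ≡ κ) → Walk R x (l ++ y ∷ []) →
               ∀ i → toℕ i ≡ 0 → R x (at l e i)
  walk-first (z ∷ l) refl (r ∷ w) zero _ = r

  walk-next : ∀ {κ x y} (l : List A) (e : length l ≡ κ) → Walk R x (l ++ y ∷ []) →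
              ∀ i j → suc (toℕ i) ≡ toℕ j → R (at l e i) (at l e j)
  walk-next (z ∷ l) refl (_ ∷ w) zero (suc j) eq = walk-first l refl w j (suc-injective (sym eq))
  walk-next (z ∷ l) refl (_ ∷ w) (suc i) (suc j) eq = walk-next l refl w i j (suc-injective eq)

  walk-last : ∀ {κ x y} (l : List A) (e : length l ≡ κ) → Walk R x (l ++ y ∷ []) →
              ∀ i → suc (toℕ i) ≡ κ → R (at l e i) y
  walk-last (z ∷ []) refl (_ ∷ r ∷ []) zero _ = r
  walk-last (z ∷ z′ ∷ l) refl (_ ∷ w) (suc i) eq = walk-last (z′ ∷ l) refl w i (suc-injective eq)

length-concat-tabulate : ∀ {A : Set} {s} (f : Fin s → List A) c → (∀ i → length (f i) ≡ c) →
                         length (concat (tabulate f)) ≡ s * c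
length-concat-tabulate {s = zero} f c h = refl
length-concat-tabulate {s = suc s} f c h = trans (length-++ (f zero))
  (cong₂ _+_ (h zero) (length-concat-tabulate (f ∘ suc) c (h ∘ suc)))

∈-concat-tabulate : ∀ {A : Set} {s} (f : Fin s → List A) i {v} → v ∈ f i → v ∈ concat (tabulate f)
∈-concat-tabulate f i v∈ = ∈-concat⁺′ v∈ (∈-tabulate⁺ i)

∈-concat-tabulate⁻ : ∀ {A : Set} {s} (f : Fin s → List A) {v} → v ∈ concat (tabulate f) → ∃[ i ] v ∈ f i
∈-concat-tabulate⁻ f v∈ with ∈-concat⁻′ (tabulate f) v∈
... | xs , v∈xs , xs∈ with ∈-tabulate⁻ xs∈
... | i , refl = i , v∈xs

-- Subdivisions assembled from spiders with common ends

module Assembly {n} (G : SimpleGraph n) (s t κ : ℕ) where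

  open Graph G

  -- `leg i` consists of the κ internal vertices of a path of length κ + 1 from `x i` to the centre.
  -- The ends `x i` are kept off the legs and the centre by being members of `X` in all uses.
  record LeggedSpider (x : Fin s → V) (X : List V) : Set where
    field
      centre : V
      leg    : Fin s → List V
      len    : ∀ i → length (leg i) ≡ κ
      walk   : ∀ i → Walk _~_ (x i) (leg i ++ centre ∷ [])
      leg!   : ∀ i → Unique (leg i)
      apart  : ∀ i j → i ≢ j → Disjoint (leg i) (leg j)
      centre∉ : ∀ i → centre ∉ leg i
      legX   : ∀ i → Disjoint (leg i) X
      centreX : centre ∉ X

  -- Room for the `t` spiders, each with a centre and `s * κ` leg vertices, and for the `s` common
  -- ends.
  bound : ℕ
  bound = t * suc (s * κ) + s

  -- Spiders with the same ends, found again and again off the earlier ones, form the subdivision: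
  -- the ends become the left branch vertices and the `t` centres the right ones.
  assemble : (x : Fin s → V) → (∀ i j → x i ≡ x j → i ≡ j) →
             (∀ X → (∀ i → x i ∈ X) → length X ≤ bound → LeggedSpider x X) →
             ContainsSubdivKst G s t (suc κ)
  assemble x x-inj spiders = f , (λ {u} {v} → f-inj u v) , f-edge
    where
    xs : List V
    xs = tabulate x
    Q : Fin t → List V → Set
    Q _ l = Σ (LeggedSpider x xs) λ S → l ≡ LeggedSpider.centre S ∷ concat (tabulate (LeggedSpider.leg S))
    step : ∀ i X → length X ≤ t * suc (s * κ) → ∃[ l ] Q i l × length l ≤ suc (s * κ) × Disjoint l X
    step i X lX = _ , (S , refl) , ≤-reflexive (cong suc (length-concat-tabulate leg κ len)) , dis
      where
      S′ : LeggedSpider x (X ++ xs)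
      S′ = spiders (X ++ xs) (λ i → ∈-++⁺ʳ X (∈-tabulate⁺ i))
        (≤-trans (≤-reflexive (length-++ X)) (+-mono-≤ lX (≤-reflexive (length-tabulate x))))
      open LeggedSpider S′
      S : LeggedSpider x xs
      S = record { centre = centre ; leg = leg ; len = len ; walk = walk ; leg! = leg! ; apart = apart
        ; centre∉ = centre∉ ; legX = λ i v∈ w∈ → legX i v∈ (∈-++⁺ʳ X w∈) ; centreX = λ c∈ → centreX (∈-++⁺ʳ X c∈) }
      dis : Disjoint (centre ∷ concat (tabulate leg)) X
      dis (here refl) w∈ = centreX (∈-++⁺ˡ w∈)
      dis (there v∈) w∈ with ∈-concat-tabulate⁻ leg v∈
      ... | j , v∈j = legX j v∈j (∈-++⁺ˡ w∈)
    chosen = choose t Q (suc (s * κ)) (t * suc (s * κ)) step [] (≤-reflexive (+-identityʳ _))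
    verts : Fin t → List V
    verts = proj₁ chosen
    S : ∀ m → LeggedSpider x xs
    S m = proj₁ (proj₁ (proj₁ (proj₂ chosen) m))
    verts≡ : ∀ m → verts m ≡ LeggedSpider.centre (S m) ∷ concat (tabulate (LeggedSpider.leg (S m)))
    verts≡ m = proj₂ (proj₁ (proj₁ (proj₂ chosen) m))
    disj : ∀ m m′ → m ≢ m′ → Disjoint (verts m) (verts m′)
    disj = proj₂ (proj₂ chosen)
    y : Fin t → V
    y m = LeggedSpider.centre (S m)
    P : Fin s → Fin t → Fin κ → V
    P i m = at (LeggedSpider.leg (S m) i) (LeggedSpider.len (S m) i)
    P∈ : ∀ i m l → P i m l ∈ LeggedSpider.leg (S m) i
    P∈ i m l = at-∈ (LeggedSpider.leg (S m) i) (LeggedSpider.len (S m) i) l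
    y∈verts : ∀ m → y m ∈ verts m
    y∈verts m rewrite verts≡ m = here refl
    P∈verts : ∀ i m l → P i m l ∈ verts m
    P∈verts i m l rewrite verts≡ m = there (∈-concat-tabulate (LeggedSpider.leg (S m)) i (P∈ i m l))
    same : ∀ m m′ {v} → v ∈ verts m → v ∈ verts m′ → m ≡ m′
    same m m′ a b with m ≟F m′
    ... | yes e = e
    ... | no ne = ⊥-elim (disj m m′ ne a b)
    f : SubdivVertex s t (suc κ) → V
    f (left i) = x i
    f (right m) = y m
    f (inner i m l) = P i m l
    x≢y : ∀ i m → x i ≢ y m
    x≢y i m e = LeggedSpider.centreX (S m) (subst (_∈ xs) e (∈-tabulate⁺ i))
    x≢P : ∀ i j m l → x i ≢ P j m l
    x≢P i j m l e = LeggedSpider.legX (S m) j (P∈ j m l) (subst (_∈ xs) e (∈-tabulate⁺ i))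
    y≢P : ∀ m′ i m l → y m′ ≢ P i m l
    y≢P m′ i m l e with same m′ m (y∈verts m′) (subst (_∈ verts m) (sym e) (P∈verts i m l))
    ... | refl = LeggedSpider.centre∉ (S m) i (subst (_∈ LeggedSpider.leg (S m) i) (sym e) (P∈ i m l))
    f-inj : ∀ u v → f u ≡ f v → u ≡ v
    f-inj (left i) (left j) e = cong left (x-inj i j e)
    f-inj (left i) (right m) e = ⊥-elim (x≢y i m e)
    f-inj (left i) (inner j m l) e = ⊥-elim (x≢P i j m l e)
    f-inj (right m) (left i) e = ⊥-elim (x≢y i m (sym e))
    f-inj (right m) (right m′) e = cong right (same m m′ (y∈verts m) (subst (_∈ verts m′) (sym e) (y∈verts m′)))
    f-inj (right m) (inner j m′ l) e = ⊥-elim (y≢P m j m′ l e)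
    f-inj (inner i m l) (left j) e = ⊥-elim (x≢P j i m l (sym e))
    f-inj (inner i m l) (right m′) e = ⊥-elim (y≢P m′ i m l (sym e))
    f-inj (inner i m l) (inner j m′ l′) e
      with same m m′ (P∈verts i m l) (subst (_∈ verts m′) (sym e) (P∈verts j m′ l′))
    ... | refl with i ≟F j
    ... | no ne = ⊥-elim (LeggedSpider.apart (S m) i j ne (P∈ i m l)
                    (subst (_∈ LeggedSpider.leg (S m) j) (sym e) (P∈ j m l′)))
    ... | yes refl = cong (inner i m) (at-injective (LeggedSpider.leg (S m) i) (LeggedSpider.len (S m) i) (LeggedSpider.leg! (S m) i) l l′ e)
    f-edge : ∀ u v → SubdivEdge s t (suc κ) u v → adj G (f u) (f v) ≡ true
    f-edge _ _ (e-left i m l z) = walk-first (LeggedSpider.leg (S m) i) (LeggedSpider.len (S m) i) (LeggedSpider.walk (S m) i) l z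
    f-edge _ _ (e-mid i m l l′ z) = walk-next (LeggedSpider.leg (S m) i) (LeggedSpider.len (S m) i) (LeggedSpider.walk (S m) i) l l′ z
    f-edge _ _ (e-right i m l z) = walk-last (LeggedSpider.leg (S m) i) (LeggedSpider.len (S m) i) (LeggedSpider.walk (S m) i) l z

-- Families of embeddings, their fibres, flexibility and cleaning

module Families (T : RootedTree) (Ω : Host) (U : Sample T Ω) where

  open Tree T Ω
  open Sample U public

  Fam : Set
  Fam = Emb → Bool

  _∈ᶠ_ : Emb → Fam → Set
  σ ∈ᶠ f = σ ∈ 𝒰 × f σ ≡ true

  size : Fam → ℕ
  size f = # f 𝒰

  inFib : Fam → PSet → Emb → Fam
  inFib f S σ τ = f τ ∧ agree S σ τ

  fib : Fam → PSet → Emb → ℕ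
  fib f S σ = size (inFib f S σ)

  inFib-intro : ∀ {f S σ τ} → f τ ≡ true → Agree S σ τ → inFib f S σ τ ≡ true
  inFib-intro {f} {S} {σ} {τ} h a = ∧-intro h (true-does (agree? S σ τ) a)

  inFib-elim : ∀ f S σ τ → inFib f S σ τ ≡ true → f τ ≡ true × Agree S σ τ
  inFib-elim f S σ τ h = let a , b = ∧-true {f τ} h in a , does-true (agree? S σ τ) b

  fib-mono : ∀ {f f′ S S′} σ σ′ → (∀ τ → τ ∈ 𝒰 → f τ ≡ true → Agree S σ τ → f′ τ ≡ true × Agree S′ σ′ τ) →
             fib f S σ ≤ fib f′ S′ σ′
  fib-mono {f} {f′} {S} {S′} σ σ′ h = #-mono 𝒰 (λ τ τ∈ k →
    let a , b = inFib-elim f S σ τ k ; a′ , b′ = h τ τ∈ a b in inFib-intro {f′} {S′} a′ b′)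

  fib-complete : ∀ f S σ → gap full S ≡ 0 → fib f S σ ≤ 1
  fib-complete f S σ g = ≤-trans (#-mono 𝒰 (λ τ _ k → let _ , a = inFib-elim f S σ τ k in
    true-does (agree? full σ τ) (λ p _ → a p (gap-0 full S g p refl)))) (sep σ)

  -- A nonempty fibre contains a member of the family, and it is also the fibre of that member.
  bound-everywhere : ∀ f S b → (∀ σ → σ ∈ᶠ f → fib f S σ ≤ b) → ∀ z → fib f S z ≤ b
  bound-everywhere f S b h z with 0 <? fib f S z
  ... | no ¬p = ≤-trans (≮⇒≥ ¬p) z≤n
  ... | yes p = let τ , τ∈ , k = #-pos (inFib f S z) 𝒰 p ; a , b = inFib-elim f S z τ k in
    ≤-trans (fib-mono {f} {f} {S} {S} z τ (λ υ _ x y → x , Agree-trans S (Agree-sym S b) y)) (h τ (τ∈ , a))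

  -- A single fixed position generates the whole tree, so `grow` applies to the pattern of `σ` on
  -- `S`.
  fib≤Δ^ : ∀ f S p σ → S p ≡ true → fib f S σ ≤ Δ ^ gap full S
  fib≤Δ^ f S p σ s =
    let Z , c , l = grow (gap full S) S full refl (Conn-full S p s) (Agree S σ) (σ ∷ [])
                      (λ _ _ a → σ , here refl , a)
    in ≤-trans
      (#-union (λ z τ → agree full z τ) 𝒰 Z (λ τ τ∈ k →
        let z , z∈ , a = c τ (proj₁ (ok τ τ∈)) (proj₂ (inFib-elim f S σ τ k)) in z , z∈ , true-does (agree? full z τ) a))
      (≤-trans (∑-≤-const Z 1 (λ z _ → sep z)) (≤-trans (≤-reflexive (*-identityʳ _))
        (≤-trans l (≤-reflexive (*-identityˡ _)))))

  Keys : PSet → List Emb → Set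
  Keys S Z = ∀ σ → σ ∈ 𝒰 → ∃[ z ] z ∈ Z × Agree S z σ

  -- There are `n` choices at `r`, and connectedness leaves at most `Δ` for each further position of
  -- `R`.
  connected-keys : ∀ R r → R r ≡ true → Conn (sing r) R →
                   ∃[ Z ] Keys R Z × length Z ≤ n * Δ ^ gap R (sing r)
  connected-keys R r h cn =
    let Z , c , l = grow (gap R (sing r)) (sing r) R refl cn (λ _ → 0 ≡ 0) (map (λ v _ → v) vs)
          (λ σ _ _ → (λ _ → σ r) , ∈-map⁺ (λ v _ → v) (∈-allFin (σ r)) ,
                     λ p k → cong σ (sym (does-true (p ≟ r) k)))
    in Z , (λ σ σ∈ → c σ (proj₁ (ok σ σ∈)) refl)
         , ≤-trans l (≤-reflexive (cong (_* Δ ^ gap R (sing r)) (trans (length-map′ _ vs) (length-tabulate {n = n} (λ i → i)))))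

  ⟦_⟧ : List P → PSet
  ⟦ [] ⟧ _ = false
  ⟦ p ∷ ps ⟧ = add ⟦ ps ⟧ p

  ∈⟦⟧ : ∀ ps {p} → p ∈ ps → ⟦ ps ⟧ p ≡ true
  ∈⟦⟧ (q ∷ ps) (here refl) = add-∋ ⟦ ps ⟧ q
  ∈⟦⟧ (q ∷ ps) (there p∈) = add-⊇ ⟦ ps ⟧ q (∈⟦⟧ ps p∈)

  ⟦⟧∈ : ∀ ps {p} → ⟦ ps ⟧ p ≡ true → p ∈ ps
  ⟦⟧∈ (q ∷ ps) h with add⁻ ⟦ ps ⟧ q h
  ... | inj₁ k = there (⟦⟧∈ ps k)
  ... | inj₂ refl = here refl

  ∉⟦⟧ : ∀ ps {p} → p ∉ ps → ⟦ ps ⟧ p ≡ false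
  ∉⟦⟧ ps p∉ = ¬true⇒false (λ h → p∉ (⟦⟧∈ ps h))

  closed-walk : ∀ {S′ R : PSet} → (∀ p q → Adj p q → S′ p ≡ true → R q ≡ true → S′ q ≡ true) →
                ∀ {x ys} → S′ x ≡ true → Walk Adj x ys → (∀ {q} → q ∈ ys → R q ≡ true) → ∀ {q} → q ∈ ys → S′ q ≡ true
  closed-walk cl s (a ∷ w) r (here refl) = cl _ _ a s (r (here refl))
  closed-walk cl s (a ∷ w) r (there q∈) = closed-walk cl (cl _ _ a s (r (here refl))) w (r ∘ there) q∈

  Conn-walk : ∀ {R p ps} → Walk Adj p ps → (∀ {q} → q ∈ ps → R q ≡ true) → (∀ {q} → R q ≡ true → q ∈ p ∷ ps) →
              Conn (sing p) R
  Conn-walk {R} {p} w ps⊆ ⊆ps S′ sub cl q h with ⊆ps h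
  ... | here refl = sub p (true-does (p ≟ p) refl)
  ... | there q∈ = closed-walk {S′} {R} cl (sub p (true-does (p ≟ p) refl)) w ps⊆ q∈

  -- For positions without any tree structure, such as the leaves, all tuples are taken. The given
  -- vertex is a default value at the other positions.
  free-keys : V → ∀ ps → ∃[ Z ] Keys ⟦ ps ⟧ Z × length Z ≡ n ^ length ps
  free-keys v [] = (λ _ → v) ∷ [] , (λ σ _ → _ , here refl , λ _ ()) , refl
  free-keys v (p ∷ ps) with free-keys v ps
  ... | Z , c , l = concatMap ext Z
    , (λ σ σ∈ → let z , z∈ , a = c σ σ∈ in
        upd z p (σ p) , ∈-concatMap ext z∈ (∈-map⁺ (upd z p) (∈-allFin (σ p))) , upd-agree ⟦ ps ⟧ p a)
    , trans (length-concatMap ext Z) (trans (∑-cong Z (λ z _ → trans (length-map′ _ vs) (length-tabulate {n = n} (λ i → i))))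
        (trans (∑-const Z n) (trans (cong (_* n) l) (*-comm (n ^ length ps) n))))
    where
    ext : Emb → List Emb
    ext z = map (upd z p) vs

  size-by-keys : ∀ f S b Z → Keys S Z → (∀ σ → σ ∈ᶠ f → fib f S σ ≤ b) → size f ≤ length Z * b
  size-by-keys f S b Z c h = ≤-trans
    (#-union (λ z → inFib f S z) 𝒰 Z (λ τ τ∈ k → let z , z∈ , a = c τ τ∈ in z , z∈ , inFib-intro {f} {S} k a))
    (∑-≤-const Z b (λ z _ → bound-everywhere f S b h z))

  -- The moved embedding lies in `f` again, so moves for different sets `S` can be alternated;
  -- everything off `S` leaves `X` at once.
  Flex : Fam → PSet → ℕ → Set
  Flex f S B = ∀ σ → σ ∈ᶠ f → ∀ X → length X ≤ B →
               ∃[ τ ] τ ∈ᶠ f × Agree S σ τ × (∀ p → S p ≡ false → τ p ∉ X)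

  -- A fibre that avoids no X has, by pigeonhole, a large subfibre through some p and some x ∈ X.
  flex : ∀ f S B b → (∀ σ → σ ∈ᶠ f → N * B * b < fib f S σ) →
         (∀ p → S p ≡ false → ∀ τ → τ ∈ᶠ f → fib f (add S p) τ ≤ b) → Flex f S B
  flex f S B b big small σ σ∈ X lX = go (find (λ τ → inFib f S σ τ ∧ not (hitsX τ)) 𝒰)
    where
    hit : Emb → P → Bool
    hit τ p = not (S p) ∧ does (memberOf _≟F_ (τ p) X)
    hitsX : Emb → Bool
    hitsX τ = does (0 <? # (hit τ) all)
    through : P × V → Fam
    through (p , x) τ = inFib f S σ τ ∧ (not (S p) ∧ does (τ p ≟F x))
    through≤ : ∀ px → size (through px) ≤ b
    through≤ (p , x) with 0 <? size (through (p , x))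
    ... | no ¬p = ≤-trans (≮⇒≥ ¬p) z≤n
    ... | yes pos =
      let τ , τ∈ , k = #-pos (through (p , x)) 𝒰 pos
          k₁ , k₂ = ∧-true {inFib f S σ τ} k
          fτ , a = inFib-elim f S σ τ k₁
          s , e = ∧-true {not (S p)} k₂
      in ≤-trans (#-mono 𝒰 (λ υ _ l →
           let l₁ , l₂ = ∧-true {inFib f S σ υ} l
               fυ , a′ = inFib-elim f S σ υ l₁
               _ , e′ = ∧-true {not (S p)} l₂
           in inFib-intro {f} {add S p} {τ} {υ} fυ (λ q h → same τ υ a a′ (trans (does-true (τ p ≟F x) e) (sym (does-true (υ p ≟F x) e′))) q h)))
         (small p (not-true s) τ (τ∈ , fτ))
      where
      same : ∀ τ υ → Agree S σ τ → Agree S σ υ → τ p ≡ υ p → Agree (add S p) τ υ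
      same τ υ a a′ e q h with add⁻ S p h
      ... | inj₁ sq = trans (sym (a q sq)) (a′ q sq)
      ... | inj₂ refl = e
    go : _ → _
    go (inj₁ (τ , τ∈ , k)) =
      let k₁ , k₂ = ∧-true {inFib f S σ τ} k
          fτ , a = inFib-elim f S σ τ k₁
      in τ , (τ∈ , fτ) , a , (λ p s x∈ → true≢false
           (true-does (0 <? # (hit τ) all) (#-∈ (all∈ p) (∧-intro (not-false s) (true-does (memberOf _≟F_ (τ p) X) x∈))))
           (not-true k₂))
    go (inj₂ none) = ⊥-elim (<-irrefl refl (<-≤-trans (big σ σ∈)
      (≤-trans (#-union through 𝒰 (cartesianProduct all X) hits)
        (≤-trans (∑-≤-const (cartesianProduct all X) b (λ px _ → through≤ px))
          (*-monoˡ-≤ b (≤-trans (≤-reflexive (length-× all X)) (*-monoʳ-≤ N lX)))))))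
      where
      hits : ∀ τ → τ ∈ 𝒰 → inFib f S σ τ ≡ true → ∃[ px ] px ∈ cartesianProduct all X × through px τ ≡ true
      hits τ τ∈ k with hitsX τ in eq
      ... | false = ⊥-elim (true≢false (∧-intro k (not-false eq)) (none τ τ∈))
      ... | true =
        let p , p∈ , h = #-pos (hit τ) all (does-true (0 <? # (hit τ) all) eq)
            s , m = ∧-true {not (S p)} h
        in (p , τ p) , ∈-cartesianProduct⁺ p∈ (does-true (memberOf _≟F_ (τ p) X) m)
         , ∧-intro k (∧-intro s (true-does (τ p ≟F τ p) refl))

  -- Deleting a fibre below its threshold T j lowers the cost by at least T j, so the inequality
  -- cost < Γ · size survives until no such fibre is left.
  module Cleaning {J : Set} (js : List J) (S : J → PSet) (T : J → ℕ) (Z : J → List Emb) (Γ : ℕ) where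

    alive : Fam → J → Emb → Bool
    alive f j z = does (0 <? fib f (S j) z)

    cost : Fam → ℕ
    cost f = ∑ js (λ j → T j * # (alive f j) (Z j))

    thin : Fam → J × Emb → Bool
    thin f (j , σ) = f σ ∧ does (Γ * fib f (S j) σ <? T j)

    discard : Fam → J → Emb → Fam
    discard f j σ τ = f τ ∧ not (agree (S j) σ τ)

    discard-mono : ∀ f j σ i z → fib (discard f j σ) (S i) z ≤ fib f (S i) z
    discard-mono f j σ i z = fib-mono {discard f j σ} {f} {S i} {S i} z z (λ τ _ k a → proj₁ (∧-true {f τ} k) , a)

    cost-discard : ∀ f j σ → j ∈ js → σ ∈ᶠ f → (∃[ z ] z ∈ Z j × Agree (S j) z σ) →
                cost (discard f j σ) + T j ≤ cost f
    cost-discard f j σ j∈ (σ∈ , fσ) (z , z∈ , a) =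
      ∑-mono-drop _ _ j∈ (T j)
        (λ i _ → *-monoʳ-≤ (T i) (#-mono (Z i) (λ y _ → mono i y)))
        (≤-trans (≤-reflexive (lem (T j) (# (alive (discard f j σ) j) (Z j))))
          (*-monoʳ-≤ (T j) (∑-mono-drop _ _ z∈ 1 (λ y _ → 𝟙-mono (mono j y)) strict)))
      where
      mono : ∀ i y → alive (discard f j σ) i y ≡ true → alive f i y ≡ true
      mono i y h = true-does (0 <? fib f (S i) y)
        (≤-trans (does-true (0 <? fib (discard f j σ) (S i) y) h) (discard-mono f j σ i y))
      lem : ∀ t k → t * k + t ≡ t * (k + 1)
      lem = solve-∀
      dead : alive (discard f j σ) j z ≡ false
      dead = false-does (0 <? _) (λ pos →
        let τ , _ , k = #-pos (inFib (discard f j σ) (S j) z) 𝒰 pos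
            k₁ , b = inFib-elim (discard f j σ) (S j) z τ k
            _ , k₂ = ∧-true {f τ} k₁
        in true≢false (true-does (agree? (S j) σ τ) (Agree-trans (S j) (Agree-sym (S j) a) b)) (not-true k₂))
      strict : 𝟙 (alive (discard f j σ) j z) + 1 ≤ 𝟙 (alive f j z)
      strict rewrite dead | true-does (0 <? fib f (S j) z) (#-∈ σ∈ (inFib-intro {f} {S j} {z} {σ} fσ a)) = ≤-refl

    clean : ∀ k f → size f ≤ k → (∀ j → j ∈ js → ∀ σ → σ ∈ᶠ f → ∃[ z ] z ∈ Z j × Agree (S j) z σ) →
            cost f < Γ * size f →
            ∃[ f′ ] (∀ σ → f′ σ ≡ true → f σ ≡ true) × (∃[ σ ] σ ∈ᶠ f′) ×
                    (∀ j → j ∈ js → ∀ σ → σ ∈ᶠ f′ → T j ≤ Γ * fib f′ (S j) σ)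
    clean k f sz keys cst with find (thin f) (cartesianProduct js 𝒰)
    ... | inj₂ none = f , (λ _ h → h) , nonempty
      , (λ j j∈ σ (σ∈ , fσ) → ≮⇒≥ (λ lt → true≢false (∧-intro fσ (true-does (Γ * fib f (S j) σ <? T j) lt))
          (none (j , σ) (∈-cartesianProduct⁺ j∈ σ∈))))
      where
      nonempty : ∃[ σ ] σ ∈ᶠ f
      nonempty with 0 <? size f
      ... | yes pos = let σ , σ∈ , fσ = #-pos f 𝒰 pos in σ , σ∈ , fσ
      ... | no ¬pos = ⊥-elim (<⇒≱ (<-≤-trans cst (≤-reflexive (trans (cong (Γ *_) (n≤0⇒n≡0 (≮⇒≥ ¬pos))) (*-zeroʳ Γ)))) z≤n)
    ... | inj₁ ((j , σ) , jσ∈ , h) = step k sz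
      where
      j∈ = proj₁ (∈-cartesianProduct⁻ js 𝒰 jσ∈)
      σ∈ = proj₂ (∈-cartesianProduct⁻ js 𝒰 jσ∈)
      fσ = proj₁ (∧-true {f σ} h)
      small = does-true (Γ * fib f (S j) σ <? T j) (proj₂ (∧-true {f σ} h))
      f₁ = discard f j σ
      split : size f ≡ fib f (S j) σ + size f₁
      split = #-split f (agree (S j) σ) 𝒰
      smaller : size f₁ < size f
      smaller = ≤-trans (+-monoˡ-≤ (size f₁) (#-∈ σ∈ (inFib-intro {f} {S j} {σ} {σ} fσ (λ _ _ → refl))))
        (≤-reflexive (sym split))
      cst₁ : cost f₁ < Γ * size f₁
      cst₁ = +-cancelˡ-< (T j) _ _ (begin-strict
        T j + cost f₁                         ≡⟨ +-comm (T j) _ ⟩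
        cost f₁ + T j                         ≤⟨ cost-discard f j σ j∈ (σ∈ , fσ) (keys j j∈ σ (σ∈ , fσ)) ⟩
        cost f                                <⟨ cst ⟩
        Γ * size f                            ≡⟨ cong (Γ *_) split ⟩
        Γ * (fib f (S j) σ + size f₁)         ≡⟨ *-distribˡ-+ Γ (fib f (S j) σ) (size f₁) ⟩
        Γ * fib f (S j) σ + Γ * size f₁       ≤⟨ +-monoˡ-≤ (Γ * size f₁) (<⇒≤ small) ⟩
        T j + Γ * size f₁                     ∎)
        where open ≤-Reasoning
      step : ∀ k → size f ≤ k → _
      step zero sz = ⊥-elim (<⇒≱ (<-≤-trans smaller sz) z≤n)
      step (suc k) sz =
        let f′ , sub , ne , big = clean k f₁ (s≤s⁻¹ (≤-trans smaller sz))
              (λ i i∈ τ (τ∈ , k) → keys i i∈ τ (τ∈ , proj₁ (∧-true {f τ} k))) cst₁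
        in f′ , (λ τ k → proj₁ (∧-true {f τ} (sub τ k))) , ne , big

  -- This serves sets that are not connected: different patterns have disjoint fibres with at least
  -- `b` members each, so the patterns are few without any appeal to the tree. `k` bounds the
  -- recursion.
  representatives : ∀ S b k f → size f ≤ k → (∀ σ → σ ∈ᶠ f → b ≤ fib f S σ) →
                    ∃[ Z ] (∀ σ → σ ∈ᶠ f → ∃[ z ] z ∈ Z × Agree S z σ) × length Z * b ≤ size f
  representatives S b k f sz big with find f 𝒰
  ... | inj₂ none = [] , (λ σ (σ∈ , fσ) → ⊥-elim (true≢false fσ (none σ σ∈))) , z≤n
  ... | inj₁ (σ , σ∈ , fσ) = step k sz
    where
    f₁ : Fam
    f₁ τ = f τ ∧ not (agree S σ τ)
    split : size f ≡ fib f S σ + size f₁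
    split = #-split f (agree S σ) 𝒰
    big₁ : ∀ τ → τ ∈ᶠ f₁ → b ≤ fib f₁ S τ
    big₁ τ (τ∈ , k) = let fτ , k′ = ∧-true {f τ} k in
      ≤-trans (big τ (τ∈ , fτ)) (fib-mono {f} {f₁} {S} {S} τ τ (λ υ _ fυ a →
        ∧-intro fυ (not-false (false-does (agree? S σ υ) (λ a′ →
          true≢false (true-does (agree? S σ τ) (Agree-trans S a′ (Agree-sym S a))) (not-true k′)))) , a))
    step : ∀ k → size f ≤ k → _
    step zero sz = ⊥-elim (<⇒≱ (<-≤-trans (#-∈ σ∈ fσ) sz) z≤n)
    step (suc k) sz =
      let Z , c , l = representatives S b k f₁ (s≤s⁻¹ (≤-trans (≤-trans (+-monoˡ-≤ (size f₁)
                        (#-∈ σ∈ (inFib-intro {f} {S} {σ} {σ} fσ (λ _ _ → refl)))) (≤-reflexive (sym split))) sz)) big₁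
      in σ ∷ Z , cover Z c , ≤-trans (+-mono-≤ (big σ (σ∈ , fσ)) l) (≤-reflexive (sym split))
      where
      cover : ∀ Z → (∀ τ → τ ∈ᶠ f₁ → ∃[ z ] z ∈ Z × Agree S z τ) →
              ∀ τ → τ ∈ᶠ f → ∃[ z ] z ∈ σ ∷ Z × Agree S z τ
      cover Z c τ (τ∈ , fτ) with agree S σ τ in eq
      ... | true = σ , here refl , does-true (agree? S σ τ) eq
      ... | false = let z , z∈ , a = c τ (τ∈ , ∧-intro fτ (not-false eq)) in z , there z∈ , a

-- A maximal set of positions with large fibres

module HeavyFibres (T : RootedTree) (Ω : Host) (U : Sample T Ω)
  (L : RootedTree.P T → Bool) (lam : ℕ → ℕ) (lam0 : 1 ≤ lam 0)
  where

  open Tree T Ω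
  open Families T Ω U

  _⊆ₛ_ : PSet → PSet → Set
  S ⊆ₛ S′ = ∀ p → S p ≡ true → S′ p ≡ true

  supersets : List P → List PSet
  supersets [] = L ∷ []
  supersets (p ∷ ps) = concatMap (λ S → S ∷ add S p ∷ []) (supersets ps)

  supersets-⊇ : ∀ ps S → S ∈ supersets ps → L ⊆ₛ S
  supersets-⊇ [] S (here refl) p h = h
  supersets-⊇ (q ∷ ps) S S∈ p h with ∈-concatMap⁻′ (λ S → S ∷ add S q ∷ []) (supersets ps) S∈
  ... | S′ , S′∈ , here refl = supersets-⊇ ps S′ S′∈ p h
  ... | S′ , S′∈ , there (here refl) = add-⊇ S′ q (supersets-⊇ ps S′ S′∈ p h)

  -- Sets of positions are functions, so `S` is found only up to pointwise equality on `ps`. Fibres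
  -- and `gap` do not see the difference when `ps` is `all`.
  supersets-complete : ∀ ps S → L ⊆ₛ S →
    ∃[ S′ ] S′ ∈ supersets ps × S′ ⊆ₛ S × (∀ p → p ∈ ps → S p ≡ true → S′ p ≡ true)
  supersets-complete [] S L⊆ = L , here refl , L⊆ , λ _ ()
  supersets-complete (q ∷ ps) S L⊆ with supersets-complete ps S L⊆ | S q in eq
  ... | S′ , S′∈ , sub , hit | true = add S′ q , ∈-concatMap (λ S → S ∷ add S q ∷ []) S′∈ (there (here refl))
    , sub′ , hit′
    where
    sub′ : add S′ q ⊆ₛ S
    sub′ p h with add⁻ S′ q h
    ... | inj₁ s = sub p s
    ... | inj₂ refl = eq
    hit′ : ∀ p → p ∈ q ∷ ps → S p ≡ true → add S′ q p ≡ true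
    hit′ p (here refl) _ = add-∋ S′ p
    hit′ p (there p∈) s = add-⊇ S′ q (hit p p∈ s)
  ... | S′ , S′∈ , sub , hit | false = S′ , ∈-concatMap (λ S → S ∷ add S q ∷ []) S′∈ (here refl) , sub
    , (λ { p (here refl) s → ⊥-elim (true≢false s eq) ; p (there p∈) s → hit p p∈ s })

  𝓛 : List PSet
  𝓛 = supersets all

  top : ℕ
  top = gap full L

  abstract
    -- If a stage meets no dense heavy set, then each set in `𝓛` removes at most a share 1/`M` of
    -- the sample. Over `top` stages this amounts to less than half.
    M : ℕ
    M = suc (2 * (top * length 𝓛))

    M-def : M ≡ suc (2 * (top * length 𝓛))
    M-def = refl

  instance
    M≢0 : NonZero M
    M≢0 = subst NonZero (sym M-def) _

  Light : ℕ → Fam → Set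
  Light j f = ∀ S → L ⊆ₛ S → gap full S ≡ j → ∀ σ → σ ∈ᶠ f → fib f S σ ≤ 2 * lam j

  heavy : Fam → PSet → ℕ → Fam
  heavy f S j σ = f σ ∧ does (2 * lam j <? fib f S σ)

  supersets-length : ∀ ps → length (supersets ps) ≡ 2 ^ length ps
  supersets-length [] = refl
  supersets-length (p ∷ ps) = trans (length-concatMap (λ S → S ∷ add S p ∷ []) (supersets ps))
    (trans (∑-const (supersets ps) 2) (trans (*-comm (length (supersets ps)) 2) (cong (2 *_) (supersets-length ps))))

  record HeavyFamily : Set where
    field
      j     : ℕ
      W     : PSet
      g     : Fam
      L⊆W   : L ⊆ₛ W
      gapW  : gap full W ≡ suc j
      dense : length 𝒰 ≤ M * size g
      big   : ∀ σ → σ ∈ᶠ g → 2 * lam (suc j) < fib g W σ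
      small : ∀ p → W p ≡ false → ∀ τ → τ ∈ᶠ g → fib g (add W p) τ ≤ 2 * lam j

  heavyFamily : ∀ j f S → L ⊆ₛ S → gap full S ≡ suc j → Light j f →
                length 𝒰 ≤ M * size (heavy f S (suc j)) → HeavyFamily
  heavyFamily j f S L⊆ g≡ light dense = record
    { j = j ; W = S ; g = g ; L⊆W = L⊆ ; gapW = g≡ ; dense = dense
    ; big = λ σ (σ∈ , gσ) → <-≤-trans (does-true (2 * lam (suc j) <? fib f S σ) (proj₂ (∧-true {f σ} gσ)))
        -- Being heavy is constant on fibres over `S`, so a heavy fibre survives whole in `g`.
        (fib-mono {f} {g} {S} {S} σ σ (λ τ τ∈ fτ a → ∧-intro fτ (true-does (2 * lam (suc j) <? fib f S τ)
          (<-≤-trans (does-true (2 * lam (suc j) <? fib f S σ) (proj₂ (∧-true {f σ} gσ)))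
            (fib-mono {f} {f} {S} {S} σ τ (λ υ _ k b → k , Agree-trans S (Agree-sym S a) b)))) , a))
    ; small = λ p s τ (τ∈ , gτ) → ≤-trans
        (fib-mono {g} {f} {add S p} {add S p} τ τ (λ υ _ k b → proj₁ (∧-true {f υ} k) , b))
        (light (add S p) (λ q h → add-⊇ S p (L⊆ q h)) (suc-injective (trans (sym (gap-add full S p s refl)) g≡))
          τ (τ∈ , proj₁ (∧-true {f τ} gτ)))
    }
    where
    g = heavy f S (suc j)

  module Stage (j : ℕ) (f : Fam) where

    isHeavy : PSet → Fam
    isHeavy S σ = does (gap full S ≟ℕ suc j) ∧ heavy f S (suc j) σ

    rest : Fam
    rest σ = f σ ∧ not (does (0 <? # (λ S → isHeavy S σ) 𝓛))

    loss : (∀ S → S ∈ 𝓛 → M * size (isHeavy S) ≤ length 𝒰) →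
           M * size f ≤ M * size rest + length 𝓛 * length 𝒰
    loss few = begin
      M * size f                                      ≤⟨ *-monoʳ-≤ M (#-∪ 𝒰 cases) ⟩
      M * (size rest + size someHeavy)                ≡⟨ *-distribˡ-+ M (size rest) (size someHeavy) ⟩
      M * size rest + M * size someHeavy              ≤⟨ +-monoʳ-≤ (M * size rest) (*-monoʳ-≤ M
           (#-union isHeavy 𝒰 𝓛 (λ σ _ h → #-pos (λ S → isHeavy S σ) 𝓛 (does-true (0 <? # (λ S → isHeavy S σ) 𝓛) h)))) ⟩
      M * size rest + M * ∑ 𝓛 (λ S → size (isHeavy S)) ≡⟨ cong (M * size rest +_) (sym (∑-*ˡ 𝓛 M (λ S → size (isHeavy S)))) ⟩
      M * size rest + ∑ 𝓛 (λ S → M * size (isHeavy S)) ≤⟨ +-monoʳ-≤ (M * size rest) (∑-≤-const 𝓛 (length 𝒰) few) ⟩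
      M * size rest + length 𝓛 * length 𝒰             ∎
      where
      open ≤-Reasoning
      someHeavy : Fam
      someHeavy σ = does (0 <? # (λ S → isHeavy S σ) 𝓛)
      cases : ∀ σ → σ ∈ 𝒰 → f σ ≡ true → rest σ ≡ true ⊎ someHeavy σ ≡ true
      cases σ _ fσ with someHeavy σ
      ... | true = inj₂ refl
      ... | false rewrite fσ = inj₁ refl

    rest-light : Light (suc j) rest
    rest-light S L⊆ g≡ σ (σ∈ , rσ) with supersets-complete all S L⊆
    ... | S′ , S′∈ , sub , sup = ≤-trans
      (fib-mono {rest} {f} {S} {S′} σ σ (λ τ _ k a → proj₁ (∧-true {f τ} k) , λ p h → a p (sub p h)))
      (≮⇒≥ (λ lt → true≢false
        (true-does (0 <? # (λ S → isHeavy S σ) 𝓛) (#-∈ S′∈ (∧-intro (true-does (gap full S′ ≟ℕ suc j) (trans same g≡))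
          (∧-intro (proj₁ (∧-true {f σ} rσ)) (true-does (2 * lam (suc j) <? fib f S′ σ) lt)))))
        (not-true (proj₂ (∧-true {f σ} rσ)))))
      where
      same : gap full S′ ≡ gap full S
      same = ∑-cong all (λ p p∈ → cong (λ b → 𝟙 (not b)) (eq p p∈))
        where
        eq : ∀ p → p ∈ all → S′ p ≡ S p
        eq p p∈ with S p in h
        ... | true = sup p p∈ h
        ... | false = ¬true⇒false (λ k → true≢false (sub p k) h)

  -- `j` counts free positions, so sets are examined from the largest down to `L`. When a set with a
  -- dense heavy part appears, all sets with one more position are already light: this is the
  -- maximality of `W`.
  search : ∀ i j f → j + i ≡ top → Light j f → M * length 𝒰 ≤ M * size f + j * (length 𝓛 * length 𝒰) →
           HeavyFamily ⊎ (∃[ f′ ] Light top f′ × M * length 𝒰 ≤ M * size f′ + top * (length 𝓛 * length 𝒰))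
  search zero j f eq light l with trans (sym (+-identityʳ j)) eq
  ... | refl = inj₂ (f , light , l)
  search (suc i) j f eq light l with find (λ S → does (length 𝒰 <? M * size (Stage.isHeavy j f S))) 𝓛
  ... | inj₁ (S , S∈ , h) with gap full S ≟ℕ suc j | does-true (length 𝒰 <? M * size (Stage.isHeavy j f S)) h
  ... | yes g≡ | lt = inj₁ (heavyFamily j f S (supersets-⊇ all S S∈) g≡ light
          (≤-trans (<⇒≤ lt) (*-monoʳ-≤ M (#-mono 𝒰 (λ σ _ k → proj₂ (∧-true {does (gap full S ≟ℕ suc j)} k))))))
  ... | no g≢ | lt = ⊥-elim (<⇒≱ (<-≤-trans lt (≤-reflexive (trans (cong (M *_) (#-false 𝒰 (λ σ _ →
            cong (_∧ heavy f S (suc j) σ) (false-does (gap full S ≟ℕ suc j) g≢)))) (*-zeroʳ M)))) z≤n)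
  search (suc i) j f eq light l | inj₂ none = search i (suc j) (Stage.rest j f) (trans (sym (+-suc j i)) eq)
    (Stage.rest-light j f) (begin
      M * length 𝒰                                   ≤⟨ l ⟩
      M * size f + j * w                              ≤⟨ +-monoˡ-≤ (j * w) (Stage.loss j f few) ⟩
      M * size (Stage.rest j f) + w + j * w           ≡⟨ +-assoc (M * size (Stage.rest j f)) w (j * w) ⟩
      M * size (Stage.rest j f) + suc j * w           ∎)
    where
    open ≤-Reasoning
    w = length 𝓛 * length 𝒰
    few : ∀ S → S ∈ 𝓛 → M * size (Stage.isHeavy j f S) ≤ length 𝒰
    few S S∈ = ≮⇒≥ (λ lt → true≢false (true-does (length 𝒰 <? M * size (Stage.isHeavy j f S)) lt) (none S S∈))

  -- In the second alternative the fibres over `L` itself are bounded on half of the sample, which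
  -- the later count of leaf tuples excludes.
  dichotomy : HeavyFamily ⊎ (∃[ f ] Light top f × length 𝒰 ≤ 2 * size f)
  dichotomy with search top 0 (λ _ → true) refl light₀ (≤-trans (≤-reflexive (cong (M *_) (length≡∑ 𝒰))) (m≤m+n _ _))
    where
    light₀ : Light 0 (λ _ → true)
    light₀ S _ g≡ σ _ = ≤-trans (fib-complete (λ _ → true) S σ g≡) (≤-trans lam0 (m≤m+n (lam 0) _))
  ... | inj₁ h = inj₁ h
  ... | inj₂ (f , light , l) = inj₂ (f , light , *-cancelˡ-≤ M (+-cancelʳ-≤ (M * length 𝒰) _ _ (begin
      M * length 𝒰 + M * length 𝒰              ≤⟨ +-mono-≤ l l ⟩
      (x + y) + (x + y)                         ≡⟨ lem x top (length 𝓛) (length 𝒰) ⟩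
      2 * x + 2 * (top * length 𝓛) * length 𝒰    ≤⟨ +-mono-≤ (≤-reflexive (lem′ M (size f))) (*-monoˡ-≤ (length 𝒰) (≤-trans (n≤1+n (2 * (top * length 𝓛))) (≤-reflexive (sym M-def)))) ⟩
      M * (2 * size f) + M * length 𝒰           ∎)))
    where
    open ≤-Reasoning
    x = M * size f
    y = top * (length 𝓛 * length 𝒰)
    lem : ∀ x j k u → (x + j * (k * u)) + (x + j * (k * u)) ≡ 2 * x + 2 * (j * k) * u
    lem = solve-∀
    lem′ : ∀ m s → 2 * (m * s) ≡ m * (2 * s)
    lem′ = solve-∀

-- The step is dictated by `flex`: a fibre must exceed `N * B` times the bound
-- `2 * thresholds N B j` for fibres with one more fixed position. Heavy fibres exceed twice the
-- threshold, so that cleaning down to the threshold itself spends at most half of the budget.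
thresholds : ℕ → ℕ → ℕ → ℕ
thresholds N B zero = 1
thresholds N B (suc j) = suc (N * B * (2 * thresholds N B j))

^-distrib : ∀ a b e → (a * b) ^ e ≡ a ^ e * b ^ e
^-distrib a b zero = refl
^-distrib a b (suc e) rewrite ^-distrib a b e = lem a b (a ^ e) (b ^ e)
  where
  lem : ∀ a b x y → a * b * (x * y) ≡ a * x * (b * y)
  lem = solve-∀

^-mono : ∀ {a b} e → a ≤ b → a ^ e ≤ b ^ e
^-mono zero _ = ≤-refl
^-mono (suc e) h = *-mono-≤ h (^-mono e h)

half+half : ∀ a b x → 2 * a ≤ x → 2 * b < x → a + b < x
half+half a b x ha hb = *-cancelˡ-< 2 _ _ (begin-strict
  2 * (a + b)      ≡⟨ *-distribˡ-+ 2 a b ⟩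
  2 * a + 2 * b    <⟨ +-mono-≤-< ha hb ⟩
  x + x            ≡⟨ cong (x +_) (sym (+-identityʳ x)) ⟩
  2 * x            ∎)
  where open ≤-Reasoning

-- One family flexible for W and for several subtrees

module Flexible (T : RootedTree) (Ω : Host) (U : Sample T Ω)
  (many : Host.n Ω * (Host.d Ω ∸ length (RootedTree.all T)) ^ Embeddings.edges T Ω ≤ length (Sample.𝒰 U))
  (L : RootedTree.P T → Bool) (B ρ : ℕ)
  where

  open Tree T Ω
  open Embeddings T Ω using (edges)
  open Families T Ω U

  lam : ℕ → ℕ
  lam = thresholds N B

  open HeavyFibres T Ω U L lam ≤-refl

  abstract
    -- One piece costs at most `K ^ edges * (n * d ^ edges)`, hence at most
    -- `K ^ edges * (2 ^ edges * M)` times the size of the heavy family. There are at most `ρ`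
    -- pieces, and the factor 2 keeps their total below half of the budget. Neither `B` nor `lam`
    -- enters.
    Γ : ℕ
    Γ = suc (2 * (ρ * (K ^ edges * (2 ^ edges * M))))

    Γ-def : Γ ≡ suc (2 * (ρ * (K ^ edges * (2 ^ edges * M))))
    Γ-def = refl

  instance
    Γ≢0 : NonZero Γ
    Γ≢0 = subst NonZero (sym Γ-def) _

  record Piece : Set where
    field
      R    : PSet
      r    : P
      r∈R  : R r ≡ true
      conR : Conn (sing r) R

  open Piece

  gap-empty : gap full (λ _ → false) ≡ N
  gap-empty = sym (length≡∑ all)

  gap-sing : ∀ r → N ≡ suc (gap full (sing r))
  gap-sing r = trans (sym gap-empty) (gap-add full (λ _ → false) r refl refl)

  gap-sing-edges : ∀ r → gap full (sing r) ≡ edges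
  gap-sing-edges r = suc-injective (trans (sym (gap-sing r)) (gap-sing root))

  -- The exponents match: threshold `d ^ gap full (R p)` times the order of the number of patterns
  -- on `R p` gives `n * d ^ edges`, the order of the sample.
  gap-piece : ∀ p → gap full (R p) + gap (R p) (sing (r p)) ≡ edges
  gap-piece p = trans (+-comm (gap full (R p)) _) (trans (sym (trans (#-split (λ q → not (sing (r p) q)) (R p) all)
      (cong₂ _+_ (∑-cong all (λ q _ → cong 𝟙 (comm (not (sing (r p) q)) (R p q))))
                 (∑-cong all (λ q _ → cong 𝟙 (outside q)))))) (gap-sing-edges (r p)))
    where
    comm : ∀ a b → a ∧ b ≡ b ∧ a
    comm true true = refl
    comm true false = refl
    comm false true = refl
    comm false false = refl
    outside : ∀ q → not (sing (r p) q) ∧ not (R p q) ≡ not (R p q)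
    outside q with q ≟ r p
    ... | no _ = refl
    ... | yes refl rewrite r∈R p = refl

  record FlexFamily (W : PSet) (ps : List Piece) : Set where
    field
      f      : Fam
      member : ∃[ σ ] σ ∈ᶠ f
      flexW  : Flex f W B
      flexR  : ∀ p → p ∈ ps → Flex f (R p) B
      denseR : ∀ p → p ∈ ps → ∀ σ → σ ∈ᶠ f → d ^ gap full (R p) ≤ Γ * fib f (R p) σ

  module _ (n>0 : 0 < n) (K>0 : 0 < K) (d≥2N : 2 * N ≤ d) (d-large : Γ * (N * B * K ^ edges) < d) where

    d>0 : 0 < d
    d>0 = ≤-trans (s≤s z≤n) d-large

    d≤2[d∸N] : d ≤ 2 * (d ∸ N)
    d≤2[d∸N] = +-cancelʳ-≤ d d (2 * (d ∸ N)) (begin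
      d + d                       ≡⟨ cong (λ x → x + x) (sym (m∸n+n≡m (≤-trans (m≤m+n N _) d≥2N))) ⟩
      (d ∸ N + N) + (d ∸ N + N)   ≡⟨ lem (d ∸ N) N ⟩
      2 * (d ∸ N) + 2 * N         ≤⟨ +-monoʳ-≤ (2 * (d ∸ N)) d≥2N ⟩
      2 * (d ∸ N) + d             ∎)
      where
      open ≤-Reasoning
      lem : ∀ a b → (a + b) + (a + b) ≡ 2 * a + 2 * b
      lem = solve-∀

    many′ : n * d ^ edges ≤ 2 ^ edges * length 𝒰
    many′ = begin
      n * d ^ edges                            ≤⟨ *-monoʳ-≤ n (^-mono edges d≤2[d∸N]) ⟩
      n * (2 * (d ∸ N)) ^ edges                ≡⟨ cong (n *_) (^-distrib 2 (d ∸ N) edges) ⟩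
      n * (2 ^ edges * (d ∸ N) ^ edges)        ≡⟨ lem n (2 ^ edges) _ ⟩
      2 ^ edges * (n * (d ∸ N) ^ edges)        ≤⟨ *-monoʳ-≤ (2 ^ edges) many ⟩
      2 ^ edges * length 𝒰                     ∎
      where
      open ≤-Reasoning
      lem : ∀ a b c → a * (b * c) ≡ b * (a * c)
      lem = solve-∀

    instance
      d≢0 : NonZero d
      d≢0 = >-nonZero d>0
      K≢0 : NonZero K
      K≢0 = >-nonZero K>0
      n≢0 : NonZero n
      n≢0 = >-nonZero n>0

    -- With one more position fixed, at most `(K * d) ^ m` embeddings remain by `fib≤Δ^`, against
    -- about `d ^ suc m` before. The surplus factor `d` absorbs `Γ`, `N * B` and the power of `K`.
    flexPiece : ∀ f p → (∀ σ → σ ∈ᶠ f → d ^ gap full (R p) ≤ Γ * fib f (R p) σ) → Flex f (R p) B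
    flexPiece f p big with gap full (R p) in eq
    ... | zero = λ σ σ∈ X _ → σ , σ∈ , (λ _ _ → refl) , (λ q s → ⊥-elim (true≢false (gap-0 full (R p) eq q refl) s))
    ... | suc m = flex f (R p) B ((K * d) ^ m)
        (λ σ σ∈ → *-cancelˡ-< Γ _ _ (begin-strict
          Γ * (N * B * (K * d) ^ m)          ≡⟨ cong (λ x → Γ * (N * B * x)) (^-distrib K d m) ⟩
          Γ * (N * B * (K ^ m * d ^ m))      ≡⟨ lem Γ (N * B) (K ^ m) (d ^ m) ⟩
          Γ * (N * B * K ^ m) * d ^ m        <⟨ *-monoˡ-< (d ^ m) {{m^n≢0 d m}} (≤-<-trans (*-monoʳ-≤ Γ (*-monoʳ-≤ (N * B)
               (^-monoʳ-≤ K (≤-trans (n≤1+n m) (≤-trans (≤-reflexive (sym eq)) (≤-trans (m≤m+n _ _) (≤-reflexive (gap-piece p)))))))) d-large) ⟩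
          d * d ^ m                          ≤⟨ big σ σ∈ ⟩
          Γ * fib f (R p) σ                  ∎))
        (λ q s τ _ → ≤-trans (fib≤Δ^ f (add (R p) q) q τ (add-∋ (R p) q))
          (≤-reflexive (cong ((K * d) ^_) (suc-injective (trans (sym (gap-add full (R p) q s refl)) eq)))))
      where
      open ≤-Reasoning
      lem : ∀ a b c e → a * (b * (c * e)) ≡ a * (b * c) * e
      lem = solve-∀

    -- `W` takes at most half of the budget `Γ * size g`, because its patterns are counted by
    -- `representatives`; the pieces take less than the other half, because theirs are counted by
    -- `connected-keys`. So one cleaning serves all of them.
    flexFamily : (H : HeavyFamily) (ps : List Piece) → length ps ≤ ρ → FlexFamily (HeavyFamily.W H) ps
    flexFamily H ps lps = finish (clean (size g) g ≤-refl covered cost<)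
      where
      open HeavyFamily H
      reps = representatives W (2 * lam (suc j)) (size g) g ≤-refl (λ σ σ∈ → <⇒≤ (big σ σ∈))
      keysOf : (p : Piece) → _
      keysOf p = connected-keys (R p) (r p) (r∈R p) (conR p)
      sets : Maybe Piece → PSet
      sets nothing = W
      sets (just p) = R p
      thr : Maybe Piece → ℕ
      -- Cleaning compares thresholds with `Γ` times a fibre, so this one leaves at least
      -- `lam (suc j)` members in each fibre over `W`.
      thr nothing = Γ * lam (suc j)
      thr (just p) = d ^ gap full (R p)
      keys : Maybe Piece → List Emb
      keys nothing = proj₁ reps
      keys (just p) = proj₁ (keysOf p)
      js : List (Maybe Piece)
      js = nothing ∷ map just ps
      open Cleaning js sets thr keys Γ
      size-g : n * d ^ edges ≤ 2 ^ edges * M * size g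
      size-g = ≤-trans many′ (≤-trans (*-monoʳ-≤ (2 ^ edges) dense) (≤-reflexive (sym (*-assoc (2 ^ edges) M (size g)))))
      piece-cost : ∀ p → thr (just p) * # (alive g (just p)) (keys (just p)) ≤ K ^ edges * (n * d ^ edges)
      piece-cost p = begin
        d ^ m * # (alive g (just p)) (keys (just p))   ≤⟨ *-monoʳ-≤ (d ^ m) (≤-trans (#≤length (alive g (just p)) (keys (just p))) (proj₂ (proj₂ (keysOf p)))) ⟩
        d ^ m * (n * (K * d) ^ c)           ≡⟨ cong (λ x → d ^ m * (n * x)) (^-distrib K d c) ⟩
        d ^ m * (n * (K ^ c * d ^ c))       ≡⟨ lem (d ^ m) n (K ^ c) (d ^ c) ⟩
        K ^ c * (n * (d ^ m * d ^ c))       ≡⟨ cong (λ x → K ^ c * (n * x)) (trans (sym (^-distribˡ-+-* d m c)) (cong (d ^_) (gap-piece p))) ⟩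
        K ^ c * (n * d ^ edges)             ≤⟨ *-monoˡ-≤ (n * d ^ edges) (^-monoʳ-≤ K (≤-trans (m≤n+m c m) (≤-reflexive (gap-piece p)))) ⟩
        K ^ edges * (n * d ^ edges)         ∎
        where
        open ≤-Reasoning
        m = gap full (R p)
        c = gap (R p) (sing (r p))
        lem : ∀ x n k y → x * (n * (k * y)) ≡ k * (n * (x * y))
        lem = solve-∀
      size-g>0 : 0 < size g
      size-g>0 = *-cancelˡ-< (2 ^ edges * M) 0 (size g) (≤-trans (≤-reflexive (cong suc (*-zeroʳ (2 ^ edges * M))))
        (<-≤-trans (*-mono-≤ n>0 (>-nonZero⁻¹ (d ^ edges) {{m^n≢0 d edges}})) size-g))
      rest = ∑ (map just ps) (λ i → thr i * # (alive g i) (keys i))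
      rest< : 2 * rest < Γ * size g
      rest< = begin-strict
        2 * rest                                        ≡⟨ cong (2 *_) (∑-map just ps _) ⟩
        2 * ∑ ps (λ p → thr (just p) * # (alive g (just p)) (keys (just p)))
                                                        ≤⟨ *-monoʳ-≤ 2 (∑-≤-const ps _ (λ p _ → piece-cost p)) ⟩
        2 * (length ps * (K ^ edges * (n * d ^ edges))) ≤⟨ *-monoʳ-≤ 2 (*-mono-≤ lps (*-monoʳ-≤ (K ^ edges) size-g)) ⟩
        2 * (ρ * (K ^ edges * (2 ^ edges * M * size g))) ≡⟨ lem ρ (K ^ edges) (2 ^ edges) M (size g) ⟩
        2 * (ρ * (K ^ edges * (2 ^ edges * M))) * size g <⟨ +-monoˡ-≤ (2 * (ρ * (K ^ edges * (2 ^ edges * M))) * size g) size-g>0 ⟩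
        suc (2 * (ρ * (K ^ edges * (2 ^ edges * M)))) * size g ≡⟨ cong (_* size g) (sym Γ-def) ⟩
        Γ * size g                                      ∎
        where
        open ≤-Reasoning
        lem : ∀ r k t m s → 2 * (r * (k * (t * m * s))) ≡ 2 * (r * (k * (t * m))) * s
        lem = solve-∀
      first = thr nothing * # (alive g nothing) (keys nothing)
      first≤ : 2 * first ≤ Γ * size g
      first≤ = begin
        2 * (Γ * lam (suc j) * # (alive g nothing) (keys nothing)) ≤⟨ *-monoʳ-≤ 2 (*-monoʳ-≤ (Γ * lam (suc j)) (#≤length (alive g nothing) (keys nothing))) ⟩
        2 * (Γ * lam (suc j) * length (proj₁ reps))   ≡⟨ lem Γ (lam (suc j)) (length (proj₁ reps)) ⟩
        Γ * (length (proj₁ reps) * (2 * lam (suc j))) ≤⟨ *-monoʳ-≤ Γ (proj₂ (proj₂ reps)) ⟩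
        Γ * size g                                    ∎
        where
        open ≤-Reasoning
        lem : ∀ a b c → 2 * (a * b * c) ≡ a * (c * (2 * b))
        lem = solve-∀
      cost< : cost g < Γ * size g
      cost< = half+half first rest (Γ * size g) first≤ rest<
      covered : ∀ i → i ∈ js → ∀ σ → σ ∈ᶠ g → ∃[ z ] z ∈ keys i × Agree (sets i) z σ
      covered nothing _ σ σ∈ = proj₁ (proj₂ reps) σ σ∈
      covered (just p) _ σ (σ∈ , _) = proj₁ (proj₂ (keysOf p)) σ σ∈
      finish : ∃[ f ] (∀ σ → f σ ≡ true → g σ ≡ true) × (∃[ σ ] σ ∈ᶠ f) ×
                      (∀ i → i ∈ js → ∀ σ → σ ∈ᶠ f → thr i ≤ Γ * fib f (sets i) σ) → FlexFamily W ps
      finish (f , sub , member , fibres) = record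
        { f = f
        ; member = member
        ; flexW = flex f W B (2 * lam j)
            (λ σ σ∈ → *-cancelˡ-≤ Γ (fibres nothing (here refl) σ σ∈))
            (λ p s τ (τ∈ , fτ) → ≤-trans (fib-mono {f} {g} {add W p} {add W p} τ τ (λ υ _ k a → sub υ k , a))
              (small p s τ (τ∈ , sub τ fτ)))
        ; flexR = λ p p∈ → flexPiece f p (λ σ σ∈ → fibres (just p) (there (∈-map⁺ just p∈)) σ σ∈)
        ; denseR = λ p p∈ σ σ∈ → fibres (just p) (there (∈-map⁺ just p∈)) σ σ∈
        }

#-by-member : ∀ {A : Set} (Q : A → Bool) xs b → (∀ x → x ∈ xs → Q x ≡ true → # Q xs ≤ b) → # Q xs ≤ b
#-by-member Q xs b h with 0 <? # Q xs
... | no ¬p = ≤-trans (≮⇒≥ ¬p) z≤n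
... | yes p = let x , x∈ , q = #-pos Q xs p in h x x∈ q

-- The Kővári-Sós-Turán argument

module KST {A I : Set} (rel : A → I → Bool) where

  deg : List A → I → ℕ
  deg rows y = # (λ p → rel p y) rows

  common : List A → I → Bool
  common [] y = true
  common (p ∷ ps) y = rel p y ∧ common ps y

  -- `c` accumulates, along the recursion, the condition of being related to the rows already
  -- chosen.
  rich : (I → Bool) → List A → ℕ → I → Bool
  rich c rows s y = c y ∧ does (s ≤? deg rows y)

  common-∈ : ∀ {ps y p} → common ps y ≡ true → p ∈ ps → rel p y ≡ true
  common-∈ {q ∷ ps} {y} h (here refl) = proj₁ (∧-true {rel q y} h)
  common-∈ {q ∷ ps} {y} h (there p∈) = common-∈ {ps} (proj₂ (∧-true {rel q y} h)) p∈

  record Choice (c : I → Bool) (rows : List A) (s : ℕ) (U : List I) : Set where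
    field
      ps    : List A
      len   : length ps ≡ s
      sub   : ∀ {p} → p ∈ ps → p ∈ rows
      uniq  : Unique rows → Unique ps
      many  : # (rich c rows s) U ≤ 2 ^ length rows * # (λ y → c y ∧ common ps y) U

  split : ∀ c r rs s U → # (rich c (r ∷ rs) (suc s)) U ≤ # (rich c rs (suc s)) U + # (rich (λ y → c y ∧ rel r y) rs s) U
  split c r rs s U = #-∪ U (λ y _ h → cases y (rel r y) refl h)
    where
    cases : ∀ y b → rel r y ≡ b → rich c (r ∷ rs) (suc s) y ≡ true →
            rich c rs (suc s) y ≡ true ⊎ rich (λ y → c y ∧ rel r y) rs s y ≡ true
    cases y b e h with ∧-true {c y} h
    cases y true e h | cy , k rewrite e =
      inj₂ (∧-intro (∧-intro cy refl) (true-does (s ≤? deg rs y) (s≤s⁻¹ (does-true (suc s ≤? suc (deg rs y)) k))))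
    cases y false e h | cy , k rewrite e = inj₁ (∧-intro cy k)

  double : ∀ x y → x * y + x * y ≡ 2 * x * y
  double = solve-∀

  -- An item of degree ≥ s + 1 in r ∷ rs has degree ≥ s + 1 in rs, or it is related to r and has degree ≥ s in rs;
  -- recurse into the more frequent alternative.
  kst : ∀ c rows s U → 0 < # (rich c rows s) U → Choice c rows s U
  kst c rows zero U _ = record
    { ps = [] ; len = refl ; sub = λ () ; uniq = λ _ → []
    ; many = ≤-trans (≤-reflexive (sym (*-identityˡ _))) (*-monoˡ-≤ _ (m^n>0 2 (length rows))) }
  kst c [] (suc s) U pos = ⊥-elim (<-irrefl (sym (#-false U (λ y _ → none (c y)))) pos)
    where
    none : ∀ b → b ∧ false ≡ false
    none true = refl
    none false = refl
  kst c (r ∷ rs) (suc s) U pos with # (rich (λ y → c y ∧ rel r y) rs s) U ≤? # (rich c rs (suc s)) U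
  ... | yes b≤a = record { ps = ps ; len = len ; sub = there ∘ sub ; uniq = λ { (_ ∷ u) → uniq u }
      ; many = ≤-trans (split c r rs s U) (≤-trans (+-monoʳ-≤ a b≤a) (≤-trans (+-mono-≤ many many) (≤-reflexive (double (2 ^ length rs) _)))) }
    where
    a = # (rich c rs (suc s)) U
    a>0 : 0 < a
    a>0 = n≢0⇒n>0 (λ a≡0 → <⇒≱ pos (≤-trans (split c r rs s U) (≤-trans (+-monoʳ-≤ a b≤a) (≤-reflexive (cong₂ _+_ a≡0 a≡0)))))
    open Choice (kst c rs (suc s) U a>0)
  ... | no b≰a = record { ps = r ∷ ps ; len = cong suc len
      ; sub = λ { (here refl) → here refl ; (there p∈) → there (sub p∈) }
      ; uniq = λ { (r∉ ∷ u) → All.tabulate (λ p∈ → All.lookup r∉ (sub p∈)) ∷ uniq u }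
      ; many = ≤-trans (split c r rs s U) (≤-trans (+-monoˡ-≤ b (<⇒≤ a<b)) (≤-trans (+-mono-≤ many many) (≤-trans (≤-reflexive (double (2 ^ length rs) _))
          (*-monoʳ-≤ (2 ^ suc (length rs)) (#-mono U (λ y _ h → let h₁ , h₂ = ∧-true {c y ∧ rel r y} h ; h₃ , h₄ = ∧-true {c y} h₁ in
            ∧-intro h₃ (∧-intro h₄ h₂))))))) }
    where
    a = # (rich c rs (suc s)) U
    b = # (rich (λ y → c y ∧ rel r y) rs s) U
    a<b : a < b
    a<b = ≰⇒> b≰a
    open Choice (kst (λ y → c y ∧ rel r y) rs s U (≤-trans (s≤s z≤n) a<b))

  -- With b rows there are at least b D / Γ incidences. Items of degree below `s` carry at most
  -- `s * length U`, and b = 2 Γ s k makes this at most half. The other half forces at least D / (2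
  -- Γ) items of degree at least `s`, and `kst` finds `s` rows common to a share 2^(-b) of them.
  denseKST : ∀ rows s U Γ k D → 0 < Γ → 0 < k → 0 < s → 0 < D → length rows ≡ 2 * (Γ * (s * k)) → length U ≤ k * D →
             (∀ p → p ∈ rows → D ≤ Γ * # (rel p) U) →
             ∃[ ps ] length ps ≡ s × (∀ {p} → p ∈ ps → p ∈ rows) × (Unique rows → Unique ps) ×
               D ≤ 2 * Γ * 2 ^ length rows * # (common ps) U
  denseKST rows s U Γ k D Γ>0 k>0 s>0 D>0 lr lU dense = ps , len , sub , uniq ,
    ≤-trans D≤ (≤-trans (*-monoʳ-≤ (2 * Γ) many) (≤-reflexive (sym (*-assoc (2 * Γ) (2 ^ length rows) _))))
    where
    c : I → Bool
    c _ = true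
    g = # (rich c rows s) U
    b = length rows
    incidences : b * D ≤ Γ * (s * length U + b * g)
    incidences = begin
      b * D                                        ≡⟨ sym (∑-const rows D) ⟩
      ∑ rows (λ _ → D)                             ≤⟨ ∑-mono rows dense ⟩
      ∑ rows (λ p → Γ * # (rel p) U)               ≡⟨ ∑-*ˡ rows Γ (λ p → # (rel p) U) ⟩
      Γ * ∑ rows (λ p → # (rel p) U)               ≡⟨ cong (Γ *_) (∑-swap rows U (λ p y → 𝟙 (rel p y))) ⟩
      Γ * ∑ U (λ y → deg rows y)                   ≤⟨ *-monoʳ-≤ Γ (∑-mono U (λ y _ → deg≤ y)) ⟩
      Γ * ∑ U (λ y → s + b * 𝟙 (rich c rows s y))  ≡⟨ cong (Γ *_) (trans (∑-+ U (λ _ → s) _) (cong₂ _+_ (trans (∑-const U s) (*-comm (length U) s)) (∑-*ˡ U b _))) ⟩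
      Γ * (s * length U + b * g)                   ∎
      where
      open ≤-Reasoning
      deg≤ : ∀ y → deg rows y ≤ s + b * 𝟙 (rich c rows s y)
      deg≤ y = go (does (s ≤? deg rows y)) refl
        where
        go : ∀ r → does (s ≤? deg rows y) ≡ r → deg rows y ≤ s + b * 𝟙 r
        go true _ = ≤-trans (#≤length (λ p → rel p y) rows) (≤-trans (≤-reflexive (sym (*-identityʳ b))) (m≤n+m _ s))
        go false e = ≤-trans (<⇒≤ (≰⇒> (λ s≤ → true≢false (true-does (s ≤? deg rows y) s≤) e))) (m≤m+n s _)
    b>0 : 0 < b
    b>0 = ≤-trans (*-mono-≤ {1} {2} (s≤s z≤n) (*-mono-≤ Γ>0 (*-mono-≤ s>0 k>0))) (≤-reflexive (sym lr))
    D≤ : D ≤ 2 * Γ * g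
    D≤ = *-cancelˡ-≤ b {{>-nonZero b>0}} (+-cancelˡ-≤ (b * D) _ _ (begin
      b * D + b * D                                       ≤⟨ +-mono-≤ incidences incidences ⟩
      Γ * (s * length U + b * g) + Γ * (s * length U + b * g) ≡⟨ lem Γ s (length U) b g ⟩
      2 * (Γ * (s * length U)) + b * (2 * Γ * g)          ≤⟨ +-monoˡ-≤ (b * (2 * Γ * g)) (*-monoʳ-≤ 2 (*-monoʳ-≤ Γ (*-monoʳ-≤ s lU))) ⟩
      2 * (Γ * (s * (k * D))) + b * (2 * Γ * g)           ≡⟨ cong (_+ b * (2 * Γ * g)) (trans (lem′ Γ s k D) (cong (_* D) (sym lr))) ⟩
      b * D + b * (2 * Γ * g)                             ∎))
      where
      open ≤-Reasoning
      lem : ∀ G s u b g → G * (s * u + b * g) + G * (s * u + b * g) ≡ 2 * (G * (s * u)) + b * (2 * G * g)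
      lem = solve-∀
      lem′ : ∀ G s k D → 2 * (G * (s * (k * D))) ≡ 2 * (G * (s * k)) * D
      lem′ = solve-∀
    g>0 : 0 < g
    g>0 = n≢0⇒n>0 (λ g≡0 → <⇒≱ D>0 (≤-trans D≤ (≤-reflexive (trans (cong (2 * Γ *_) g≡0) (*-zeroʳ (2 * Γ))))))
    open Choice (kst c rows s U g>0)

halve : ∀ m → ∃[ e ] (m ≡ 2 * e ⊎ m ≡ suc (2 * e))
halve zero = 0 , inj₁ refl
halve (suc m) with halve m
... | e , inj₁ refl = e , inj₂ refl
... | e , inj₂ refl = suc e , inj₁ (cong suc (sym (+-suc e (e + 0))))

-- Alternating moves and enumeration of walks

module Moves (T : RootedTree) (Ω : Host) (U : Sample T Ω)
  (f : Tree.Emb T Ω → Bool)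
  where

  open Tree T Ω
  open Families T Ω U

  hom : ∀ {σ} → σ ∈ᶠ f → Hom σ
  hom (σ∈ , _) = proj₁ (ok _ σ∈)

  inj : ∀ {σ} → σ ∈ᶠ f → Inj σ
  inj (σ∈ , _) = proj₂ (ok _ σ∈)

  -- Keeping W changes u to a fresh vertex, and then keeping R changes z to a fresh neighbour of it:
  -- this lengthens a walk ending at the image of z by 2.
  zigzag : ∀ {W R : PSet} {z u} B → Flex f W B → Flex f R B → Adj z u →
           W z ≡ true → W u ≡ false → R u ≡ true → R z ≡ false →
           ∀ e σ X → σ ∈ᶠ f → 2 * e + length X ≤ B →
           ∃[ τ ] ∃[ l ] τ ∈ᶠ f × (∀ p → W p ≡ true → R p ≡ true → σ p ≡ τ p) ×
             length l ≡ 2 * e × Walk _~_ (σ z) l × end (σ z) l ≡ τ z × Unique l × Disjoint l X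
  zigzag B fW fR a Wz Wu Ru Rz zero σ X σ∈ _ =
    σ , [] , σ∈ , (λ _ _ _ → refl) , refl , [] , refl , [] , λ ()
  zigzag {W} {R} {z} {u} B fW fR a Wz Wu Ru Rz (suc e) σ X σ∈ bd
    with fW σ σ∈ X (≤-trans (m≤n+m _ _) bd)
  ... | σ₁ , σ₁∈ , ag₁ , out₁
    with fR σ₁ σ₁∈ (σ₁ u ∷ X) (≤-trans (+-monoˡ-≤ (length X) {1} {2 * suc e} (s≤s z≤n)) bd)
  ... | σ₂ , σ₂∈ , ag₂ , out₂
    with zigzag {W} {R} B fW fR a Wz Wu Ru Rz e σ₂ (σ₁ u ∷ σ₂ z ∷ X) σ₂∈
           (≤-trans (≤-reflexive (lem e (length X))) bd)
    where
    lem : ∀ e x → 2 * e + suc (suc x) ≡ 2 * suc e + x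
    lem = solve-∀
  ... | τ , l , τ∈ , ag , len , w , en , l! , dis =
    τ , σ₁ u ∷ σ₂ z ∷ l , τ∈
    , (λ p Wp Rp → trans (ag₁ p Wp) (trans (ag₂ p Rp) (ag p Wp Rp)))
    , trans (cong (λ x → suc (suc x)) len) (lem e)
    , subst (_~ σ₁ u) (sym (ag₁ z Wz)) (hom-adj (hom σ₁∈) a)
      ∷ subst (_~ σ₂ z) (sym (ag₂ u Ru)) (~-sym (hom-adj (hom σ₂∈) a)) ∷ w
    , en
    , (All.tabulate (λ { (here refl) e → out₂ z Rz (here (sym e)) ; (there v∈) refl → dis v∈ (here refl) }))
      ∷ All.tabulate (λ { v∈ refl → dis v∈ (there (here refl)) }) ∷ l!
    , λ { (here refl) v∈ → out₁ u Wu v∈ ; (there (here refl)) v∈ → out₂ z Rz (there v∈)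
        ; (there (there w∈)) v∈ → dis w∈ (there (there v∈)) }
    where
    lem : ∀ e → suc (suc (2 * e)) ≡ 2 * suc e
    lem = solve-∀

  walksFrom : V → ℕ → List (List V)
  walksFrom v zero = [] ∷ []
  walksFrom v (suc j) = concatMap (λ u → map (u ∷_) (walksFrom u j)) (nbrs v)

  walksFrom-length : ∀ v j → length (walksFrom v j) ≤ Δ ^ j
  walksFrom-length v zero = ≤-refl
  walksFrom-length v (suc j) = ≤-trans (≤-reflexive (length-concatMap _ (nbrs v)))
    (≤-trans (∑-≤-const (nbrs v) (Δ ^ j) (λ u _ → ≤-trans (≤-reflexive (length-map′ _ (walksFrom u j))) (walksFrom-length u j)))
      (*-monoˡ-≤ (Δ ^ j) (deg≤ v)))

  walksFrom-∈ : ∀ {v l} → Walk _~_ v l → l ∈ walksFrom v (length l)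
  walksFrom-∈ [] = here refl
  walksFrom-∈ {v} (_∷_ {y = u} {ys} a w) = ∈-concatMap (λ u → map (u ∷_) (walksFrom u (length ys))) (∈-nbrs a) (∈-map⁺ (u ∷_) (walksFrom-∈ w))

  _≟L_ : DecidableEquality (List V)
  _≟L_ = ≡-dec _≟F_

  -- This makes the length of a list of items a count of different items.
  walksFrom-once : ∀ v j i → # (λ l → does (l ≟L i)) (walksFrom v j) ≤ 1
  walksFrom-once v zero i with [] ≟L i
  ... | yes _ = ≤-refl
  ... | no _ = z≤n
  walksFrom-once v (suc j) [] = ≤-trans (≤-reflexive (#-false (walksFrom v (suc j)) none)) z≤n
    where
    none : ∀ l → l ∈ walksFrom v (suc j) → does (l ≟L []) ≡ false
    none l l∈ with ∈-concatMap⁻′ (λ u → map (u ∷_) (walksFrom u j)) (nbrs v) l∈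
    ... | u , _ , l∈u with ∈-map⁻ (u ∷_) l∈u
    ... | l′ , _ , refl = false-does ((u ∷ l′) ≟L []) (λ ())
  walksFrom-once v (suc j) (x ∷ i) = ≤-trans (≤-reflexive (∑-concatMap (λ u → map (u ∷_) (walksFrom u j)) (nbrs v) _))
    (≤-trans (∑-mono (nbrs v) (λ u _ → ≤-trans (≤-reflexive (∑-map (u ∷_) (walksFrom u j) _)) (pt u (u ≟F x))))
      (#-point≤1 _≟F_ x (nbrs! v)))
    where
    pt : ∀ u (dec : Dec (u ≡ x)) → # (λ l → does ((u ∷ l) ≟L (x ∷ i))) (walksFrom u j) ≤ 𝟙 (does (u ≟F x))
    pt u (yes refl) rewrite true-does (u ≟F u) refl =
      walksFrom-once u j i
    pt u (no u≢x) = ≤-trans (≤-reflexive (#-false (walksFrom u j) (λ l _ → false-does ((u ∷ l) ≟L (x ∷ i)) (λ { refl → u≢x refl })))) z≤n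

-- Many values at some positions compatible with several values at another

module Extensions (T : RootedTree) (Ω : Host) (U : Sample T Ω)
  (f : Tree.Emb T Ω → Bool)
  (d>0 : 0 < Host.d Ω) (K>0 : 0 < Host.K Ω)
  (Γ Γ₁ : ℕ) (Γ>0 : 0 < Γ) (Γ₁≡ : Γ₁ ≡ Γ * Host.K Ω ^ length (RootedTree.all T))
  (s b₀ : ℕ) (s>0 : 0 < s) (b₀≡ : b₀ ≡ 2 * (Γ₁ * (s * Host.K Ω ^ 2)))
  where

  open Tree T Ω
  open Families T Ω U
  open Moves T Ω U f

  addAll : PSet → List P → PSet
  addAll R [] = R
  addAll R (q ∷ qs) = addAll (add R q) qs

  addAll-⊇ : ∀ R qs {p} → R p ≡ true → addAll R qs p ≡ true
  addAll-⊇ R [] h = h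
  addAll-⊇ R (q ∷ qs) h = addAll-⊇ (add R q) qs (add-⊇ R q h)

  addAll⁻ : ∀ R qs {p} → addAll R qs p ≡ true → R p ≡ true ⊎ p ∈ qs
  addAll⁻ R [] h = inj₁ h
  addAll⁻ R (q ∷ qs) h with addAll⁻ (add R q) qs h
  ... | inj₂ p∈ = inj₂ (there p∈)
  ... | inj₁ k with add⁻ R q k
  ... | inj₁ r = inj₁ r
  ... | inj₂ refl = inj₂ (here refl)

  gap-addAll : ∀ R qs → Unique qs → (∀ q → q ∈ qs → R q ≡ false) → gap full R ≡ length qs + gap full (addAll R qs)
  gap-addAll R [] _ _ = refl
  gap-addAll R (q ∷ qs) (q∉ ∷ qs!) out = trans (gap-add full R q (out q (here refl)) refl)
    (cong suc (gap-addAll (add R q) qs qs! (λ x x∈ → ¬true⇒false (λ h → case add⁻ R q h of λ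
      { (inj₁ k) → true≢false k (out x (there x∈)) ; (inj₂ refl) → All.lookup q∉ x∈ refl }))))

  map-agree : ∀ {σ τ : Emb} qs → map σ qs ≡ map τ qs → ∀ {q} → q ∈ qs → σ q ≡ τ q
  map-agree (q ∷ qs) e (here refl) = ∷-injectiveˡ e
  map-agree (q ∷ qs) e (there q∈) = map-agree qs (∷-injectiveʳ e) q∈

  -- A complete bipartite pattern: every one of the `s` values in `ps` at `α` occurs together with
  -- every tuple in `items` at `qs`, always with the values of `σ₀` on `R₀`. The number of items has
  -- the order `d ^ length qs`, the largest possible.
  record Spread (R₀ : PSet) (α : P) (qs : List P) (σ₀ : Emb) : Set where
    field
      ps     : List V
      len    : length ps ≡ s
      ps!    : Unique ps
      items  : List (List V)
      once   : ∀ i → # (λ l → does (l ≟L i)) items ≤ 1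
      linked : ∀ {i p} → i ∈ items → p ∈ ps → ∃[ τ ] τ ∈ᶠ f × Agree R₀ σ₀ τ × τ α ≡ p × map τ qs ≡ i
      many   : d ^ length qs ≤ 2 * Γ₁ * 2 ^ b₀ * length items

  values : ∀ {R₀ B} α → Flex f R₀ B → R₀ α ≡ false → ∀ {σ₀} → σ₀ ∈ᶠ f → ∀ m → m ≤ B →
           ∃[ ps ] length ps ≡ m × Unique ps × (∀ {p} → p ∈ ps → ∃[ τ ] τ ∈ᶠ f × Agree R₀ σ₀ τ × τ α ≡ p)
  values α flx out σ₀∈ zero _ = [] , refl , [] , λ ()
  values α flx out σ₀∈ (suc m) m< with values α flx out σ₀∈ m (≤-trans (n≤1+n m) m<)
  ... | ps , l , u , w with flx _ σ₀∈ ps (≤-trans (≤-reflexive l) (≤-trans (n≤1+n m) m<))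
  ... | τ , τ∈ , a , fr = τ α ∷ ps , cong suc l , All.tabulate (λ { v∈ refl → fr α out v∈ }) ∷ u
    , λ { (here refl) → τ , τ∈ , a , refl ; (there p∈) → w p∈ }

  -- The rows are `b₀` values at `α`, produced by moves that keep `R₀`. The items lie among the
  -- walks from the fixed vertex `σ₀ x₀`, at most `(K * d) ^ length qs` of them. A row has a fibre
  -- over `R₁` of size at least `d ^ gap full R₁` divided by `Γ`, of which each item accounts for at
  -- most `(K * d) ^ m′`; so each row meets a positive proportion of the items.
  spread : ∀ R₀ R₁ α x₀ qs B → (∀ p → R₀ p ≡ true → R₁ p ≡ true) → (∀ p → R₁ p ≡ true → R₀ p ≡ true ⊎ p ≡ α) →
           R₁ α ≡ true → R₀ α ≡ false → R₀ x₀ ≡ true → Walk Adj x₀ qs → Unique qs → (∀ q → q ∈ qs → R₁ q ≡ false) →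
           length qs ≤ 2 → Flex f R₀ B → b₀ ≤ B → (∀ σ → σ ∈ᶠ f → d ^ gap full R₁ ≤ Γ * fib f R₁ σ) →
           ∀ σ₀ → σ₀ ∈ᶠ f → Spread R₀ α qs σ₀
  spread R₀ R₁ α x₀ qs B R₀⊆ R₁⊆ R₁α R₀α x₀∈ w qs! out lq flx b₀≤ dns σ₀ σ₀∈ = record
    { ps = ps ; len = len ; ps! = uniq rows! ; items = items
    ; once = λ i → ≤-trans (≤-reflexive (∑-filterᵇ (common ps) walks _)) (≤-trans
        (∑-mono walks (λ l _ → ≤-trans (*-monoˡ-≤ (𝟙 (does (l ≟L i))) (𝟙≤1 (common ps l))) (≤-reflexive (*-identityˡ _))))
        (walksFrom-once (σ₀ x₀) j i))
    ; linked = λ {i} {p} i∈ p∈ → related p i (common-∈ {ps} {i} (proj₂ (∈-filterᵇ⁻ (common ps) walks i∈)) p∈)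
    ; many = ≤-trans D≤ (≤-reflexive (cong₂ (λ b c → 2 * Γ₁ * 2 ^ b * c) rows-len (sym (length-filterᵇ (common ps) walks))))
    }
    where
    j = length qs
    rowData = values {R₀} α flx R₀α σ₀∈ b₀ b₀≤
    rows = proj₁ rowData
    rows-len = proj₁ (proj₂ rowData)
    rows! = proj₁ (proj₂ (proj₂ rowData))
    witness = proj₂ (proj₂ (proj₂ rowData))
    walks = walksFrom (σ₀ x₀) j
    joins : V → List V → Fam
    joins p i τ = inFib f R₀ σ₀ τ ∧ (does (τ α ≟F p) ∧ does (map τ qs ≟L i))
    rel : V → List V → Bool
    rel p i = does (0 <? size (joins p i))
    open KST rel
    related : ∀ p i → rel p i ≡ true → ∃[ τ ] τ ∈ᶠ f × Agree R₀ σ₀ τ × τ α ≡ p × map τ qs ≡ i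
    related p i h =
      let τ , τ∈ , k = #-pos (joins p i) 𝒰 (does-true (0 <? size (joins p i)) h)
          k₁ , k₂ = ∧-true {inFib f R₀ σ₀ τ} k
          fτ , a = inFib-elim f R₀ σ₀ τ k₁
          k₃ , k₄ = ∧-true {does (τ α ≟F p)} k₂
      in τ , (τ∈ , fτ) , a , does-true (τ α ≟F p) k₃ , does-true (map τ qs ≟L i) k₄
    m′ = gap full (addAll R₁ qs)
    m≡ : gap full R₁ ≡ j + m′
    m≡ = gap-addAll R₁ qs qs! out
    fibre≤ : ∀ p τ₀ → τ₀ ∈ᶠ f → Agree R₀ σ₀ τ₀ → τ₀ α ≡ p → fib f R₁ τ₀ ≤ # (rel p) walks * (K * d) ^ m′
    fibre≤ p τ₀ τ₀∈ a₀ e₀ = ≤-trans (#-union Q 𝒰 (filterᵇ (rel p) walks) cover)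
      (≤-trans (∑-≤-const (filterᵇ (rel p) walks) ((K * d) ^ m′) (λ i _ → class≤ i))
        (≤-reflexive (cong (_* (K * d) ^ m′) (length-filterᵇ (rel p) walks))))
      where
      Q : List V → Fam
      Q i τ = inFib f R₁ τ₀ τ ∧ does (map τ qs ≟L i)
      cover : ∀ τ → τ ∈ 𝒰 → inFib f R₁ τ₀ τ ≡ true → ∃[ i ] i ∈ filterᵇ (rel p) walks × Q i τ ≡ true
      cover τ τ∈ k =
        let fτ , a = inFib-elim f R₁ τ₀ τ k
            a₁ : Agree R₀ σ₀ τ
            a₁ = Agree-trans R₀ a₀ (λ q h → a q (R₀⊆ q h))
            walk = subst (λ v → Walk _~_ v (map τ qs)) (sym (a₁ x₀ x₀∈)) (Walk-map τ (hom-adj (proj₁ (ok τ τ∈))) w)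
            mem = subst (λ c → map τ qs ∈ walksFrom (σ₀ x₀) c) (length-map′ τ qs) (walksFrom-∈ walk)
        in map τ qs
         , ∈-filterᵇ⁺ (rel p) mem (true-does (0 <? size (joins p (map τ qs))) (#-∈ τ∈
             (∧-intro (inFib-intro {f} {R₀} {σ₀} {τ} fτ a₁) (∧-intro (true-does (τ α ≟F p) (trans (sym (a α R₁α)) e₀))
               (true-does (map τ qs ≟L map τ qs) refl)))))
         , ∧-intro k (true-does (map τ qs ≟L map τ qs) refl)
      class≤ : ∀ i → size (Q i) ≤ (K * d) ^ m′
      class≤ i = #-by-member (Q i) 𝒰 _ (λ υ υ∈ k → ≤-trans (#-mono 𝒰 (λ τ _ l → inside υ τ k l))
                   (fib≤Δ^ f (addAll R₁ qs) α υ (addAll-⊇ R₁ qs R₁α)))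
        where
        inside : ∀ υ τ → Q i υ ≡ true → Q i τ ≡ true → inFib f (addAll R₁ qs) υ τ ≡ true
        inside υ τ k l =
          let k₁ , k₂ = ∧-true {inFib f R₁ τ₀ υ} k
              l₁ , l₂ = ∧-true {inFib f R₁ τ₀ τ} l
              _ , a = inFib-elim f R₁ τ₀ υ k₁
              fτ , a′ = inFib-elim f R₁ τ₀ τ l₁
              e = trans (does-true (map υ qs ≟L i) k₂) (sym (does-true (map τ qs ≟L i) l₂))
          in inFib-intro {f} {addAll R₁ qs} {υ} {τ} fτ (λ q h → case addAll⁻ R₁ qs h of λ
               { (inj₁ r) → trans (sym (a q r)) (a′ q r) ; (inj₂ q∈) → map-agree qs e q∈ })
    instance
      d≢0 : NonZero d
      d≢0 = >-nonZero d>0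
      K≢0 : NonZero K
      K≢0 = >-nonZero K>0
    dense : ∀ p → p ∈ rows → d ^ j ≤ Γ₁ * # (rel p) walks
    dense p p∈ with witness p∈
    ... | τ₀ , τ₀∈ , a₀ , e₀ = *-cancelʳ-≤ _ _ (d ^ m′) {{m^n≢0 d m′}} (begin
      d ^ j * d ^ m′                          ≡⟨ sym (^-distribˡ-+-* d j m′) ⟩
      d ^ (j + m′)                            ≡⟨ cong (d ^_) (sym m≡) ⟩
      d ^ gap full R₁                         ≤⟨ dns τ₀ τ₀∈ ⟩
      Γ * fib f R₁ τ₀                         ≤⟨ *-monoʳ-≤ Γ (fibre≤ p τ₀ τ₀∈ a₀ e₀) ⟩
      Γ * (# (rel p) walks * (K * d) ^ m′)        ≡⟨ cong (λ x → Γ * (# (rel p) walks * x)) (^-distrib K d m′) ⟩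
      Γ * (# (rel p) walks * (K ^ m′ * d ^ m′))   ≡⟨ lem Γ (# (rel p) walks) (K ^ m′) (d ^ m′) ⟩
      Γ * K ^ m′ * # (rel p) walks * d ^ m′       ≤⟨ *-monoˡ-≤ (d ^ m′) (*-monoˡ-≤ (# (rel p) walks) (*-monoʳ-≤ Γ (^-monoʳ-≤ K (#≤length _ all)))) ⟩
      Γ * K ^ N * # (rel p) walks * d ^ m′        ≡⟨ cong (λ x → x * # (rel p) walks * d ^ m′) (sym Γ₁≡) ⟩
      Γ₁ * # (rel p) walks * d ^ m′               ∎)
      where
      open ≤-Reasoning
      lem : ∀ g r k e → g * (r * (k * e)) ≡ g * k * r * e
      lem = solve-∀
    walks≤ : length walks ≤ K ^ 2 * d ^ j
    walks≤ = ≤-trans (walksFrom-length (σ₀ x₀) j) (≤-trans (≤-reflexive (^-distrib K d j)) (*-monoˡ-≤ (d ^ j) (^-monoʳ-≤ K lq)))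
    Γ₁>0 : 0 < Γ₁
    Γ₁>0 = ≤-trans (*-mono-≤ Γ>0 (m^n>0 K N)) (≤-reflexive (sym Γ₁≡))
    chosen = denseKST rows s walks Γ₁ (K ^ 2) (d ^ j) Γ₁>0 (m^n>0 K 2) s>0 (m^n>0 d j) (trans rows-len b₀≡) walks≤ dense
    ps = proj₁ chosen
    len = proj₁ (proj₂ chosen)
    uniq = proj₁ (proj₂ (proj₂ (proj₂ chosen)))
    D≤ = proj₂ (proj₂ (proj₂ (proj₂ chosen)))
    items = filterᵇ (common ps) walks

-- Two positions of W joined by a path outside W

module LinkCase (T : RootedTree) (Ω : Host) (U : Sample T Ω)
  (f : Tree.Emb T Ω → Bool)
  (d>0 : 0 < Host.d Ω) (K>0 : 0 < Host.K Ω)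
  (Γ Γ₁ : ℕ) (Γ>0 : 0 < Γ) (Γ₁≡ : Γ₁ ≡ Γ * Host.K Ω ^ length (RootedTree.all T))
  (s b₀ : ℕ) (s>0 : 0 < s) (b₀≡ : b₀ ≡ 2 * (Γ₁ * (s * Host.K Ω ^ 2)))
  (t κ Θ b B : ℕ) (Θ≡ : Θ ≡ 2 * Γ₁ * 2 ^ b₀)
  (b≥ : s * κ + suc (Assembly.bound (Host.G Ω) s t κ) ≤ b)
  (B≥ : Host.K Ω * b * Θ + b + (b₀ + suc (κ + b)) ≤ B)
  (d-large : Θ * (2 * b * Host.K Ω) < Host.d Ω)
  where

  open Tree T Ω
  open Families T Ω U
  open Moves T Ω U f
  open Extensions T Ω U f d>0 K>0 Γ Γ₁ Γ>0 Γ₁≡ s b₀ s>0 b₀≡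
  open Assembly G s t κ

  outside : List V → V → Bool
  outside X u = not (does (memberOf _≟F_ u X))

  outside⁺ : ∀ {X u} → u ∉ X → outside X u ≡ true
  outside⁺ {X} {u} h = not-false (false-does (memberOf _≟F_ u X) h)

  outside⁻ : ∀ {X u} → outside X u ≡ true → u ∉ X
  outside⁻ {X} {u} h u∈ = true≢false (true-does (memberOf _≟F_ u X) u∈) (not-true h)

  -- Each vertex of `X` spoils at most the one item that codes it.
  escape : ∀ (items : List (List V)) → (∀ i → # (λ l → does (l ≟L i)) items ≤ 1) →
           ∀ (code : V → List V) (sel : List V → Bool) X → length X < # sel items →
           ∃[ i ] i ∈ items × sel i ≡ true × (∀ x → x ∈ X → i ≢ code x)
  escape items once code sel X lt with find (λ i → sel i ∧ not (does (0 <? # (λ x → does (i ≟L code x)) X))) items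
  ... | inj₁ (i , i∈ , h) = let h₁ , h₂ = ∧-true {sel i} h in i , i∈ , h₁ , λ x x∈ e →
          true≢false (true-does (0 <? # (λ x → does (i ≟L code x)) X) (#-∈ x∈ (true-does (i ≟L code x) e))) (not-true h₂)
  ... | inj₂ none = ⊥-elim (<⇒≱ lt (≤-trans
          (#-union (λ x i → does (i ≟L code x)) items X (λ i i∈ h →
            let x , x∈ , e = #-pos (λ x → does (i ≟L code x)) X (does-true (0 <? # (λ x → does (i ≟L code x)) X)
                  (hit (sel i) (does (0 <? # (λ x → does (i ≟L code x)) X)) h (none i i∈)))
            in x , x∈ , e))
          (≤-trans (∑-≤-const X 1 (λ x _ → once (code x))) (≤-reflexive (*-identityʳ _)))))
    where
    hit : ∀ a c → a ≡ true → a ∧ not c ≡ false → c ≡ true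
    hit true true _ _ = refl
    hit true false _ ()
    hit false c () _

  module Link (W : PSet) (α β y : P) (D′ : List P)
    (walkT : Walk Adj β (y ∷ D′ ++ α ∷ [])) (uniqT : Unique (β ∷ y ∷ D′ ++ α ∷ []))
    (Wα : W α ≡ true) (Wβ : W β ≡ true) (WD : ∀ p → p ∈ y ∷ D′ → W p ≡ false)
    (short : suc (length D′) ≤ κ)
    (flexW : Flex f W B) (flexα : Flex f ⟦ β ∷ y ∷ D′ ⟧ B)
    where

    D : List P
    D = y ∷ D′

    β∉ : ∀ {p} → p ∈ D ++ α ∷ [] → β ≢ p
    β∉ p∈ = All.lookup (AllPairs.head uniqT) p∈

    y∉ : ∀ {p} → p ∈ D′ ++ α ∷ [] → y ≢ p
    y∉ p∈ = All.lookup (AllPairs.head (AllPairs.tail uniqT)) p∈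

    α∉D′ : α ∉ D′
    α∉D′ = last∉ D′ (AllPairs.tail (AllPairs.tail uniqT))

    α∉D : α ∉ D
    α∉D (here refl) = y∉ (∈-++⁺ʳ D′ (here refl)) refl
    α∉D (there m) = α∉D′ m

    -- One witness suffices for a robust link: as `α` and `β` lie in `W`, flexibility over `W` keeps
    -- `p` and `q` and moves the path between them off any bounded set.
    Linked : V → V → Set
    Linked p q = ∃[ σ ] σ ∈ᶠ f × σ α ≡ p × σ β ≡ q

    -- The zigzag moves the image of `α` while the set kept by the second move contains `β`, so `q`
    -- stays. A last move over `W` then takes the path between the new image of `α` and `q` off the
    -- zigzag and `X`.
    linkWalk : ∀ {p q} e X → Linked p q → 2 * e + length X ≤ B →
               ∃[ l ] length l ≡ 2 * e + suc (length D′) × Walk _~_ p (l ++ q ∷ []) × Unique l × Disjoint l X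
    linkWalk {p} {q} e X (σ , σ∈ , refl , refl) bd
      with zigzag {W} {⟦ β ∷ D ⟧} B flexW flexα u~α Wα (WD _ (end-∈ y D′)) (∈⟦⟧ (β ∷ D) (there (end-∈ y D′)))
             (∉⟦⟧ (β ∷ D) (λ { (here refl) → β∉ (∈-++⁺ʳ D (here refl)) refl ; (there m) → α∉D m })) e σ X σ∈ bd
      where
      u~α : Adj α (end y D′)
      u~α = Adj-sym (walk-head (Walk-++⁻ʳ D walkT))
    ... | τ , l , τ∈ , ag , len , w , en , l! , dis
      with flexW τ τ∈ (l ++ X) (≤-trans (≤-reflexive (trans (length-++ l) (cong (_+ length X) len))) bd)
    ... | υ , υ∈ , ag′ , fr = l ++ seg
      , trans (length-++ l) (cong₂ _+_ len (trans (length-map′ υ (reverse D)) (length-reverse D)))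
      , subst (Walk _~_ (σ α)) (sym (++-assoc l seg (σ β ∷ [])))
          (Walk-++ l w (subst₂ (λ a c → Walk _~_ a (seg ++ c ∷ [])) (trans (sym (ag′ α Wα)) (sym en))
            (trans (sym (ag′ β Wβ)) (sym (ag β Wβ (∈⟦⟧ (β ∷ D) (here refl)))))
            (subst (Walk _~_ (υ α)) (map-++ υ (reverse D) (β ∷ []))
              (Walk-map υ (hom-adj (hom υ∈)) (Walk-reverse Adj-sym D walkT)))))
      , Unique-++ l! (Unique-map υ (inj υ∈ _ _) (Unique-reverse D D!)) (λ v∈ v∈s → seg∉ v∈s (∈-++⁺ˡ v∈))
      , Disjoint-++ˡ dis (λ v∈s v∈X → seg∉ v∈s (∈-++⁺ʳ l v∈X))
      where
      seg = map υ (reverse D)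
      D! : Unique D
      D! = Unique-prefix D (AllPairs.tail uniqT)
      seg∉ : ∀ {v} → v ∈ seg → v ∉ l ++ X
      seg∉ v∈ with ∈-map⁻ υ v∈
      ... | p , p∈ , refl = fr p (WD p (∈-reverse⁻ D p∈))

    -- If the parity is right, `q` is the centre. Otherwise `h` is the centre, and each leg arrives
    -- there through a `q` of its own; this is why a hub has to serve for every bounded `X′`.
    Serves : List V → V → List V → Set
    Serves ps h X = ∃[ q ] q ∉ X × h ~ q × (∀ {p} → p ∈ ps → Linked p q)

    HubOutside : List V → List V → Set
    HubOutside ps X = ∃[ h ] h ∉ X × (∀ X′ → length X′ ≤ b → Serves ps h X′)

    record Hubs : Set where
      field
        ps  : List V
        len : length ps ≡ s
        ps! : Unique ps
        hub : ∀ X → length X ≤ b → HubOutside ps X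

    someone : ∀ (ps : List V) → length ps ≡ s → ∃[ p ] p ∈ ps
    someone [] e = ⊥-elim (<-irrefl e s>0)
    someone (p ∷ ps) _ = p , here refl

    -- For a two-edge link the items q are neighbours of the image of y, and each of them has more than B - b
    -- common neighbours with p₁ outside X. As p₁ has only K d neighbours, some neighbour serves many items.
    hubs-short : D′ ≡ [] → ∀ σ₀ → σ₀ ∈ᶠ f → Spread ⟦ y ∷ [] ⟧ α (β ∷ []) σ₀ → Hubs
    hubs-short refl σ₀ σ₀∈ sp = record { ps = ps ; len = len ; ps! = ps! ; hub = hub }
      where
      open Spread sp
      p₁ = proj₁ (someone ps len)
      p₁∈ = proj₂ (someone ps len)
      inc : V → List V → Bool
      inc u [] = false
      inc u (q ∷ _) = adj G u q
      good : List V → V → List V → Bool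
      good X u i = outside X u ∧ inc u i
      I≥ : d ≤ Θ * length items
      I≥ = ≤-trans (≤-reflexive (sym (*-identityʳ d))) (≤-trans many (≤-reflexive (cong (_* length items) (sym Θ≡))))
      I>0 : 0 < length items
      I>0 = n≢0⇒n>0 (λ e → <⇒≱ d>0 (≤-trans I≥ (≤-reflexive (trans (cong (Θ *_) e) (*-zeroʳ Θ)))))
      -- If the common neighbours outside `X` were few, a move over `W` would take `y` off all of
      -- them and off `X`, although its new image is again a common neighbour of `p₁` and the item.
      popular : ∀ X → length X ≤ b → ∀ i → i ∈ items → suc B ≤ # (λ u → good X u i) (nbrs p₁) + b
      popular X lX i i∈ with linked i∈ p₁∈
      ... | τ , τ∈ , _ , τα , refl = ≰⇒> (λ le →
        let L = filterᵇ (λ u → good X u (τ β ∷ [])) (nbrs p₁)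
            υ , υ∈ , ag , fr = flexW τ τ∈ (L ++ X) (≤-trans (≤-reflexive (trans (length-++ L)
                (cong (_+ length X) (length-filterᵇ (λ u → good X u (τ β ∷ [])) (nbrs p₁))))) (≤-trans (+-monoʳ-≤ _ lX) le))
            y∉X = fr y (WD y (here refl))
        in y∉X (∈-++⁺ˡ (∈-filterᵇ⁺ _ (∈-nbrs (subst (_~ υ y) (trans (sym (ag α Wα)) τα) (~-sym (hom-adj (hom υ∈) yα))))
             (∧-intro (outside⁺ (λ m → y∉X (∈-++⁺ʳ L m)))
               (subst (υ y ~_) (sym (ag β Wβ)) (~-sym (hom-adj (hom υ∈) βy)))))))
        where
        βy : Adj β y
        βy = walk-head walkT
        yα : Adj y α
        yα = walk-head (walk-tail walkT)
      hub : ∀ X → length X ≤ b → HubOutside ps X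
      hub X lX with ∑-pigeon (nbrs p₁) (λ u → # (good X u) items) (λ _ → b) total
        where
        open ≤-Reasoning
        served = ∑ (nbrs p₁) (λ u → # (good X u) items)
        I = length items
        -- `I` is at least `d` divided by `Θ`, and `p₁` has at most `K * d` neighbours; the summand
        -- `K * b * Θ + b` in the bound on `B` makes the average neighbour serve more than `b`
        -- items.
        total : ∑ (nbrs p₁) (λ _ → b) < served
        total = +-cancelʳ-< (I * b) _ _ (begin-strict
          ∑ (nbrs p₁) (λ _ → b) + I * b     ≡⟨ cong (_+ I * b) (∑-const (nbrs p₁) b) ⟩
          length (nbrs p₁) * b + I * b      ≤⟨ +-monoˡ-≤ (I * b) (*-monoˡ-≤ b (deg≤ p₁)) ⟩
          K * d * b + I * b                 ≤⟨ +-monoˡ-≤ (I * b) (*-monoˡ-≤ b (*-monoʳ-≤ K I≥)) ⟩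
          K * (Θ * I) * b + I * b           ≡⟨ lem K Θ I b ⟩
          I * (K * b * Θ + b)               <⟨ *-monoʳ-< I {{>-nonZero I>0}} (s≤s (≤-trans (m≤m+n _ _) B≥)) ⟩
          I * suc B                         ≡⟨ sym (∑-const items (suc B)) ⟩
          ∑ items (λ _ → suc B)             ≤⟨ ∑-mono items (popular X lX) ⟩
          ∑ items (λ i → # (λ u → good X u i) (nbrs p₁) + b)
                                            ≡⟨ ∑-+ items _ (λ _ → b) ⟩
          ∑ items (λ i → # (λ u → good X u i) (nbrs p₁)) + ∑ items (λ _ → b)
                                            ≡⟨ cong₂ _+_ (∑-swap items (nbrs p₁) (λ i u → 𝟙 (good X u i))) (∑-const items b) ⟩
          served + I * b                       ∎)
          where
          lem : ∀ k θ i b → k * (θ * i) * b + i * b ≡ i * (k * b * θ + b)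
          lem = solve-∀
      ... | u , _ , rich = u
        , (let i , _ , h = #-pos (good X u) items (≤-trans (s≤s z≤n) rich) in outside⁻ (proj₁ (∧-true {outside X u} h)))
        , λ X′ lX′ → pick X′ (escape items once (λ q → q ∷ []) (good X u) X′ (≤-<-trans lX′ rich))
        where
        pick : ∀ X′ → (∃[ i ] i ∈ items × good X u i ≡ true × (∀ x → x ∈ X′ → i ≢ x ∷ [])) → Serves ps u X′
        pick X′ (i , i∈ , g , new) with linked i∈ p₁∈
        ... | τ , _ , _ , _ , refl = τ β , (λ m → new (τ β) m refl) , proj₂ (∧-true {outside X u} g) , all-linked
          where
          all-linked : ∀ {p} → p ∈ ps → Linked p (τ β)
          all-linked p∈ with linked i∈ p∈
          ... | υ , υ∈ , _ , υα , e = υ , υ∈ , υα , ∷-injectiveˡ e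

    -- For a longer link the items are the pairs of images of y and β; both may vary while the images of D′ stay fixed.
    hubs-long : ∀ {x D″} → D′ ≡ x ∷ D″ → ∀ σ₀ → σ₀ ∈ᶠ f → Spread ⟦ D′ ⟧ α (y ∷ β ∷ []) σ₀ → Hubs
    hubs-long {x} {D″} refl σ₀ σ₀∈ sp = record { ps = ps ; len = len ; ps! = ps! ; hub = hub }
      where
      open Spread sp
      p₁ = proj₁ (someone ps len)
      p₁∈ = proj₂ (someone ps len)
      heads : V → List V → Bool
      heads u [] = false
      heads u (h ∷ _) = does (h ≟F u)
      good : List V → V → List V → Bool
      good X u i = outside X u ∧ heads u i
      I = length items
      I≥ : d * d ≤ Θ * I
      I≥ = ≤-trans (≤-reflexive (cong (d *_) (sym (*-identityʳ d)))) (≤-trans many (≤-reflexive (cong (_* I) (sym Θ≡))))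
      βy : Adj β y
      βy = walk-head walkT
      yx : Adj y x
      yx = walk-head (walk-tail walkT)
      Y = nbrs (σ₀ x)
      fewHeads : ∀ u → # (heads u) items ≤ K * d
      fewHeads u = ≤-trans (#-union (λ q i → does (i ≟L (u ∷ q ∷ []))) items (nbrs u) cover)
        (≤-trans (∑-≤-const (nbrs u) 1 (λ q _ → once (u ∷ q ∷ []))) (≤-trans (≤-reflexive (*-identityʳ _)) (deg≤ u)))
        where
        cover : ∀ i → i ∈ items → heads u i ≡ true → ∃[ q ] q ∈ nbrs u × does (i ≟L (u ∷ q ∷ [])) ≡ true
        cover i i∈ h with linked i∈ p₁∈
        ... | τ , τ∈ , _ , _ , refl with does-true (τ y ≟F u) h
        ... | refl = τ β , ∈-nbrs (~-sym (hom-adj (hom τ∈) βy)) , true-does ((τ y ∷ τ β ∷ []) ≟L (τ y ∷ τ β ∷ [])) refl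
      hub : ∀ X → length X ≤ b → HubOutside ps X
      hub X lX with ∑-pigeon Y (λ u → # (good X u) items) (λ _ → b) total
        where
        open ≤-Reasoning
        served = ∑ Y (λ u → # (good X u) items)
        fresh-head used-head : List V → Bool
        fresh-head i = does (0 <? # (λ u → good X u i) Y)
        used-head i = does (0 <? # (λ u → heads u i) X)
        cover : ∀ i → i ∈ items → true ≡ true → fresh-head i ≡ true ⊎ used-head i ≡ true
        cover i i∈ _ with linked i∈ p₁∈
        ... | τ , τ∈ , ag , _ , refl = decide (memberOf _≟F_ (τ y) X)
          where
          same : does (τ y ≟F τ y) ≡ true
          same = true-does (τ y ≟F τ y) refl
          decide : Dec (τ y ∈ X) → _
          decide (yes m) = inj₂ (true-does (0 <? _) (#-∈ m same))
          decide (no m) = inj₁ (true-does (0 <? _) (#-∈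
            (∈-nbrs (subst (_~ τ y) (sym (ag x (∈⟦⟧ D′ (here refl)))) (~-sym (hom-adj (hom τ∈) yx))))
            (∧-intro (outside⁺ m) same)))
        I≤ : I ≤ served + b * (K * d)
        I≤ = begin
          I                                      ≡⟨ length≡∑ items ⟩
          # (λ _ → true) items                   ≤⟨ #-∪ items cover ⟩
          # fresh-head items + # used-head items
            ≤⟨ +-mono-≤ (#-union good′ items Y (λ i _ h → #-pos (λ u → good X u i) Y (does-true (0 <? _) h)))
                        (#-union heads items X (λ i _ h → #-pos (λ u → heads u i) X (does-true (0 <? _) h))) ⟩
          served + ∑ X (λ u → # (heads u) items)    ≤⟨ +-monoʳ-≤ served (∑-≤-const X (K * d) (λ u _ → fewHeads u)) ⟩
          served + length X * (K * d)               ≤⟨ +-monoʳ-≤ served (*-monoˡ-≤ (K * d) lX) ⟩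
          served + b * (K * d)                      ∎
          where
          good′ = good X
        -- Items whose head lies in `X` number at most `b * (K * d)`, and the heads all lie in `Y`,
        -- the neighbourhood of a fixed vertex. If no head outside `X` served more than `b` items,
        -- `I` would be linear in `d`, whereas `Θ * I` is at least `d * d`.
        total : ∑ Y (λ _ → b) < served
        total = ≰⇒> (λ le → <⇒≱ d-large (*-cancelˡ-≤ d {{>-nonZero d>0}} (begin
          d * d                                  ≤⟨ I≥ ⟩
          Θ * I                                  ≤⟨ *-monoʳ-≤ Θ I≤ ⟩
          Θ * (served + b * (K * d))                ≤⟨ *-monoʳ-≤ Θ (+-monoˡ-≤ _ (≤-trans le (≤-trans (≤-reflexive (∑-const Y b)) (*-monoˡ-≤ b (deg≤ (σ₀ x)))))) ⟩
          Θ * (K * d * b + b * (K * d))          ≡⟨ lem Θ K d b ⟩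
          d * (Θ * (2 * b * K))                  ∎)))
          where
          lem : ∀ θ k d b → θ * (k * d * b + b * (k * d)) ≡ d * (θ * (2 * b * k))
          lem = solve-∀
      ... | u , _ , rich = u
        , (let i , _ , h = #-pos (good X u) items (≤-trans (s≤s z≤n) rich) in outside⁻ (proj₁ (∧-true {outside X u} h)))
        , λ X′ lX′ → pick X′ (escape items once (λ q → u ∷ q ∷ []) (good X u) X′ (≤-<-trans lX′ rich))
        where
        pick : ∀ X′ → (∃[ i ] i ∈ items × good X u i ≡ true × (∀ x → x ∈ X′ → i ≢ u ∷ x ∷ [])) → Serves ps u X′
        pick X′ (i , i∈ , g , new) with linked i∈ p₁∈
        ... | τ , τ∈ , _ , _ , refl with does-true (τ y ≟F u) (proj₂ (∧-true {outside X u} g))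
        ... | refl = τ β , (λ m → new (τ β) m refl) , ~-sym (hom-adj (hom τ∈) βy) , all-linked
          where
          all-linked : ∀ {p} → p ∈ ps → Linked p (τ β)
          all-linked p∈ with linked i∈ p∈
          ... | υ , υ∈ , _ , υα , e = υ , υ∈ , υα , ∷-injectiveˡ (∷-injectiveʳ e)

    spiders : Hubs → ContainsSubdivKst G s t (suc κ)
    spiders hubs = assemble x (at-injective ps len ps!) spider
      where
      open Hubs hubs
      x : Fin s → V
      x = at ps len
      Leg : V → Fin s → List V → Set
      Leg c i l = length l ≡ κ × Walk _~_ (x i) (l ++ c ∷ []) × Unique l
      bound≤ : ∀ {X : List V} → length X ≤ bound → length X ≤ b
      bound≤ lX = ≤-trans lX (≤-trans (n≤1+n bound) (≤-trans (m≤n+m _ (s * κ)) b≥))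
      κ+b≤B : suc (κ + b) ≤ B
      κ+b≤B = ≤-trans (m≤n+m _ b₀) (≤-trans (m≤n+m _ (K * b * Θ + b)) B≥)
      legs : ∀ c X → c ∉ X → length X ≤ bound →
             (∀ i X′ → length X′ ≤ b → ∃[ l ] Leg c i l × length l ≤ κ × Disjoint l X′) → LeggedSpider x X
      legs c X c∉ lX step = record
        { centre = c ; leg = l
        ; len = λ i → proj₁ (proj₁ (q i)) ; walk = λ i → proj₁ (proj₂ (proj₁ (q i))) ; leg! = λ i → proj₂ (proj₂ (proj₁ (q i)))
        ; apart = proj₂ (proj₂ chosen) ; centre∉ = λ i c∈ → proj₂ (q i) c∈ (here refl)
        ; legX = λ i v∈ m → proj₂ (q i) v∈ (there m) ; centreX = c∉ }
        where
        chosen = choose s (Leg c) κ b step (c ∷ X) (≤-trans (+-monoʳ-≤ (s * κ) (s≤s lX)) b≥)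
        l = proj₁ chosen
        q = proj₁ (proj₂ chosen)
      spider : ∀ X → (∀ i → x i ∈ X) → length X ≤ bound → LeggedSpider x X
      spider X x∈ lX with hub X (bound≤ {X} lX) | halve (κ ∸ suc (length D′))
      -- The missing length is even, so a single `q` is the centre for all legs.
      ... | h , h∉ , serves | e , inj₁ even = case serves X (bound≤ {X} lX) of λ
        { (q , q∉ , _ , linked) → legs q X q∉ lX (λ i X′ lX′ →
          let l , ll , w , l! , dis = linkWalk e X′ (linked (at-∈ ps len i)) (≤-trans (+-mono-≤ 2e≤κ lX′) (≤-trans (n≤1+n _) κ+b≤B))
          in l , (trans ll κ≡ , w , l!) , ≤-reflexive (trans ll κ≡) , dis) }
        where
        κ≡ : 2 * e + suc (length D′) ≡ κ
        κ≡ = trans (cong (_+ suc (length D′)) (sym even)) (m∸n+n≡m short)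
        2e≤κ : 2 * e ≤ κ
        2e≤κ = ≤-trans (m≤m+n _ _) (≤-reflexive κ≡)
      -- The missing length is odd: the additional step leads from a private `q` to the hub `h`, and
      -- `q` joins the vertices to be avoided by its own walk.
      ... | h , h∉ , serves | e , inj₂ odd = legs h X h∉ lX (λ i X′ lX′ →
          let q , q∉ , h~q , linked = serves X′ lX′
              l , ll , w , l! , dis = linkWalk e (q ∷ X′) (linked (at-∈ ps len i))
                (≤-trans (+-mono-≤ 2e≤κ (s≤s lX′)) (≤-trans (≤-reflexive (+-suc κ b)) κ+b≤B))
              len′ = trans (length-++ l) (trans (+-comm _ 1) (trans (cong suc ll) κ≡))
          in l ++ q ∷ []
           , (len′ , Walk-++ (l ++ q ∷ []) w (subst (λ v → Walk _~_ v (h ∷ [])) (sym (end-∷ʳ (x i) l {q})) (~-sym {h} {q} h~q ∷ []))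
               , Unique-++ l! ([] ∷ []) (λ { v∈ (here refl) → dis v∈ (here refl) }))
           , ≤-reflexive len′
           , Disjoint-++ˡ (λ v∈ m → dis v∈ (there m)) (λ { (here refl) m → q∉ m }))
        where
        κ≡ : suc (2 * e + suc (length D′)) ≡ κ
        κ≡ = trans (cong (_+ suc (length D′)) (sym odd)) (m∸n+n≡m short)
        2e≤κ : 2 * e ≤ κ
        2e≤κ = ≤-trans (≤-trans (m≤m+n _ _) (n≤1+n _)) (≤-reflexive κ≡)

    b₀≤B : b₀ ≤ B
    b₀≤B = ≤-trans (≤-trans (m≤m+n b₀ _) (m≤n+m _ (K * b * Θ + b))) B≥

    Dense : PSet → Set
    Dense R = ∀ σ → σ ∈ᶠ f → d ^ gap full R ≤ Γ * fib f R σ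

    -- The fixed set has to be connected to `α` and must leave `β` free. Here `y` is the only
    -- interior position; in `link-long` the set `D′` suffices and `y` is free as well, so that the
    -- images of `y` can act as hubs.
    link-short : D′ ≡ [] → Flex f ⟦ y ∷ [] ⟧ B → Dense ⟦ α ∷ y ∷ [] ⟧ → (∃[ σ ] σ ∈ᶠ f) → ContainsSubdivKst G s t (suc κ)
    link-short eq flx dns (σ₀ , σ₀∈) = spiders (hubs-short eq σ₀ σ₀∈
      (spread ⟦ y ∷ [] ⟧ ⟦ α ∷ y ∷ [] ⟧ α y (β ∷ []) B
        (λ p h → add-⊇ ⟦ y ∷ [] ⟧ α h) (λ p h → add⁻ ⟦ y ∷ [] ⟧ α h) (add-∋ ⟦ y ∷ [] ⟧ α)
        (∉⟦⟧ (y ∷ []) (λ { (here refl) → α∉D (here refl) })) (∈⟦⟧ (y ∷ []) (here refl))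
        (Adj-sym (walk-head walkT) ∷ []) ([] ∷ [])
        (λ { q (here refl) → ∉⟦⟧ (α ∷ y ∷ []) (λ { (here e) → β∉ (∈-++⁺ʳ D (here refl)) e
                                                ; (there (here e)) → β∉ (here refl) e }) })
        (s≤s z≤n) flx b₀≤B dns σ₀ σ₀∈))

    link-long : ∀ {x D″} → D′ ≡ x ∷ D″ → Flex f ⟦ D′ ⟧ B → Dense ⟦ α ∷ D′ ⟧ → (∃[ σ ] σ ∈ᶠ f) → ContainsSubdivKst G s t (suc κ)
    link-long {x} refl flx dns (σ₀ , σ₀∈) = spiders (hubs-long refl σ₀ σ₀∈
      (spread ⟦ D′ ⟧ ⟦ α ∷ D′ ⟧ α x (y ∷ β ∷ []) B
        (λ p h → add-⊇ ⟦ D′ ⟧ α h) (λ p h → add⁻ ⟦ D′ ⟧ α h) (add-∋ ⟦ D′ ⟧ α)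
        (∉⟦⟧ D′ α∉D′) (∈⟦⟧ D′ (here refl))
        (Adj-sym (walk-head (walk-tail walkT)) ∷ Adj-sym (walk-head walkT) ∷ [])
        (((λ { refl → β∉ (here refl) refl }) ∷ []) ∷ [] ∷ [])
        (λ { q (here refl) → ∉⟦⟧ (α ∷ D′) (λ { (here e) → y∉ (∈-++⁺ʳ D′ (here refl)) e
                                              ; (there m) → y∉ (∈-++⁺ˡ m) refl })
           ; q (there (here refl)) → ∉⟦⟧ (α ∷ D′) (λ { (here e) → β∉ (∈-++⁺ʳ D (here refl)) e
                                              ; (there m) → β∉ (there (∈-++⁺ˡ m)) refl }) })
        (s≤s (s≤s z≤n)) flx b₀≤B dns σ₀ σ₀∈))

parityOf : ∀ m → ∃[ e ] ∃[ o ] m ≡ 𝟙 o + 2 * e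
parityOf m with halve m
... | e , inj₁ refl = e , false , refl
... | e , inj₂ refl = e , true , refl

end-self : ∀ {A : Set} (x : A) xs → end x xs ≡ x → x ∉ xs → xs ≡ []
end-self x [] _ _ = refl
end-self x (y ∷ xs) e x∉ = ⊥-elim (x∉ (subst (_∈ y ∷ xs) e (end-∈ y xs)))

-- Spiders whose centre lies outside W

module Legs (T : RootedTree) (Ω : Host) (U : Sample T Ω)
  {s : ℕ} (pre : Fin s → List (RootedTree.P T)) (z : Fin s → RootedTree.P T)
  (walkT : ∀ i → Walk (Tree.Adj T Ω) (RootedTree.root T) (pre i ++ z i ∷ []))
  (uniqT : ∀ i → Unique (RootedTree.root T ∷ pre i ++ z i ∷ []))
  (apartT : ∀ i j → i ≢ j → Disjoint (pre i ++ z i ∷ []) (pre j ++ z j ∷ []))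
  where

  open Tree T Ω
  open Families T Ω U

  opt : Bool → P → List P
  opt q p = if q then p ∷ [] else []

  -- The subtrees kept by the second kind of move: the centre, each leg before its first position
  -- `z i` in W, and those `z i` that `Q` selects. Position `z i` is free exactly when `Q i` is
  -- false.
  region : (Fin s → Bool) → List P
  region Q = root ∷ concat (tabulate (λ i → pre i ++ opt (Q i) (z i)))

  pre∈region : ∀ Q i {p} → p ∈ pre i → p ∈ region Q
  pre∈region Q i p∈ = there (∈-concat-tabulate (λ i → pre i ++ opt (Q i) (z i)) i (∈-++⁺ˡ p∈))

  z∈region : ∀ Q i → Q i ≡ true → z i ∈ region Q
  z∈region Q i q = there (∈-concat-tabulate (λ i → pre i ++ opt (Q i) (z i)) i
    (∈-++⁺ʳ (pre i) (subst (λ b → z i ∈ opt b (z i)) (sym q) (here refl))))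

  region⁻ : ∀ Q {p} → p ∈ region Q → p ≡ root ⊎ ∃[ i ] (p ∈ pre i ⊎ (Q i ≡ true × p ≡ z i))
  region⁻ Q (here e) = inj₁ e
  region⁻ Q {p} (there p∈) with ∈-concat-tabulate⁻ (λ i → pre i ++ opt (Q i) (z i)) p∈
  ... | i , m with ∈-++⁻ (pre i) m
  ... | inj₁ m₁ = inj₂ (i , inj₁ m₁)
  ... | inj₂ m₂ = inj₂ (i , inj₂ (go (Q i) m₂))
    where
    go : ∀ b → p ∈ opt b (z i) → b ≡ true × p ≡ z i
    go true (here e) = refl , e

  root∉ : ∀ i → root ∉ pre i ++ z i ∷ []
  root∉ i m = All.lookup (AllPairs.head (uniqT i)) m refl

  z∉pre : ∀ i j → z i ∉ pre j
  z∉pre i j m with i ≟F j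
  ... | no ne = apartT i j ne (∈-++⁺ʳ (pre i) (here refl)) (∈-++⁺ˡ m)
  ... | yes refl = last∉ (pre i) (AllPairs.tail (uniqT i)) m

  z-injective : ∀ {i j} → z i ≡ z j → i ≡ j
  z-injective {i} {j} e with i ≟F j
  ... | yes eq = eq
  ... | no ne = ⊥-elim (apartT i j ne (∈-++⁺ʳ (pre i) (here refl)) (subst (_∈ pre j ++ z j ∷ []) (sym e) (∈-++⁺ʳ (pre j) (here refl))))

  pre! : ∀ i → Unique (pre i)
  pre! i = Unique-prefix (pre i) (AllPairs.tail (uniqT i))

  z∉region : ∀ Q i → Q i ≡ false → z i ∉ region Q
  z∉region Q i q m with region⁻ Q m
  ... | inj₁ e = root∉ i (subst (_∈ pre i ++ z i ∷ []) e (∈-++⁺ʳ (pre i) (here refl)))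
  ... | inj₂ (j , inj₁ m₁) = z∉pre i j m₁
  ... | inj₂ (j , inj₂ (q′ , e)) with z-injective e
  ... | refl = true≢false q′ q

  region-conn : ∀ Q → Conn (sing root) ⟦ region Q ⟧
  region-conn Q S′ sub cl p h with region⁻ Q (⟦⟧∈ (region Q) h)
  ... | inj₁ refl = sub root (true-does (root ≟ root) refl)
  ... | inj₂ (i , inj₁ m) = closed-walk {S′} {⟦ region Q ⟧} cl (sub root (true-does (root ≟ root) refl))
          (Walk-++⁻ˡ (pre i) (walkT i)) (λ q∈ → ∈⟦⟧ (region Q) (pre∈region Q i q∈)) m
  ... | inj₂ (i , inj₂ (q , refl)) = closed-walk {S′} {⟦ region Q ⟧} cl (sub root (true-does (root ≟ root) refl))
          (walkT i) inR (∈-++⁺ʳ (pre i) (here refl))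
    where
    inR : ∀ {x} → x ∈ pre i ++ z i ∷ [] → ⟦ region Q ⟧ x ≡ true
    inR x∈ with ∈-++⁻ (pre i) x∈
    ... | inj₁ m = ∈⟦⟧ (region Q) (pre∈region Q i m)
    ... | inj₂ (here refl) = ∈⟦⟧ (region Q) (z∈region Q i q)

module SpiderCase (T : RootedTree) (Ω : Host) (U : Sample T Ω)
  {s : ℕ} (pre : Fin s → List (RootedTree.P T)) (z : Fin s → RootedTree.P T)
  (walkT : ∀ i → Walk (Tree.Adj T Ω) (RootedTree.root T) (pre i ++ z i ∷ []))
  (uniqT : ∀ i → Unique (RootedTree.root T ∷ pre i ++ z i ∷ []))
  (apartT : ∀ i j → i ≢ j → Disjoint (pre i ++ z i ∷ []) (pre j ++ z j ∷ []))
  where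

  open Tree T Ω
  open Families T Ω U
  open Legs T Ω U pre z walkT uniqT apartT

  module Build (f : Emb → Bool) (t κ B : ℕ) (B≥ : s * κ + (s + Assembly.bound G s t κ) ≤ B)
    (half : Fin s → ℕ) (odd : Fin s → Bool)
    (lengths : ∀ i → length (pre i) + (𝟙 (odd i) + 2 * half i) ≡ κ)
    (no-clash : ∀ i j → i ≢ j → pre i ≡ [] → odd i ≡ true → pre j ≡ [] → odd j ≡ true → ⊥)
    (W : PSet) (Wroot : W root ≡ false) (Wpre : ∀ i p → p ∈ pre i → W p ≡ false) (Wz : ∀ i → W (z i) ≡ true)
    (flexW : Flex f W B)
    (flexR : ∀ i → Flex f ⟦ region (λ j → not (does (j ≟F i))) ⟧ B)
    (flexE : Flex f ⟦ region (not ∘ odd) ⟧ B)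
    where

    open Moves T Ω U f
    open Assembly G s t κ

    u : Fin s → P
    u i = end root (pre i)

    u~z : ∀ i → Adj (u i) (z i)
    u~z i = walk-head (Walk-++⁻ʳ (pre i) (walkT i))

    u-cases : ∀ i → u i ≡ root ⊎ u i ∈ pre i
    u-cases i with end-∈ root (pre i)
    ... | here e = inj₁ e
    ... | there m = inj₂ m

    Wu : ∀ i → W (u i) ≡ false
    Wu i with u-cases i
    ... | inj₁ e = trans (cong W e) Wroot
    ... | inj₂ m = Wpre i (u i) m

    u∈region : ∀ Q i → u i ∈ region Q
    u∈region Q i with u-cases i
    ... | inj₁ e = here e
    ... | inj₂ m = pre∈region Q i m

    2half≤κ : ∀ i → 2 * half i ≤ κ
    2half≤κ i = ≤-trans (m≤n+m _ (𝟙 (odd i))) (≤-trans (m≤n+m _ (length (pre i))) (≤-reflexive (lengths i)))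

    put : Fin s → List V → (Fin s → List V) → Fin s → List V
    put i l₀ l j = if does (j ≟F i) then l₀ else l j

    record Lengthened (is : List (Fin s)) (σ : Emb) (X : List V) : Set where
      field
        τ      : Emb
        τ∈     : τ ∈ᶠ f
        ext    : Fin s → List V
        walk   : ∀ j → Walk _~_ (σ (z j)) (ext j)
        ends   : ∀ j → end (σ (z j)) (ext j) ≡ τ (z j)
        ext!   : ∀ j → Unique (ext j)
        extX   : ∀ j → Disjoint (ext j) X
        done   : ∀ j → j ∈ is → length (ext j) ≡ 2 * half j
        idle   : ∀ j → j ∉ is → ext j ≡ []
        apart  : ∀ i j → i ≢ j → Disjoint (ext i) (ext j)

    -- The legs are lengthened one at a time. The zigzag on leg `i` keeps all `z j` with `j ≢ i`,
    -- since these lie both in `W` and in the region used for `i`; so the ends reached on other legs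
    -- are not disturbed.
    lengthen : ∀ is → Unique is → ∀ σ X → σ ∈ᶠ f → length is * κ + length X ≤ B → Lengthened is σ X
    lengthen [] _ σ X σ∈ _ = record
      { τ = σ ; τ∈ = σ∈ ; ext = λ _ → [] ; walk = λ _ → [] ; ends = λ _ → refl ; ext! = λ _ → [] ; extX = λ _ ()
      ; done = λ _ () ; idle = λ _ _ → refl ; apart = λ _ _ _ () }
    lengthen (i ∷ is) (i∉ ∷ is!) σ X σ∈ bd
      with zigzag {W} {⟦ region (λ j → not (does (j ≟F i))) ⟧} B flexW (flexR i) (Adj-sym (u~z i)) (Wz i) (Wu i)
             (∈⟦⟧ (region _) (u∈region _ i)) (∉⟦⟧ (region _) (z∉region _ i (cong not (true-does (i ≟F i) refl))))
             (half i) σ X σ∈ (≤-trans (+-monoˡ-≤ (length X) (≤-trans (2half≤κ i) (m≤m+n κ _))) bd)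
    ... | σ₁ , l₀ , σ₁∈ , ag , len₀ , w₀ , en₀ , l₀! , dis₀
      with lengthen is is! σ₁ (l₀ ++ X) σ₁∈ (≤-trans (≤-reflexive (cong (length is * κ +_) (trans (length-++ l₀) (cong (_+ length X) len₀))))
             (≤-trans (+-monoʳ-≤ (length is * κ) (+-monoˡ-≤ (length X) (2half≤κ i)))
               (≤-trans (≤-reflexive (lem (length is * κ) κ (length X))) bd)))
      where
      lem : ∀ a k x → a + (k + x) ≡ k + a + x
      lem = solve-∀
    ... | rec = record
      { τ = τ ; τ∈ = τ∈ ; ext = put i l₀ ext
      ; walk = λ j → by j (λ l → Walk _~_ (σ (z j)) l) (λ { refl → w₀ }) (λ ne → subst (λ v → Walk _~_ v (ext j)) (sym (keep j ne)) (walk j))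
      ; ends = λ j → by j (λ l → end (σ (z j)) l ≡ τ (z j))
          (λ { refl → trans en₀ (trans (sym (cong (end (σ₁ (z i))) ei)) (ends i)) })
          (λ ne → trans (cong (λ v → end v (ext j)) (keep j ne)) (ends j))
      ; ext! = λ j → by j Unique (λ _ → l₀!) (λ _ → ext! j)
      ; extX = λ j → by j (λ l → Disjoint l X) (λ _ → dis₀) (λ _ v∈ v∈X → extX j v∈ (∈-++⁺ʳ l₀ v∈X))
      ; done = λ j j∈ → by j (λ l → length l ≡ 2 * half j) (λ { refl → len₀ })
          (λ ne → done j (case j∈ of λ { (here e) → ⊥-elim (ne e) ; (there m) → m }))
      ; idle = λ j j∉ → by j (_≡ []) (λ { refl → ⊥-elim (j∉ (here refl)) }) (λ ne → idle j (λ m → j∉ (there m)))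
      ; apart = λ j k ne → by j (λ l → Disjoint l (put i l₀ ext k))
          (λ { refl → by k (Disjoint l₀) (λ { refl → ⊥-elim (ne refl) }) (λ _ v∈ m → extX k m (∈-++⁺ˡ v∈)) })
          (λ _ → by k (Disjoint (ext j)) (λ _ v∈ m → extX j v∈ (∈-++⁺ˡ m)) (λ _ → apart j k ne))
      }
      where
      open Lengthened rec
      ei : ext i ≡ []
      ei = idle i (λ m → All.lookup i∉ m refl)
      keep : ∀ j → j ≢ i → σ (z j) ≡ σ₁ (z j)
      keep j ne = ag (z j) (Wz j) (∈⟦⟧ (region _) (z∈region _ j (cong not (false-does (j ≟F i) ne))))
      by : ∀ j (Q : List V → Set) → (j ≡ i → Q l₀) → (j ≢ i → Q (ext j)) → Q (put i l₀ ext j)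
      by j Q a c with j ≟F i
      ... | yes e = a e
      ... | no ne = c ne

    -- The position whose image under the initial embedding is the prescribed end of leg `i`. Two of
    -- them can coincide only if both are the centre, which `no-clash` excludes.
    start : Fin s → P
    start i = if odd i then u i else z i

    start-injective : ∀ i j → start i ≡ start j → i ≡ j
    start-injective i j e with i ≟F j
    ... | yes eq = eq
    ... | no ne = ⊥-elim (go (odd i) (odd j) refl refl e)
      where
      u≢z : ∀ i j → i ≢ j → u i ≢ z j
      u≢z i j ne e with u-cases i
      ... | inj₁ r = root∉ j (subst (_∈ pre j ++ z j ∷ []) (trans (sym e) r) (∈-++⁺ʳ (pre j) (here refl)))
      ... | inj₂ m = z∉pre j i (subst (_∈ pre i) e m)
      go : ∀ a c → odd i ≡ a → odd j ≡ c → (if a then u i else z i) ≡ (if c then u j else z j) → ⊥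
      go false false _ _ e = ne (z-injective e)
      go true false _ _ e = u≢z i j ne e
      go false true _ _ e = u≢z j i (ne ∘ sym) (sym e)
      go true true oi oj e with u-cases i | u-cases j
      ... | inj₁ r | inj₁ r′ = no-clash i j ne (end-self root (pre i) r (λ m → root∉ i (∈-++⁺ˡ m))) oi
                                 (end-self root (pre j) r′ (λ m → root∉ j (∈-++⁺ˡ m))) oj
      ... | inj₁ r | inj₂ m = root∉ j (∈-++⁺ˡ (subst (_∈ pre j) (trans (sym e) r) m))
      ... | inj₂ m | inj₁ r = root∉ i (∈-++⁺ˡ (subst (_∈ pre i) (trans e r) m))
      ... | inj₂ m | inj₂ m′ = apartT i j ne (∈-++⁺ˡ m) (subst (_∈ pre j ++ z j ∷ []) (sym e) (∈-++⁺ˡ m′))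

    -- A leg is composed of `T₁ i`, one edge to a fresh image of `z i` if the parity requires it,
    -- the zigzag `ext i`, and the tree path back to the centre. A final move over `W` takes the
    -- tree paths and the centre off all that has been used.
    spider-case : (∃[ σ ] σ ∈ᶠ f) → ContainsSubdivKst G s t (suc κ)
    spider-case (σ₀ , σ₀∈) = assemble x (λ i j e → start-injective i j (inj σ₀∈ _ _ e)) spider
      where
      x : Fin s → V
      x i = σ₀ (start i)
      spider : ∀ X → (∀ i → x i ∈ X) → length X ≤ bound → LeggedSpider x X
      -- This move keeps the ends of all legs, namely `u i` for odd and `z i` for even ones, and
      -- takes `z i` off `X` on the odd legs.
      spider X x∈ lX with flexE σ₀ σ₀∈ X (≤-trans lX (≤-trans (m≤n+m bound s) (≤-trans (m≤n+m _ (s * κ)) B≥)))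
      ... | σ₁ , σ₁∈ , ag₁ , fr₁ = stretched (lengthen (allFin s) (allFin⁺ s) σ₁ (zs ++ X) σ₁∈
          (≤-trans (+-mono-≤ (≤-reflexive (cong (_* κ) (length-tabulate {n = s} (λ i → i)))) lzs) B≥))
        where
        zs : List V
        zs = tabulate (σ₁ ∘ z)
        lzs : length (zs ++ X) ≤ s + bound
        lzs = ≤-trans (≤-reflexive (trans (length-++ zs) (cong (_+ length X) (length-tabulate (σ₁ ∘ z))))) (+-monoʳ-≤ s lX)
        T₁ : Fin s → List V
        T₁ i = if odd i then σ₁ (z i) ∷ [] else []
        T₁-walk : ∀ i → Walk _~_ (x i) (T₁ i)
        T₁-walk i with odd i
        ... | true = subst (_~ σ₁ (z i)) (sym (ag₁ (u i) (∈⟦⟧ (region (not ∘ odd)) (u∈region (not ∘ odd) i)))) (hom-adj (hom σ₁∈) (u~z i)) ∷ []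
        ... | false = []
        T₁-end : ∀ i → end (x i) (T₁ i) ≡ σ₁ (z i)
        T₁-end i = go (odd i) refl
          where
          go : ∀ o → odd i ≡ o → end (σ₀ (if o then u i else z i)) (if o then σ₁ (z i) ∷ [] else []) ≡ σ₁ (z i)
          go true _ = refl
          go false e = ag₁ (z i) (∈⟦⟧ (region (not ∘ odd)) (z∈region (not ∘ odd) i (cong not e)))
        T₁⊆ : ∀ i {v} → v ∈ T₁ i → v ≡ σ₁ (z i) × odd i ≡ true
        T₁⊆ i v∈ with odd i
        T₁⊆ i (here e) | true = e , refl
        T₁zs : ∀ i {v} → v ∈ T₁ i → v ∈ zs ++ X
        T₁zs i v∈ with T₁⊆ i v∈
        ... | refl , _ = ∈-++⁺ˡ (∈-tabulate⁺ i)
        T₁X : ∀ i → Disjoint (T₁ i) X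
        T₁X i v∈ with T₁⊆ i v∈
        ... | refl , o = fr₁ (z i) (∉⟦⟧ (region (not ∘ odd)) (z∉region (not ∘ odd) i (cong not o)))
        T₁! : ∀ i → Unique (T₁ i)
        T₁! i with odd i
        ... | true = [] ∷ []
        ... | false = []
        T₁-apart : ∀ i j → i ≢ j → Disjoint (T₁ i) (T₁ j)
        T₁-apart i j ne v∈ w∈ with T₁⊆ i v∈ | T₁⊆ j w∈
        ... | refl , _ | e , _ = ne (z-injective (inj σ₁∈ _ _ e))
        T₁-len : ∀ i → length (T₁ i) ≡ 𝟙 (odd i)
        T₁-len i with odd i
        ... | true = refl
        ... | false = refl
        stretched : Lengthened (allFin s) σ₁ (zs ++ X) → LeggedSpider x X
        stretched L = recentred (flexW τ τ∈ (exts ++ (zs ++ X)) (≤-trans (≤-reflexive (length-++ exts)) (≤-trans (+-mono-≤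
            (exts-len ext (λ i → ≤-trans (≤-reflexive (ext-len i)) (2half≤κ i))) lzs) B≥)))
          where
          open Lengthened L
          ext-len : ∀ i → length (ext i) ≡ 2 * half i
          ext-len i = done i (∈-allFin i)
          exts : List V
          exts = concat (tabulate ext)
          exts-len : ∀ {r} (g : Fin r → List V) → (∀ i → length (g i) ≤ κ) → length (concat (tabulate g)) ≤ r * κ
          exts-len {zero} g h = z≤n
          exts-len {suc r} g h = ≤-trans (≤-reflexive (length-++ (g Fin.zero))) (+-mono-≤ (h Fin.zero) (exts-len (g ∘ Fin.suc) (h ∘ Fin.suc)))
          recentred : ∃[ υ ] υ ∈ᶠ f × Agree W τ υ × (∀ p → W p ≡ false → υ p ∉ exts ++ (zs ++ X)) → LeggedSpider x X
          recentred (υ , υ∈ , ag₃ , fr₃) = record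
              { centre = υ root ; leg = leg ; len = leg-len ; walk = leg-walk
              ; leg! = λ i → Unique-++ (T₁! i) (Unique-++ (ext! i) (seg! i) (λ a c → seg-new i c (ext∈ i a)))
                  (λ a m → case ∈-++⁻ (ext i) m of λ
                    { (inj₁ c) → extX i c (T₁zs i a) ; (inj₂ c) → seg-new i c (∈-++⁺ʳ exts (T₁zs i a)) })
              ; apart = leg-apart ; centre∉ = centre∉ ; legX = legX
              ; centreX = λ m → centre-new (∈-++⁺ʳ exts (∈-++⁺ʳ zs m)) }
            where
            seg : Fin s → List V
            seg i = map υ (reverse (pre i))
            seg⁻ : ∀ i {v} → v ∈ seg i → ∃[ p ] p ∈ pre i × v ≡ υ p
            seg⁻ i v∈ with ∈-map⁻ υ v∈
            ... | p , p∈ , e = p , ∈-reverse⁻ (pre i) p∈ , e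
            seg-new : ∀ i → Disjoint (seg i) (exts ++ (zs ++ X))
            seg-new i v∈ with seg⁻ i v∈
            ... | p , p∈ , refl = fr₃ p (Wpre i p p∈)
            seg-walk : ∀ i → Walk _~_ (τ (z i)) (seg i ++ υ root ∷ [])
            seg-walk i = subst₂ (Walk _~_) (sym (ag₃ (z i) (Wz i))) (map-++ υ (reverse (pre i)) (root ∷ []))
              (Walk-map υ (hom-adj (hom υ∈)) (Walk-reverse Adj-sym (pre i) (walkT i)))
            leg : Fin s → List V
            leg i = T₁ i ++ (ext i ++ seg i)
            leg⁻ : ∀ i {v} → v ∈ leg i → v ∈ T₁ i ⊎ v ∈ ext i ⊎ v ∈ seg i
            leg⁻ i v∈ with ∈-++⁻ (T₁ i) v∈
            ... | inj₁ m = inj₁ m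
            ... | inj₂ m = inj₂ (∈-++⁻ (ext i) m)
            ext∈ : ∀ i {v} → v ∈ ext i → v ∈ exts ++ (zs ++ X)
            ext∈ i m = ∈-++⁺ˡ (∈-concat-tabulate ext i m)
            seg! : ∀ i → Unique (seg i)
            seg! i = Unique-map υ (inj υ∈ _ _) (Unique-reverse (pre i) (pre! i))
            leg-apart : ∀ i j → i ≢ j → Disjoint (leg i) (leg j)
            leg-apart i j ne v∈ w∈ with leg⁻ i v∈ | leg⁻ j w∈
            ... | inj₁ a | inj₁ c = T₁-apart i j ne a c
            ... | inj₁ a | inj₂ (inj₁ c) = extX j c (T₁zs i a)
            ... | inj₁ a | inj₂ (inj₂ c) = seg-new j c (∈-++⁺ʳ exts (T₁zs i a))
            ... | inj₂ (inj₁ a) | inj₁ c = extX i a (T₁zs j c)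
            ... | inj₂ (inj₁ a) | inj₂ (inj₁ c) = apart i j ne a c
            ... | inj₂ (inj₁ a) | inj₂ (inj₂ c) = seg-new j c (ext∈ i a)
            ... | inj₂ (inj₂ a) | inj₁ c = seg-new i a (∈-++⁺ʳ exts (T₁zs j c))
            ... | inj₂ (inj₂ a) | inj₂ (inj₁ c) = seg-new i a (ext∈ j c)
            ... | inj₂ (inj₂ a) | inj₂ (inj₂ c) with seg⁻ i a | seg⁻ j c
            ... | p , p∈ , refl | q , q∈ , e = apartT i j ne (∈-++⁺ˡ p∈) (∈-++⁺ˡ (subst (_∈ pre j) (sym (inj υ∈ _ _ e)) q∈))
            centre-new : υ root ∉ exts ++ (zs ++ X)
            centre-new = fr₃ root Wroot
            legX : ∀ i → Disjoint (leg i) X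
            legX i v∈ m with leg⁻ i v∈
            ... | inj₁ a = T₁X i a m
            ... | inj₂ (inj₁ a) = extX i a (∈-++⁺ʳ zs m)
            ... | inj₂ (inj₂ a) = seg-new i a (∈-++⁺ʳ exts (∈-++⁺ʳ zs m))
            centre∉ : ∀ i → υ root ∉ leg i
            centre∉ i v∈ with leg⁻ i v∈
            ... | inj₁ a = centre-new (∈-++⁺ʳ exts (T₁zs i a))
            ... | inj₂ (inj₁ a) = centre-new (ext∈ i a)
            ... | inj₂ (inj₂ a) with seg⁻ i a
            ... | p , p∈ , e = root∉ i (∈-++⁺ˡ (subst (_∈ pre i) (sym (inj υ∈ _ _ e)) p∈))
            leg-walk : ∀ i → Walk _~_ (x i) (leg i ++ υ root ∷ [])
            leg-walk i = subst (Walk _~_ (x i)) (sym (trans (++-assoc (T₁ i) (ext i ++ seg i) (υ root ∷ []))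
                (cong (T₁ i ++_) (++-assoc (ext i) (seg i) (υ root ∷ [])))))
              (Walk-++ (T₁ i) (T₁-walk i) (subst (λ v → Walk _~_ v (ext i ++ (seg i ++ υ root ∷ []))) (sym (T₁-end i))
                (Walk-++ (ext i) (walk i) (subst (λ v → Walk _~_ v (seg i ++ υ root ∷ [])) (sym (ends i)) (seg-walk i)))))
            leg-len : ∀ i → length (leg i) ≡ κ
            leg-len i = trans (length-++ (T₁ i)) (trans (cong₂ _+_ (T₁-len i) (trans (length-++ (ext i))
                (cong₂ _+_ (ext-len i) (trans (length-map′ υ (reverse (pre i))) (length-reverse (pre i))))))
              (trans (lem (𝟙 (odd i)) (2 * half i) (length (pre i))) (lengths i)))
              where
              lem : ∀ a c p → a + (c + p) ≡ p + (a + c)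
              lem = solve-∀

-- The spider as a rooted tree, and runs of a path outside a set

data SpiderPos (s k : ℕ) : Set where
  ctr : SpiderPos s k
  lg  : Fin s → Fin k → SpiderPos s k

lg-injective : ∀ {s k} {i i′ : Fin s} {l l′ : Fin k} → lg i l ≡ lg i′ l′ → i ≡ i′ × l ≡ l′
lg-injective refl = refl , refl

parent : ∀ {s k} → SpiderPos s k → SpiderPos s k
parent ctr = ctr
parent (lg i zero) = ctr
parent (lg i (suc l)) = lg i (inject₁ l)

spiderTree : ℕ → ℕ → RootedTree
spiderTree s k = record
  { P = SpiderPos s k ; _≟_ = _≟S_ ; all = ctr ∷ map pos pairs ; all∈ = all∈
  ; all! = All.tabulate (λ m → λ { refl → case-∉ m }) ∷ Unique-map pos pos-inj (cartesianProduct⁺ (allFin⁺ s) (allFin⁺ k))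
  ; root = ctr ; par = parent ; conn = conn }
  where
  pairs = cartesianProduct (allFin s) (allFin k)
  pos : Fin s × Fin k → SpiderPos s k
  pos (i , l) = lg i l
  pos-inj : ∀ {x y} → pos x ≡ pos y → x ≡ y
  pos-inj refl = refl
  case-∉ : ctr ∉ map pos pairs
  case-∉ m with ∈-map⁻ pos m
  ... | _ , _ , ()
  _≟S_ : DecidableEquality (SpiderPos s k)
  ctr ≟S ctr = yes refl
  ctr ≟S lg _ _ = no λ ()
  lg _ _ ≟S ctr = no λ ()
  lg i l ≟S lg i′ l′ with i ≟F i′ | l ≟F l′
  ... | yes refl | yes refl = yes refl
  ... | no ne | _ = no (ne ∘ proj₁ ∘ lg-injective)
  ... | _ | no ne = no (ne ∘ proj₂ ∘ lg-injective)
  all∈ : ∀ p → p ∈ ctr ∷ map pos pairs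
  all∈ ctr = here refl
  all∈ (lg i l) = there (∈-map⁺ pos (∈-cartesianProduct⁺ (∈-allFin i) (∈-allFin l)))
  conn : ∀ (S : SpiderPos s k → Bool) p₀ → S p₀ ≡ true →
         (∀ p → p ≢ ctr → S p ≡ true → S (parent p) ≡ true) →
         (∀ p → p ≢ ctr → S (parent p) ≡ true → S p ≡ true) → ∀ p → S p ≡ true
  conn S p₀ h ups downs = reach
    where
    climb : ∀ m i l → toℕ l ≡ m → S (lg i l) ≡ true → S ctr ≡ true
    climb m i zero _ h = ups (lg i zero) (λ ()) h
    climb (suc m) i (suc l) e h = climb m i (inject₁ l) (trans (toℕ-inject₁ l) (suc-injective e)) (ups (lg i (suc l)) (λ ()) h)
    centre : S ctr ≡ true
    centre = from p₀ h
      where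
      from : ∀ p → S p ≡ true → S ctr ≡ true
      from ctr h = h
      from (lg i l) h = climb (toℕ l) i l refl h
    fall : ∀ m i l → toℕ l ≡ m → S (lg i l) ≡ true
    fall m i zero _ = downs (lg i zero) (λ ()) centre
    fall (suc m) i (suc l) e = downs (lg i (suc l)) (λ ()) (fall m i (inject₁ l) (trans (toℕ-inject₁ l) (suc-injective e)))
    reach : ∀ p → S p ≡ true
    reach ctr = centre
    reach (lg i l) = fall (toℕ l) i l refl

spiderTree-size : ∀ s k → length (RootedTree.all (spiderTree s k)) ≡ suc (s * k)
spiderTree-size s k = cong suc (trans (length-map′ _ (cartesianProduct (allFin s) (allFin k)))
  (trans (length-× (allFin s) (allFin k)) (cong₂ _*_ (length-tabulate {n = s} (λ i → i)) (length-tabulate {n = k} (λ i → i)))))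

walk-tabulate : ∀ {A : Set} {R : A → A → Set} m (g : Fin (suc m) → A) → (∀ l → R (g (inject₁ l)) (g (suc l))) →
                Walk R (g zero) (tabulate (g ∘ suc))
walk-tabulate zero g h = []
walk-tabulate (suc m) g h = h zero ∷ walk-tabulate m (g ∘ suc) (h ∘ suc)

module _ {A : Set} (W : A → Bool) where

  record FirstHit (xs : List A) : Set where
    field
      pre  : List A
      z    : A
      post : List A
      eq   : xs ≡ pre ++ z ∷ post
      out  : ∀ p → p ∈ pre → W p ≡ false
      hit  : W z ≡ true

  firstHit : ∀ xs {a} → a ∈ xs → W a ≡ true → FirstHit xs
  firstHit (x ∷ xs) a∈ h with W x in e
  ... | true = record { pre = [] ; z = x ; post = xs ; eq = refl ; out = λ _ () ; hit = e }
  firstHit (x ∷ xs) (here refl) h | false = ⊥-elim (true≢false h e)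
  firstHit (x ∷ xs) (there a∈) h | false = record
    { pre = x ∷ pre ; z = z ; post = post ; eq = cong (x ∷_) eq ; hit = hit
    ; out = λ { p (here refl) → e ; p (there m) → out p m } }
    where open FirstHit (firstHit xs a∈ h)

  module _ {R : A → A → Set} where

    record Interval (xs : List A) : Set where
      field
        β y α : A
        D     : List A
        walk  : Walk R β (y ∷ D ++ α ∷ [])
        uniq  : Unique (β ∷ y ∷ D ++ α ∷ [])
        Wα    : W α ≡ true
        Wβ    : W β ≡ true
        WD    : ∀ p → p ∈ y ∷ D → W p ≡ false
        short : suc (suc (length D)) ≤ length xs

    -- The start advances inside `W` until the next position lies outside; the first return to `W`
    -- closes the run. On a leg, `short` leaves at most κ interior positions, so that the run fits
    -- into a path of length κ + 1.
    interval : ∀ x xs {p} → W x ≡ true → W (end x xs) ≡ true → p ∈ xs → W p ≡ false →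
               Walk R x xs → Unique (x ∷ xs) → Interval xs
    interval x (x′ ∷ xs) {p} Wx We p∈ Wp (r ∷ w) (x∉ ∷ u) with W x′ in e
    ... | true = record { β = β ; y = y ; α = α ; D = D ; walk = walk ; uniq = uniq ; Wα = Wα ; Wβ = Wβ ; WD = WD
                        ; short = ≤-trans short (n≤1+n _) }
      where
      tail-∈ : p ∈ x′ ∷ xs → p ∈ xs
      tail-∈ (here refl) = ⊥-elim (true≢false e Wp)
      tail-∈ (there m) = m
      open Interval (interval x′ xs e We (tail-∈ p∈) Wp w u)
    ... | false = record
      { β = x ; y = x′ ; α = z ; D = pre
      ; walk = r ∷ Walk-++⁻ˡ (pre ++ z ∷ []) (subst (Walk R x′) eq′ w)
      ; uniq = Unique-prefix (x ∷ x′ ∷ pre ++ z ∷ []) (subst (λ l → Unique (x ∷ x′ ∷ l)) eq′ (x∉ ∷ u))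
      ; Wα = hit ; Wβ = Wx ; WD = λ { p (here refl) → e ; p (there m) → out p m }
      ; short = s≤s (≤-trans (s≤s (m≤m+n _ _)) (≤-reflexive (sym (trans (cong length eq) (trans (length-++ pre) (+-suc (length pre) (length post)))))))
      }
      where
      last∈ : end x′ xs ∈ xs
      last∈ with end-∈ x′ xs
      ... | here eq = ⊥-elim (true≢false (trans (cong W (sym eq)) We) e)
      ... | there m = m
      open FirstHit (firstHit xs last∈ We)
      eq′ : xs ≡ (pre ++ z ∷ []) ++ post
      eq′ = trans eq (sym (++-assoc pre (z ∷ []) post))

isLeaf : ∀ {s κ} → SpiderPos s (suc κ) → Bool
isLeaf ctr = false
isLeaf {κ = κ} (lg i l) = does (l ≟F fromℕ κ)

innerCount : ℕ → ℕ → ℕ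
innerCount s κ = # (λ p → not (isLeaf p)) (RootedTree.all (spiderTree s (suc κ)))

-- Subdivisions in dense, nearly regular graphs

module RegularGraph (s t κ : ℕ) (Ω : Host) (s≥1 : 1 ≤ s) (κ≥1 : 1 ≤ κ) (K>0 : 0 < Host.K Ω)
  (Γ₀ Γ₁ b₀ Θ b B : ℕ)
  (Γ₀≡ : Γ₀ ≡ suc (2 * ((3 + s) * (Host.K Ω ^ (s * suc κ) * (2 ^ (s * suc κ) * suc (2 * (innerCount s κ * 2 ^ suc (s * suc κ))))))))
  (Γ₁≡ : Γ₁ ≡ Γ₀ * Host.K Ω ^ suc (s * suc κ)) (b₀≡ : b₀ ≡ 2 * (Γ₁ * (s * Host.K Ω ^ 2))) (Θ≡ : Θ ≡ 2 * Γ₁ * 2 ^ b₀)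
  (b≥ : s * κ + suc (t * suc (s * κ) + s) ≤ b)
  (B≥ : Host.K Ω * b * Θ + b + (b₀ + suc (κ + b)) + (s * κ + (s + (t * suc (s * κ) + s))) ≤ B)
  (n>0 : 0 < Host.n Ω) (d≥2N : 2 * suc (s * suc κ) ≤ Host.d Ω)
  (d-large : Γ₀ * (suc (s * suc κ) * B * Host.K Ω ^ (s * suc κ)) < Host.d Ω)
  (d-large′ : Θ * (2 * b * Host.K Ω) < Host.d Ω)
  (dense : 2 ^ (s * suc κ) * (2 * (2 * thresholds (suc (s * suc κ)) B (innerCount s κ))) * Host.n Ω ^ (s ∸ 1)
           < Host.d Ω ^ (s * suc κ))
  where

  T : RootedTree
  T = spiderTree s (suc κ)

  open Tree T Ω
  open Embeddings T Ω using (edges; embeddings)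

  N≡ : N ≡ suc (s * suc κ)
  N≡ = spiderTree-size s (suc κ)

  module Core (U : Sample T Ω) (many : n * (d ∸ N) ^ edges ≤ length (Sample.𝒰 U)) where

    open Families T Ω U
    open Flexible T Ω U many isLeaf B (3 + s)
    open HeavyFibres T Ω U isLeaf lam ≤-refl hiding (_⊆ₛ_)

    edges≡ : edges ≡ s * suc κ
    edges≡ = suc-injective (trans (sym (gap-sing root)) N≡)

    Γ≡ : Γ ≡ Γ₀
    Γ≡ = trans Γ-def (trans (cong₂ (λ e m → suc (2 * ((3 + s) * (K ^ e * (2 ^ e * m))))) edges≡
      (trans M-def (cong (λ x → suc (2 * (innerCount s κ * x))) (trans (supersets-length all) (cong (2 ^_) N≡))))) (sym Γ₀≡))

    d-pos : 0 < d
    d-pos = ≤-trans (s≤s z≤n) d-large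

    d≥ : 2 * N ≤ d
    d≥ = ≤-trans (≤-reflexive (cong (2 *_) N≡)) d≥2N

    d> : Γ * (N * B * K ^ edges) < d
    d> = ≤-trans (≤-reflexive (cong suc (trans (cong₂ (λ g m → g * (m * B * K ^ edges)) Γ≡ N≡)
      (cong (λ e → Γ₀ * (suc (s * suc κ) * B * K ^ e)) edges≡)))) d-large

    flexible : (H : HeavyFamily) (ps : List Piece) → length ps ≤ 3 + s → FlexFamily (HeavyFamily.W H) ps
    flexible = flexFamily n>0 K>0 d≥ d>

    Γ>0 : 0 < Γ
    Γ>0 = ≤-trans (s≤s z≤n) (≤-reflexive (sym Γ-def))

    Γ₁≡′ : Γ₁ ≡ Γ * K ^ N
    Γ₁≡′ = trans Γ₁≡ (sym (cong₂ (λ g m → g * K ^ m) Γ≡ N≡))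

    B≥′ : K * b * Θ + b + (b₀ + suc (κ + b)) ≤ B
    B≥′ = ≤-trans (m≤m+n _ _) B≥

    -- Three pieces are cleaned: `Rα` for the zigzag at `α`, `R₀` for the rows of the bipartite
    -- pattern, and `R₁` for its density. The spider case needs `s + 1` pieces; `3 + s` covers both.
    link : (H : HeavyFamily) → (let W = HeavyFamily.W H) → ∀ β y α D′ →
           Walk Adj β (y ∷ D′ ++ α ∷ []) → Unique (β ∷ y ∷ D′ ++ α ∷ []) → W α ≡ true → W β ≡ true →
           (∀ p → p ∈ y ∷ D′ → W p ≡ false) → suc (length D′) ≤ κ → ContainsSubdivKst G s t (suc κ)
    link H β y α D′ walk uniq Wα Wβ WD short = go D′ refl
      where
      Rα : Piece
      Rα = record { R = ⟦ β ∷ y ∷ D′ ⟧ ; r = β ; r∈R = ∈⟦⟧ (β ∷ y ∷ D′) (here refl)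
        ; conR = Conn-walk (Walk-++⁻ˡ (y ∷ D′) walk) (λ m → ∈⟦⟧ (β ∷ y ∷ D′) (there m)) (⟦⟧∈ (β ∷ y ∷ D′)) }
      go : ∀ D → D ≡ D′ → ContainsSubdivKst G s t (suc κ)
      go [] refl = LinkCase.Link.link-short T Ω U f d-pos K>0 Γ Γ₁ Γ>0 Γ₁≡′ s b₀ s≥1 b₀≡ t κ Θ b B Θ≡ b≥ B≥′ d-large′
        (HeavyFamily.W H) α β y D′ walk uniq Wα Wβ WD short flexW (flexR Rα (here refl)) refl
        (flexR R₀ (there (here refl))) (denseR R₁ (there (there (here refl)))) member
        where
        R₀ R₁ : Piece
        R₀ = record { R = ⟦ y ∷ [] ⟧ ; r = y ; r∈R = ∈⟦⟧ (y ∷ []) (here refl)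
          ; conR = Conn-walk [] (λ ()) (⟦⟧∈ (y ∷ [])) }
        R₁ = record { R = ⟦ α ∷ y ∷ [] ⟧ ; r = y ; r∈R = ∈⟦⟧ (α ∷ y ∷ []) (there (here refl))
          ; conR = Conn-walk (walk-tail walk) (λ { (here refl) → ∈⟦⟧ (α ∷ y ∷ []) (here refl) })
              (λ h → case ⟦⟧∈ (α ∷ y ∷ []) h of λ { (here e) → there (here e) ; (there (here e)) → here e }) }
        open FlexFamily (flexible H (Rα ∷ R₀ ∷ R₁ ∷ []) (s≤s (s≤s (s≤s z≤n))))
      go (x ∷ D″) refl = LinkCase.Link.link-long T Ω U f d-pos K>0 Γ Γ₁ Γ>0 Γ₁≡′ s b₀ s≥1 b₀≡ t κ Θ b B Θ≡ b≥ B≥′ d-large′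
        (HeavyFamily.W H) α β y D′ walk uniq Wα Wβ WD short flexW (flexR Rα (here refl)) refl
        (flexR R₀ (there (here refl))) (denseR R₁ (there (there (here refl)))) member
        where
        R₀ R₁ : Piece
        R₀ = record { R = ⟦ x ∷ D″ ⟧ ; r = x ; r∈R = ∈⟦⟧ (x ∷ D″) (here refl)
          ; conR = Conn-walk (Walk-++⁻ˡ D″ (walk-tail (walk-tail walk))) (λ m → ∈⟦⟧ (x ∷ D″) (there m)) (⟦⟧∈ (x ∷ D″)) }
        R₁ = record { R = ⟦ α ∷ x ∷ D″ ⟧ ; r = x ; r∈R = ∈⟦⟧ (α ∷ x ∷ D″) (there (here refl))
          ; conR = Conn-walk (walk-tail (walk-tail walk))
              (λ m → ∈⟦⟧ (α ∷ x ∷ D″) (case ∈-++⁻ D″ m of λ { (inj₁ a) → there (there a) ; (inj₂ (here e)) → here e }))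
              (λ h → case ⟦⟧∈ (α ∷ x ∷ D″) h of λ
                { (here e) → there (∈-++⁺ʳ D″ (here e)) ; (there (here e)) → here e ; (there (there m)) → there (∈-++⁺ˡ m) }) }
        open FlexFamily (flexible H (Rα ∷ R₀ ∷ R₁ ∷ []) (s≤s (s≤s (s≤s z≤n))))

    leg : Fin s → List P
    leg i = tabulate (lg i)

    leg-length : ∀ i → length (leg i) ≡ suc κ
    leg-length i = length-tabulate (lg i)

    leg-walk : ∀ i → Walk Adj ctr (leg i)
    leg-walk i = walk-tabulate (suc κ) g step
      where
      g : Fin (suc (suc κ)) → P
      g Fin.zero = ctr
      g (Fin.suc l) = lg i l
      step : ∀ l → Adj (g (inject₁ l)) (g (Fin.suc l))
      step Fin.zero = down (lg i Fin.zero) (λ ())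
      step (Fin.suc l) = down (lg i (Fin.suc l)) (λ ())

    leg! : ∀ i → Unique (ctr ∷ leg i)
    leg! i = All.tabulate (λ m e → case ∈-tabulate⁻ {f = lg i} m of λ { (l , refl) → case e of λ () })
      ∷ tabulate⁺ {f = lg i} (λ e → proj₂ (lg-injective {i = i} {i′ = i} e))

    leg-apart : ∀ i j → i ≢ j → Disjoint (leg i) (leg j)
    leg-apart i j ne v∈ w∈ with ∈-tabulate⁻ {f = lg i} v∈ | ∈-tabulate⁻ {f = lg j} w∈
    ... | l , refl | l′ , e = ne (proj₁ (lg-injective e))

    leaf : Fin s → P
    leaf i = lg i (fromℕ κ)

    leaf-isLeaf : ∀ i → isLeaf (leaf i) ≡ true
    leaf-isLeaf i = true-does (fromℕ κ ≟F fromℕ κ) refl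

    leaf-end : ∀ i x → end x (leg i) ≡ leaf i
    leaf-end i x = go κ (lg i) x
      where
      go : ∀ {A : Set} m (g : Fin (suc m) → A) x → end x (tabulate g) ≡ g (fromℕ m)
      go zero g x = refl
      go (suc m) g x = go m (g ∘ Fin.suc) (g Fin.zero)

    module SpiderKernel (H : HeavyFamily) (Wctr : HeavyFamily.W H ctr ≡ false) where
      open HeavyFamily H
      split : ∀ i → FirstHit W (leg i)
      split i = firstHit W (leg i) (∈-tabulate⁺ {f = lg i} (fromℕ κ)) (L⊆W (leaf i) (leaf-isLeaf i))
      pre : Fin s → List P
      pre i = FirstHit.pre (split i)
      z : Fin s → P
      z i = FirstHit.z (split i)
      post : Fin s → List P
      post i = FirstHit.post (split i)
      leg≡ : ∀ i → leg i ≡ (pre i ++ z i ∷ []) ++ post i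
      leg≡ i = trans (FirstHit.eq (split i)) (sym (++-assoc (pre i) (z i ∷ []) (post i)))
      part : ∀ i {p} → p ∈ pre i ++ z i ∷ [] → p ∈ leg i
      part i {p} m = subst (p ∈_) (sym (leg≡ i)) (∈-++⁺ˡ m)
      walkT : ∀ i → Walk Adj root (pre i ++ z i ∷ [])
      walkT i = Walk-++⁻ˡ (pre i ++ z i ∷ []) (subst (Walk Adj root) (leg≡ i) (leg-walk i))
      uniqT : ∀ i → Unique (root ∷ pre i ++ z i ∷ [])
      uniqT i = Unique-prefix (root ∷ pre i ++ z i ∷ []) (subst (λ l → Unique (root ∷ l)) (leg≡ i) (leg! i))
      apartT : ∀ i j → i ≢ j → Disjoint (pre i ++ z i ∷ []) (pre j ++ z j ∷ [])
      apartT i j ne v∈ w∈ = leg-apart i j ne (part i v∈) (part j w∈)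
      open Legs T Ω U pre z walkT uniqT apartT
      half : Fin s → ℕ
      half i = proj₁ (parityOf (length (post i)))
      odd : Fin s → Bool
      odd i = proj₁ (proj₂ (parityOf (length (post i))))
      lengths : ∀ i → length (pre i) + (𝟙 (odd i) + 2 * half i) ≡ κ
      lengths i = suc-injective (trans (cong (λ x → suc (length (pre i) + x)) (sym (proj₂ (proj₂ (parityOf (length (post i)))))))
        (trans (sym (trans (length-++ (pre i)) (+-suc (length (pre i)) (length (post i)))))
          (trans (cong length (sym (FirstHit.eq (split i)))) (leg-length i))))
      piece : (Fin s → Bool) → Piece
      piece Q = record { R = ⟦ region Q ⟧ ; r = root ; r∈R = ∈⟦⟧ (region Q) (here refl) ; conR = region-conn Q }
      others : Fin s → Fin s → Bool
      others i j = not (does (j ≟F i))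
      pieces : List Piece
      pieces = piece (not ∘ odd) ∷ tabulate (λ i → piece (others i))
      isNil : List P → Bool
      isNil [] = true
      isNil (_ ∷ _) = false
      nil : ∀ ps → isNil ps ≡ true → ps ≡ []
      nil [] _ = refl
      clash : Fin s × Fin s → Bool
      clash (i , j) = others i j ∧ (isNil (pre i) ∧ isNil (pre j))
      result : ContainsSubdivKst G s t (suc κ)
      result with find clash (cartesianProduct (allFin s) (allFin s))
      -- Both `z i` and `z j` are adjacent to the centre, which is then the one interior position of
      -- a link.
      ... | inj₁ ((i , j) , _ , h) =
        let h₁ , h₂ = ∧-true {others i j} h
            h₃ , h₄ = ∧-true {isNil (pre i)} h₂
            ne : z j ≢ z i
            ne e = true≢false (true-does (j ≟F i) (z-injective e)) (not-true h₁)
            rootz : ∀ i → pre i ≡ [] → Adj root (z i)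
            rootz i e = walk-head (subst (λ l → Walk Adj root (l ++ z i ∷ [])) e (walkT i))
            root≢ : ∀ i → root ≢ z i
            root≢ i e = root∉ i (subst (_∈ pre i ++ z i ∷ []) (sym e) (∈-++⁺ʳ (pre i) (here refl)))
        in link H (z j) root (z i) [] (Adj-sym (rootz j (nil (pre j) h₄)) ∷ rootz i (nil (pre i) h₃) ∷ [])
             (((λ e → root≢ j (sym e)) ∷ ne ∷ []) ∷ (root≢ i ∷ []) ∷ [] ∷ [])
             (FirstHit.hit (split i)) (FirstHit.hit (split j)) (λ { p (here refl) → Wctr }) κ≥1
      ... | inj₂ none = SpiderCase.Build.spider-case T Ω U pre z walkT uniqT apartT (FlexFamily.f F) t κ B (≤-trans (m≤n+m _ (K * b * Θ + b + (b₀ + suc (κ + b)))) B≥) half odd lengths no-clash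
            W Wctr (λ i → FirstHit.out (split i)) (λ i → FirstHit.hit (split i))
            (FlexFamily.flexW F) (λ i → FlexFamily.flexR F (piece (others i)) (there (∈-tabulate⁺ {f = λ i → piece (others i)} i)))
            (FlexFamily.flexR F (piece (not ∘ odd)) (here refl)) (FlexFamily.member F)
        where
        F : FlexFamily W pieces
        F = flexible H pieces (s≤s (≤-trans (≤-reflexive (length-tabulate (λ i → piece (others i)))) (m≤n+m s 2)))
        no-clash : ∀ i j → i ≢ j → pre i ≡ [] → odd i ≡ true → pre j ≡ [] → odd j ≡ true → ⊥
        no-clash i j ne e _ e′ _ = true≢false
          (∧-intro (cong not (false-does (j ≟F i) (ne ∘ sym))) (∧-intro (cong isNil e) (cong isNil e′)))
          (none (i , j) (∈-cartesianProduct⁺ (∈-allFin i) (∈-allFin j)))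

    -- By `gapW` some position is outside `W`. It lies on a leg whose ends, the centre and a leaf,
    -- are in `W`.
    pathKernel : (H : HeavyFamily) → HeavyFamily.W H ctr ≡ true → ContainsSubdivKst G s t (suc κ)
    pathKernel H Wctr = free (#-pos (λ p → full p ∧ not (W p)) all (≤-trans (s≤s z≤n) (≤-reflexive (sym gapW))))
      where
      open HeavyFamily H
      free : (∃[ p ] p ∈ all × not (W p) ≡ true) → ContainsSubdivKst G s t (suc κ)
      free (ctr , _ , h) = ⊥-elim (true≢false Wctr (not-true h))
      free (lg i l , _ , h) = link H β y α D walk uniq Wα Wβ WD (s≤s⁻¹ (≤-trans short (≤-reflexive (leg-length i))))
        where
        open Interval (interval W {R = Adj} ctr (leg i) Wctr
          (trans (cong W (leaf-end i ctr)) (L⊆W (leaf i) (leaf-isLeaf i))) (∈-tabulate⁺ {f = lg i} l) (not-true h) (leg-walk i) (leg! i))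

    -- The leaves have at most `n ^ s` patterns with fibres of bounded size, while the sample has
    -- order `n * d ^ (s * suc κ)`. This is where the density hypothesis, with its exponent `s ∸ 1`,
    -- is used.
    few : ∀ f → Light (innerCount s κ) f → length 𝒰 ≤ 2 * size f → ⊥
    few f light half = <⇒≱ dense (*-cancelˡ-≤ n {{>-nonZero n>0}} (begin
      n * d ^ (s * suc κ)                         ≡⟨ cong (λ e → n * d ^ e) (sym edges≡) ⟩
      n * d ^ edges                               ≤⟨ many′ n>0 K>0 d≥ d> ⟩
      2 ^ edges * length 𝒰                        ≤⟨ *-mono-≤ (≤-reflexive (cong (2 ^_) edges≡)) (≤-trans half (*-monoʳ-≤ 2
            (≤-trans (size-by-keys f isLeaf (2 * lam (innerCount s κ)) Z keys (λ σ σ∈ → light isLeaf (λ _ h → h) refl σ σ∈))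
              (≤-reflexive (cong (_* (2 * lam (innerCount s κ))) (trans lenZ (cong (n ^_) (length-tabulate leaf)))))))) ⟩
      2 ^ (s * suc κ) * (2 * (n ^ s * (2 * lam (innerCount s κ))))
            ≡⟨ cong (λ x → 2 ^ (s * suc κ) * (2 * (x * (2 * lam (innerCount s κ))))) (pow s s≥1) ⟩
      2 ^ (s * suc κ) * (2 * (n * n ^ (s ∸ 1) * (2 * lam (innerCount s κ))))
            ≡⟨ cong (λ x → 2 ^ (s * suc κ) * (2 * (n * n ^ (s ∸ 1) * (2 * thresholds x B (innerCount s κ))))) N≡ ⟩
      2 ^ (s * suc κ) * (2 * (n * n ^ (s ∸ 1) * (2 * thresholds (suc (s * suc κ)) B (innerCount s κ))))
            ≡⟨ lem (2 ^ (s * suc κ)) n (n ^ (s ∸ 1)) (thresholds (suc (s * suc κ)) B (innerCount s κ)) ⟩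
      n * (2 ^ (s * suc κ) * (2 * (2 * thresholds (suc (s * suc κ)) B (innerCount s κ))) * n ^ (s ∸ 1)) ∎))
      where
      open ≤-Reasoning
      lem : ∀ p n m l → p * (2 * (n * m * (2 * l))) ≡ n * (p * (2 * (2 * l)) * m)
      lem = solve-∀
      pow : ∀ s → 1 ≤ s → n ^ s ≡ n * n ^ (s ∸ 1)
      pow (suc s) _ = refl
      leaves : List P
      leaves = tabulate leaf
      keyData = free-keys (fromℕ< n>0) leaves
      Z = proj₁ keyData
      lenZ = proj₂ (proj₂ keyData)
      keys : Keys isLeaf Z
      keys σ σ∈ = let z , z∈ , a = proj₁ (proj₂ keyData) σ σ∈ in z , z∈ , λ p h → a p (∈⟦⟧ leaves (isLeaf⁻ p h))
        where
        isLeaf⁻ : ∀ p → isLeaf p ≡ true → p ∈ leaves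
        isLeaf⁻ (lg i l) h with does-true (l ≟F fromℕ κ) h
        ... | refl = ∈-tabulate⁺ {f = leaf} i

    contains : ContainsSubdivKst G s t (suc κ)
    contains with dichotomy
    ... | inj₂ (f , light , half) = ⊥-elim (few f light half)
    ... | inj₁ H = byCentre (HeavyFamily.W H ctr) refl
      where
      byCentre : ∀ c → HeavyFamily.W H ctr ≡ c → ContainsSubdivKst G s t (suc κ)
      byCentre true e = pathKernel H e
      byCentre false e = SpiderKernel.result H e

  contains : ContainsSubdivKst G s t (suc κ)
  contains = let U , ok , sep , many = embeddings refl in Core.contains (record { 𝒰 = U ; ok = ok ; sep = sep }) many

-- Reduction to nearly regular graphs

heaviestBlock : ∀ {A : Set} b a (xs : List A) (w : A → ℕ) → 0 < b → length xs ≤ b * a →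
                ∃[ ys ] length ys ≤ a × (∀ g → ∑ ys g ≤ ∑ xs g) × (∀ {x} → x ∈ ys → x ∈ xs) × ∑ xs w ≤ b * ∑ ys w
heaviestBlock (suc zero) a xs w _ l = xs , ≤-trans l (≤-reflexive (+-identityʳ a)) , (λ _ → ≤-refl) , (λ m → m) , ≤-reflexive (sym (+-identityʳ _))
heaviestBlock {A} (suc (suc b)) a xs w _ l
  with heaviestBlock (suc b) a (drop a xs) w (s≤s z≤n)
         (≤-trans (≤-reflexive (length-drop a xs)) (m≤n+o⇒m∸n≤o (length xs) a l))
... | ys , ly , part , sub , heavy with ∑ ys w ≤? ∑ (take a xs) w
... | yes le = take a xs , ≤-trans (≤-reflexive (length-take a xs)) (m⊓n≤m a _) , take≤ , take-∈
  , ≤-trans (≤-reflexive (whole w)) (+-monoʳ-≤ (∑ (take a xs) w) (≤-trans heavy (*-monoʳ-≤ (suc b) le)))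
  where
  whole : ∀ g → ∑ xs g ≡ ∑ (take a xs) g + ∑ (drop a xs) g
  whole g = trans (cong (λ l → ∑ l g) (sym (take++drop≡id a xs))) (∑-++ (take a xs) (drop a xs) g)
  take≤ : ∀ g → ∑ (take a xs) g ≤ ∑ xs g
  take≤ g = ≤-trans (m≤m+n _ _) (≤-reflexive (sym (whole g)))
  take-∈ : ∀ {x} → x ∈ take a xs → x ∈ xs
  take-∈ m = subst (_ ∈_) (take++drop≡id a xs) (∈-++⁺ˡ m)
... | no ≰ = ys , ly , (λ g → ≤-trans (part g) (≤-trans (m≤n+m _ (∑ (take a xs) g)) (≤-reflexive (sym (whole g)))))
  , (λ m → subst (_ ∈_) (take++drop≡id a xs) (∈-++⁺ʳ (take a xs) (sub m)))
  , ≤-trans (≤-reflexive (whole w)) (+-mono-≤ (<⇒≤ (≰⇒> ≰)) heavy)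
  where
  whole : ∀ g → ∑ xs g ≡ ∑ (take a xs) g + ∑ (drop a xs) g
  whole g = trans (cong (λ l → ∑ l g) (sym (take++drop≡id a xs))) (∑-++ (take a xs) (drop a xs) g)

∑-lookup : ∀ {A : Set} (xs : List A) (f : A → ℕ) → ∑ (allFin (length xs)) (f ∘ lookup xs) ≡ ∑ xs f
∑-lookup xs f = trans (sym (∑-map (lookup xs) (allFin (length xs)) f))
  (cong (λ l → ∑ l f) (trans (map-tabulate (λ i → i) (lookup xs)) (tabulate-lookup xs)))

module Subgraphs {n} (G : SimpleGraph n) where

  open Graph G

  degIn : (V → Bool) → V → ℕ
  degIn S v = # (λ j → S j ∧ adj G v j) vs

  -- Ordered pairs: each edge inside `S` counts twice.
  e2 : (V → Bool) → ℕ
  e2 S = ∑ vs (λ i → ∑ vs (λ j → 𝟙 (S i ∧ (S j ∧ adj G i j))))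

  members : (V → Bool) → List V
  members S = filterᵇ S vs

  induced : (S : V → Bool) → SimpleGraph (length (members S))
  induced S = record
    { adj = λ i j → adj G (lookup (members S) i) (lookup (members S) j)
    ; sym = λ i j → adj-sym G _ _
    ; irrefl = λ i → irrefl G _ }

  order : ∀ S → length (members S) ≡ # S vs
  order S = length-filterᵇ S vs

  degree : ∀ v → length (nbrs v) ≡ # (adj G v) vs
  degree v = length-filterᵇ (adj G v) vs

  degIn≤ : ∀ S v → degIn S v ≤ length (nbrs v)
  degIn≤ S v = ≤-trans (#-mono vs (λ j _ h → proj₂ (∧-true {S j} h))) (≤-reflexive (sym (degree v)))

  #-members : ∀ S (Q : V → Bool) → # Q (members S) ≡ # (λ j → S j ∧ Q j) vs
  #-members S Q = trans (∑-filterᵇ S vs (𝟙 ∘ Q)) (∑-cong vs (λ j _ → pt (S j) (Q j)))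
    where
    pt : ∀ a c → 𝟙 a * 𝟙 c ≡ 𝟙 (a ∧ c)
    pt true c = +-identityʳ (𝟙 c)
    pt false c = refl

  induced-degree : ∀ S i → length (Graph.nbrs (induced S) i) ≡ degIn S (lookup (members S) i)
  induced-degree S i = trans (length-filterᵇ (adj (induced S) i) (allFin _))
    (trans (∑-lookup (members S) (𝟙 ∘ adj G (lookup (members S) i))) (#-members S (adj G (lookup (members S) i))))

  handshake : 2 * edgeCount G ≡ ∑ vs (λ i → # (adj G i) vs)
  handshake = sym (begin
    ∑ vs (λ i → ∑ vs (λ j → 𝟙 (adj G i j)))
      ≡⟨ ∑-cong vs (λ i _ → trans (∑-cong vs (λ j _ → pt i j)) (∑-+ vs (λ j → lower i j) (λ j → lower j i))) ⟩
    ∑ vs (λ i → ∑ vs (λ j → lower i j) + ∑ vs (λ j → lower j i))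
      ≡⟨ ∑-+ vs (λ i → ∑ vs (λ j → lower i j)) (λ i → ∑ vs (λ j → lower j i)) ⟩
    edgeCount G + ∑ vs (λ i → ∑ vs (λ j → lower j i))
      ≡⟨ cong (edgeCount G +_) (trans (∑-swap vs vs (λ i j → lower j i)) (sym (+-identityʳ _))) ⟩
    2 * edgeCount G ∎)
    where
    open ≡-Reasoning
    lower : V → V → ℕ
    lower i j = 𝟙 ((toℕ i <ᵇ toℕ j) ∧ adj G i j)
    below : ∀ {a c} → a < c → (a <ᵇ c) ≡ true
    below {a} {c} h = true-does (a <? c) h
    notBelow : ∀ {a c} → ¬ (a < c) → (a <ᵇ c) ≡ false
    notBelow {a} {c} h = false-does (a <? c) h
    pt : ∀ i j → 𝟙 (adj G i j) ≡ lower i j + lower j i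
    pt i j with <-cmp (toℕ i) (toℕ j)
    ... | tri< lt _ ≯ rewrite below lt | notBelow ≯ = sym (+-identityʳ _)
    ... | tri> ≮ _ gt rewrite notBelow ≮ | below gt = cong 𝟙 (adj-sym G i j)
    ... | tri≈ ≮ e ≯ rewrite notBelow ≮ | notBelow ≯ with toℕ-injective e
    ... | refl rewrite irrefl G i = refl

  -- Deleting a vertex of degree below `d` lowers `e2` by at most `2 * d`, so the strict inequality
  -- persists; it fails for the empty set, so the deletions stop before that.
  minDegree : ∀ k d S → # S vs ≤ k → 2 * d * # S vs < e2 S →
              ∃[ S′ ] (∀ v → S′ v ≡ true → S v ≡ true) × (∃[ v ] S′ v ≡ true) × (∀ v → S′ v ≡ true → d ≤ degIn S′ v)
  minDegree k d S Sk dense with find (λ v → S v ∧ does (degIn S v <? d)) vs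
  ... | inj₂ none = S , (λ _ h → h) , nonempty , (λ v Sv → ≮⇒≥ (λ lt → true≢false (∧-intro Sv (true-does (degIn S v <? d) lt)) (none v (∈-allFin v))))
    where
    nonempty : ∃[ v ] S v ≡ true
    nonempty with find S vs
    ... | inj₁ (v , _ , h) = v , h
    ... | inj₂ empty = ⊥-elim (<⇒≱ dense (≤-trans (≤-reflexive (trans
            (∑-cong vs (λ i i∈ → trans (∑-cong vs (λ j _ → cong (λ c → 𝟙 (c ∧ (S j ∧ adj G i j))) (empty i i∈))) (∑-zero vs))) (∑-zero vs))) z≤n))
  ... | inj₁ (v , _ , h) = step k Sk
    where
    Sv : S v ≡ true
    Sv = proj₁ (∧-true {S v} h)
    low : degIn S v < d
    low = does-true (degIn S v <? d) (proj₂ (∧-true {S v} h))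
    S₁ : V → Bool
    S₁ i = S i ∧ not (does (i ≟F v))
    size : # S vs ≡ suc (# S₁ vs)
    size = trans (#-split S (λ i → does (i ≟F v)) vs) (cong (_+ # S₁ vs)
      (trans (∑-cong vs (λ i _ → cong 𝟙 (pt i))) (#-point _≟F_ (allFin⁺ n) (∈-allFin v))))
      where
      pt : ∀ i → S i ∧ does (i ≟F v) ≡ does (i ≟F v)
      pt i with i ≟F v
      ... | yes refl rewrite Sv = refl
      ... | no _ with S i
      ... | true = refl
      ... | false = refl
    point-sum : ∀ c → ∑ vs (λ i → 𝟙 (does (i ≟F v)) * c) ≡ c
    point-sum c = trans (∑-*ʳ vs (λ i → 𝟙 (does (i ≟F v))) c)
      (trans (cong (_* c) (#-point _≟F_ (allFin⁺ n) (∈-allFin v))) (*-identityˡ c))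
    loss : e2 S ≤ e2 S₁ + 2 * degIn S v
    loss = begin
      e2 S ≤⟨ ∑-mono vs (λ i _ → ≤-trans (∑-mono vs (λ j _ → pt i j)) (≤-reflexive (trans (∑-+ vs (λ j → a i j + c i j) (g i))
                (cong (_+ ∑ vs (g i)) (∑-+ vs (a i) (c i)))))) ⟩
      ∑ vs (λ i → ∑ vs (a i) + ∑ vs (c i) + ∑ vs (g i))
        ≡⟨ trans (∑-+ vs (λ i → ∑ vs (a i) + ∑ vs (c i)) (λ i → ∑ vs (g i))) (cong (_+ ∑ vs (λ i → ∑ vs (g i))) (∑-+ vs (λ i → ∑ vs (a i)) (λ i → ∑ vs (c i)))) ⟩
      e2 S₁ + ∑ vs (λ i → ∑ vs (c i)) + ∑ vs (λ i → ∑ vs (g i))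
        ≡⟨ cong₂ (λ x y → e2 S₁ + x + y) cs gs ⟩
      e2 S₁ + degIn S v + degIn S v ≡⟨ lem (e2 S₁) (degIn S v) ⟩
      e2 S₁ + 2 * degIn S v ∎
      where
      open ≤-Reasoning
      a c g : V → V → ℕ
      a i j = 𝟙 (S₁ i ∧ (S₁ j ∧ adj G i j))
      c i j = 𝟙 (does (i ≟F v)) * 𝟙 (S j ∧ adj G v j)
      g i j = 𝟙 (does (j ≟F v)) * 𝟙 (S i ∧ adj G v i)
      cs : ∑ vs (λ i → ∑ vs (c i)) ≡ degIn S v
      cs = trans (∑-cong vs (λ i _ → ∑-*ˡ vs (𝟙 (does (i ≟F v))) (λ j → 𝟙 (S j ∧ adj G v j)))) (point-sum (degIn S v))
      gs : ∑ vs (λ i → ∑ vs (g i)) ≡ degIn S v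
      gs = ∑-cong vs (λ i _ → point-sum (𝟙 (S i ∧ adj G v i)))
      lem : ∀ x y → x + y + y ≡ x + 2 * y
      lem = solve-∀
      key : ∀ si sj e x y di dj → (di ≡ true → e ≡ x) → (dj ≡ true → e ≡ y) →
            𝟙 (si ∧ (sj ∧ e)) ≤ 𝟙 ((si ∧ not di) ∧ ((sj ∧ not dj) ∧ e)) + 𝟙 di * 𝟙 (sj ∧ x) + 𝟙 dj * 𝟙 (si ∧ y)
      key false _ _ _ _ _ _ _ _ = z≤n
      key true false _ _ _ _ _ _ _ = z≤n
      key true true false _ _ _ _ _ _ = z≤n
      key true true true x y true _ hx _ with hx refl
      ... | refl = s≤s z≤n
      key true true true x y false true _ hy with hy refl
      ... | refl = s≤s z≤n
      key true true true x y false false _ _ = s≤s z≤n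
      pt : ∀ i j → 𝟙 (S i ∧ (S j ∧ adj G i j)) ≤ a i j + c i j + g i j
      pt i j = key (S i) (S j) (adj G i j) (adj G v j) (adj G v i) (does (i ≟F v)) (does (j ≟F v))
        (λ e → cong (λ w → adj G w j) (does-true (i ≟F v) e))
        (λ e → trans (cong (adj G i) (does-true (j ≟F v) e)) (adj-sym G i v))
    dense₁ : 2 * d * # S₁ vs < e2 S₁
    dense₁ = +-cancelʳ-< (2 * d) _ _ (begin-strict
      2 * d * # S₁ vs + 2 * d       ≡⟨ lem d (# S₁ vs) ⟩
      2 * d * suc (# S₁ vs)         ≡⟨ cong (2 * d *_) (sym size) ⟩
      2 * d * # S vs                <⟨ dense ⟩
      e2 S                          ≤⟨ loss ⟩
      e2 S₁ + 2 * degIn S v         ≤⟨ +-monoʳ-≤ (e2 S₁) (*-monoʳ-≤ 2 (<⇒≤ low)) ⟩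
      e2 S₁ + 2 * d                 ∎)
      where
      open ≤-Reasoning
      lem : ∀ d x → 2 * d * x + 2 * d ≡ 2 * d * suc x
      lem = solve-∀
    step : ∀ k → # S vs ≤ k → _
    step zero Sk = ⊥-elim (<⇒≱ (≤-trans (s≤s z≤n) (≤-reflexive (sym size))) Sk)
    step (suc k) Sk =
      let S′ , sub , ne , big = minDegree k d S₁ (s≤s⁻¹ (≤-trans (≤-reflexive (sym size)) Sk)) dense₁
      in S′ , (λ w h → proj₁ (∧-true {S w} (sub w h))) , ne , big

module Regularise (p q C′ b : ℕ) (p≥1 : 1 ≤ p) (q≥1 : 1 ≤ q) (b≡ : b ≡ 4 ^ (p + p + q))
  (Free : ∀ {n} → SimpleGraph n → Set)
  (hereditary : ∀ {n} (G : SimpleGraph n) S → Free G → Free (Subgraphs.induced G S))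
  (regular : ∀ {m} (G : SimpleGraph m) d → 0 < m → (∀ v → d ≤ length (Graph.nbrs G v)) →
             (∀ v → length (Graph.nbrs G v) ≤ 16 * b * d) → C′ * m ^ q < d ^ p → ¬ Free G)
  where

  -- The factor `16 ^ p` comes from `E≤16nd`. The summand `C′` supplies the density for `regular`,
  -- and `b ^ p` forces `b < d`.
  C : ℕ
  C = 16 ^ p * (C′ + b ^ p)

  instance
    p≢0 : NonZero p
    p≢0 = >-nonZero p≥1

  b>4 : 4 < b
  b>4 = ≤-trans (≤-trans (s≤s (s≤s (s≤s (s≤s (s≤s z≤n))))) (^-monoʳ-≤ 4 (≤-trans (+-mono-≤ (+-mono-≤ p≥1 p≥1) q≥1) ≤-refl)))
    (≤-reflexive (sym b≡))

  instance
    b≢0 : NonZero b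
    b≢0 = >-nonZero (≤-trans (s≤s z≤n) b>4)

  ^-cancel : ∀ x y → x ^ p < y ^ p → x < y
  ^-cancel x y h = ≰⇒> (λ le → <⇒≱ h (^-mono p le))

  Bounded : ℕ → Set
  Bounded n = ∀ (G : SimpleGraph n) → Free G → edgeCount G ^ p ≤ C * n ^ (p + q)

  module Step {n} (n>0 : 0 < n) (IH : ∀ {m} → m < n → Bounded m) (G : SimpleGraph n) (free : Free G)
    (lt : C * n ^ (p + q) < edgeCount G ^ p) where

    open Graph G
    open Subgraphs G

    E K d : ℕ
    E = edgeCount G
    K = 16 * b

    instance
      n≢0 : NonZero n
      n≢0 = >-nonZero n>0
      8n≢0 : NonZero (8 * n)
      8n≢0 = m*n≢0 8 n

    d = E / (8 * n)

    8nd≤E : 8 * n * d ≤ E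
    8nd≤E = ≤-trans (≤-reflexive (*-comm (8 * n) d)) (m/n*n≤m E (8 * n))

    E<8n[1+d] : E < 8 * n * suc d
    E<8n[1+d] = begin-strict
      E                                ≡⟨ m≡m%n+[m/n]*n E (8 * n) ⟩
      E % (8 * n) + d * (8 * n)        <⟨ +-monoˡ-< (d * (8 * n)) (m%n<n E (8 * n)) ⟩
      8 * n + d * (8 * n)              ≡⟨ *-comm (suc d) (8 * n) ⟩
      8 * n * suc d                    ∎
      where open ≤-Reasoning

    C≥ : b ^ p ≤ C′ + b ^ p
    C≥ = m≤n+m (b ^ p) C′

    n^q>0 : 0 < n ^ q
    n^q>0 = m^n>0 n q

    transfer : ∀ x → E ≤ 16 * n * x → (C′ + b ^ p) * n ^ q < x ^ p
    transfer x le = *-cancelˡ-< (16 ^ p * n ^ p) _ _ (begin-strict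
      16 ^ p * n ^ p * ((C′ + b ^ p) * n ^ q)     ≡⟨ lem (16 ^ p) (n ^ p) (C′ + b ^ p) (n ^ q) ⟩
      16 ^ p * (C′ + b ^ p) * (n ^ p * n ^ q)     ≡⟨ cong (C *_) (sym (^-distribˡ-+-* n p q)) ⟩
      C * n ^ (p + q)                             <⟨ lt ⟩
      E ^ p                                       ≤⟨ ^-mono p le ⟩
      (16 * n * x) ^ p                            ≡⟨ trans (^-distrib (16 * n) x p) (cong (_* x ^ p) (^-distrib 16 n p)) ⟩
      16 ^ p * n ^ p * x ^ p                      ∎)
      where
      open ≤-Reasoning
      lem : ∀ a c e f → a * c * (e * f) ≡ a * e * (c * f)
      lem = solve-∀

    d>0 : 0 < d
    d>0 = n≢0⇒n>0 (λ d≡0 → <⇒≱ (transfer 1 (≤-trans (<⇒≤ E<8n[1+d]) (≤-trans (≤-reflexive (cong (λ x → 8 * n * suc x) d≡0))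
      (*-monoˡ-≤ 1 (*-monoˡ-≤ n (m≤m+n 8 8))))))
      (≤-trans (≤-reflexive (^-zeroˡ p)) (*-mono-≤ (≤-trans (m^n>0 b p) C≥) n^q>0)))

    E≤16nd : E ≤ 16 * n * d
    E≤16nd = ≤-trans (<⇒≤ E<8n[1+d]) (≤-trans (*-monoʳ-≤ (8 * n) (+-monoˡ-≤ d d>0)) (≤-reflexive (lem n d)))
      where
      lem : ∀ n d → 8 * n * (d + d) ≡ 16 * n * d
      lem = solve-∀

    d-dense : (C′ + b ^ p) * n ^ q < d ^ p
    d-dense = transfer d E≤16nd

    -- Together with `d≤n` this gives `b ≤ n`, so that rounding up the block size `a` at most
    -- doubles it.
    b<d : b < d
    b<d = ^-cancel b d (≤-<-trans (≤-trans C≥ (≤-trans (≤-reflexive (sym (*-identityʳ _))) (*-monoʳ-≤ (C′ + b ^ p) n^q>0))) d-dense)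

    lengthvs : length vs ≡ n
    lengthvs = length-tabulate {n = n} (λ i → i)

    2E≤n² : 2 * E ≤ n * n
    2E≤n² = ≤-trans (≤-reflexive handshake) (≤-trans (∑-≤-const vs n (λ i _ → ≤-trans (#≤length (adj G i) vs) (≤-reflexive lengthvs)))
      (≤-reflexive (cong (_* n) lengthvs)))

    d≤n : d ≤ n
    d≤n = *-cancelˡ-≤ n (≤-trans (*-monoˡ-≤ d (m≤m+n n (7 * n))) (≤-trans 8nd≤E (≤-trans (m≤m+n E _) 2E≤n²)))

    b≤n : b ≤ n
    b≤n = ≤-trans (<⇒≤ b<d) d≤n

    Big : V → Bool
    Big v = does (K * d <? length (nbrs v))

    bA≤2n : b * # Big vs ≤ 2 * n
    bA≤2n = *-cancelʳ-≤ _ _ (16 * d) {{m*n≢0 16 d {{_}} {{>-nonZero d>0}}}} (begin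
      b * # Big vs * (16 * d)                   ≡⟨ lem b (# Big vs) d ⟩
      # Big vs * (16 * b * d)                   ≡⟨ sym (∑-*ʳ vs (𝟙 ∘ Big) (K * d)) ⟩
      ∑ vs (λ v → 𝟙 (Big v) * (K * d))          ≤⟨ ∑-mono vs (λ v _ → heavy v) ⟩
      ∑ vs (λ v → # (adj G v) vs)             ≡⟨ sym handshake ⟩
      2 * E                                   ≤⟨ *-monoʳ-≤ 2 E≤16nd ⟩
      2 * (16 * n * d)                        ≡⟨ lem′ n d ⟩
      2 * n * (16 * d)                        ∎)
      where
      open ≤-Reasoning
      lem : ∀ b a d → b * a * (16 * d) ≡ a * (16 * b * d)
      lem = solve-∀
      lem′ : ∀ n d → 2 * (16 * n * d) ≡ 2 * n * (16 * d)
      lem′ = solve-∀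
      heavy : ∀ v → 𝟙 (Big v) * (K * d) ≤ # (adj G v) vs
      heavy v = go (Big v) refl
        where
        go : ∀ c → Big v ≡ c → 𝟙 c * (K * d) ≤ # (adj G v) vs
        go false _ = z≤n
        go true e = ≤-trans (≤-reflexive (+-identityʳ (K * d)))
          (≤-trans (<⇒≤ (does-true (K * d <? length (nbrs v)) e)) (≤-reflexive (degree v)))

    -- Ordered pairs consisting of any vertex and a high-degree neighbour of it; this bounds the
    -- number of edges that are lost with `Big`.
    tA : ℕ
    tA = ∑ vs (degIn Big)

    a : ℕ
    a = suc (n / b)

    n≤ba : n ≤ b * a
    n≤ba = begin
      n                     ≡⟨ m≡m%n+[m/n]*n n b ⟩
      n % b + n / b * b     ≤⟨ +-monoˡ-≤ (n / b * b) (<⇒≤ (m%n<n n b)) ⟩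
      b + n / b * b         ≡⟨ *-comm a b ⟩
      b * a                 ∎
      where open ≤-Reasoning

    ba≤2n : b * a ≤ 2 * n
    ba≤2n = begin
      b * a               ≡⟨ *-comm b a ⟩
      b + n / b * b       ≤⟨ +-mono-≤ b≤n (m/n*n≤m n b) ⟩
      n + n               ≡⟨ cong (n +_) (sym (+-identityʳ n)) ⟩
      2 * n               ∎
      where open ≤-Reasoning

    -- Otherwise the set Big of high-degree vertices together with one of b blocks of vertices spans too many edges for the induction hypothesis.
    fewTouched : 2 * tA ≤ E
    fewTouched = ≮⇒≥ contra
      where
      contra : E < 2 * tA → ⊥
      contra many with heaviestBlock b a vs (degIn Big) (≤-trans (s≤s z≤n) b>4) (≤-trans (≤-reflexive lengthvs) n≤ba)
      ... | ys , ly , part , _ , heavy = <⇒≱ final (≤-reflexive refl)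
        where
        open ≤-Reasoning
        S : V → Bool
        S v = Big v ∨ does (memberOf _≟F_ v ys)
        m = length (members S)
        H = induced S
        bm≤4n : b * m ≤ 4 * n
        bm≤4n = begin
          b * m                       ≡⟨ cong (b *_) (order S) ⟩
          b * # S vs                  ≤⟨ *-monoʳ-≤ b (≤-trans (#-∪ vs (λ v _ h → ∨-true {Big v} h)) (+-monoʳ-≤ (# Big vs) ysCount)) ⟩
          b * (# Big vs + a)            ≡⟨ *-distribˡ-+ b (# Big vs) a ⟩
          b * # Big vs + b * a          ≤⟨ +-mono-≤ bA≤2n ba≤2n ⟩
          2 * n + 2 * n               ≡⟨ lem n ⟩
          4 * n                       ∎
          where
          lem : ∀ n → 2 * n + 2 * n ≡ 4 * n
          lem = solve-∀
          ysCount : # (λ v → does (memberOf _≟F_ v ys)) vs ≤ a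
          ysCount = ≤-trans (#-union (λ y v → does (v ≟F y)) vs ys (λ v _ h → v , does-true (memberOf _≟F_ v ys) h , true-does (v ≟F v) refl))
            (≤-trans (∑-≤-const ys 1 (λ y _ → #-point≤1 _≟F_ y (allFin⁺ n))) (≤-trans (≤-reflexive (*-identityʳ _)) ly))
        m<n : m < n
        m<n = ≰⇒> (λ n≤m → <⇒≱ b>4 (*-cancelʳ-≤ b 4 n (≤-trans (*-monoʳ-≤ b n≤m) bm≤4n)))
        e′ = edgeCount H
        block≤ : ∑ ys (degIn Big) ≤ 2 * e′
        block≤ = begin
          ∑ ys (degIn Big)                              ≤⟨ ∑-mono ys (λ v v∈ → inS v v∈) ⟩
          ∑ ys (λ v → 𝟙 (S v) * degIn S v)            ≤⟨ part _ ⟩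
          ∑ vs (λ v → 𝟙 (S v) * degIn S v)            ≡⟨ sym (∑-filterᵇ S vs (degIn S)) ⟩
          ∑ (members S) (degIn S)                     ≡⟨ sym (∑-lookup (members S) (degIn S)) ⟩
          ∑ (allFin m) (degIn S ∘ lookup (members S)) ≡⟨ ∑-cong (allFin m) (λ i _ → trans (sym (induced-degree S i)) (Subgraphs.degree H i)) ⟩
          ∑ (allFin m) (λ i → # (adj H i) (allFin m)) ≡⟨ sym (Subgraphs.handshake H) ⟩
          2 * e′                                      ∎
          where
          inS : ∀ v → v ∈ ys → degIn Big v ≤ 𝟙 (S v) * degIn S v
          inS v v∈ = ≤-trans (#-mono vs (λ j _ h → let h₁ , h₂ = ∧-true {Big j} h in ∧-intro (∨-introˡ h₁) h₂))
            (≤-reflexive (trans (sym (*-identityˡ _)) (cong (λ c → 𝟙 c * degIn S v) (sym (∨-introʳ {Big v} (true-does (memberOf _≟F_ v ys) v∈))))))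
        E≤4be′ : E ≤ 4 * b * e′
        E≤4be′ = begin
          E                            ≤⟨ <⇒≤ many ⟩
          2 * tA                       ≤⟨ *-monoʳ-≤ 2 heavy ⟩
          2 * (b * ∑ ys (degIn Big))     ≤⟨ *-monoʳ-≤ 2 (*-monoʳ-≤ b block≤) ⟩
          2 * (b * (2 * e′))           ≡⟨ lem b e′ ⟩
          4 * b * e′                   ∎
          where
          lem : ∀ b e → 2 * (b * (2 * e)) ≡ 4 * b * e
          lem = solve-∀
        Y = b ^ p * (C * n ^ (p + q))
        -- The block with `Big` has at most 4 n / b vertices and at least E / (4 b) edges. This
        -- contradicts the induction hypothesis once (4 b)^p 4^(p+q) ≤ b^(p+q), that is 4^(2p+q) ≤
        -- b^q; as q ≥ 1, the choice b = 4^(2p+q) suffices.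
        b≡′ : 4 ^ p * 4 ^ (p + q) ≡ b
        b≡′ = trans (sym (^-distribˡ-+-* 4 p (p + q))) (trans (cong (4 ^_) (sym (+-assoc p p q))) (sym b≡))
        final : Y * b ^ q < Y * b ^ q
        final = begin-strict
          b ^ p * (C * n ^ (p + q)) * b ^ q          ≡⟨ lem₁ (b ^ p) (C * n ^ (p + q)) (b ^ q) ⟩
          b ^ p * b ^ q * (C * n ^ (p + q))          ≡⟨ cong (_* (C * n ^ (p + q))) (sym (^-distribˡ-+-* b p q)) ⟩
          b ^ (p + q) * (C * n ^ (p + q))            <⟨ *-monoʳ-< (b ^ (p + q)) {{m^n≢0 b (p + q)}} lt ⟩
          b ^ (p + q) * E ^ p                        ≤⟨ *-monoʳ-≤ (b ^ (p + q)) (^-mono p E≤4be′) ⟩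
          b ^ (p + q) * (4 * b * e′) ^ p             ≡⟨ cong (b ^ (p + q) *_) (trans (^-distrib (4 * b) e′ p) (cong (_* e′ ^ p) (^-distrib 4 b p))) ⟩
          b ^ (p + q) * (4 ^ p * b ^ p * e′ ^ p)     ≤⟨ *-monoʳ-≤ (b ^ (p + q)) (*-monoʳ-≤ (4 ^ p * b ^ p) (IH m<n H (hereditary G S free))) ⟩
          b ^ (p + q) * (4 ^ p * b ^ p * (C * m ^ (p + q))) ≡⟨ lem₂ (b ^ (p + q)) (4 ^ p) (b ^ p) C (m ^ (p + q)) ⟩
          4 ^ p * b ^ p * C * (b ^ (p + q) * m ^ (p + q)) ≡⟨ cong (4 ^ p * b ^ p * C *_) (sym (^-distrib b m (p + q))) ⟩
          4 ^ p * b ^ p * C * (b * m) ^ (p + q)      ≤⟨ *-monoʳ-≤ (4 ^ p * b ^ p * C) (^-mono (p + q) bm≤4n) ⟩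
          4 ^ p * b ^ p * C * (4 * n) ^ (p + q)      ≡⟨ cong (4 ^ p * b ^ p * C *_) (^-distrib 4 n (p + q)) ⟩
          4 ^ p * b ^ p * C * (4 ^ (p + q) * n ^ (p + q)) ≡⟨ lem₃ (4 ^ p) (b ^ p) C (4 ^ (p + q)) (n ^ (p + q)) ⟩
          Y * (4 ^ p * 4 ^ (p + q))                  ≡⟨ cong (Y *_) b≡′ ⟩
          Y * b                                      ≤⟨ *-monoʳ-≤ Y (≤-trans (≤-reflexive (sym (*-identityʳ b))) (^-monoʳ-≤ b q≥1)) ⟩
          Y * b ^ q                                  ∎
          where
          lem₁ : ∀ x y z → x * y * z ≡ x * z * y
          lem₁ = solve-∀
          lem₂ : ∀ x y z c w → x * (y * z * (c * w)) ≡ y * z * c * (x * w)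
          lem₂ = solve-∀
          lem₃ : ∀ f g c h k → f * g * c * (h * k) ≡ g * (c * k) * (f * h)
          lem₃ = solve-∀

    low : V → Bool
    low v = not (Big v)

    -- Of the `2 * E` ordered pairs at most `2 * tA` involve `Big`, and `fewTouched` bounds these by
    -- `E`.
    E≤e2 : E ≤ e2 low
    E≤e2 = +-cancelʳ-≤ E E (e2 low) (begin
      E + E                     ≡⟨ cong (E +_) (sym (+-identityʳ E)) ⟩
      2 * E                     ≡⟨ handshake ⟩
      ∑ vs (λ i → ∑ vs (λ j → 𝟙 (adj G i j)))
        ≤⟨ ∑-mono vs (λ i _ → ≤-trans (∑-mono vs (λ j _ → pt (Big i) (Big j) (adj G i j) (adj G j i) (adj-sym G i j)))
             (≤-reflexive (trans (∑-+ vs (λ j → x i j + y i j) (y′ i)) (cong (_+ ∑ vs (y′ i)) (∑-+ vs (x i) (y i)))))) ⟩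
      ∑ vs (λ i → ∑ vs (x i) + ∑ vs (y i) + ∑ vs (y′ i))
        ≡⟨ trans (∑-+ vs (λ i → ∑ vs (x i) + ∑ vs (y i)) (λ i → ∑ vs (y′ i))) (cong₂ _+_ (∑-+ vs (λ i → ∑ vs (x i)) (λ i → ∑ vs (y i))) (∑-swap vs vs y′)) ⟩
      e2 low + tA + tA          ≡⟨ lem (e2 low) tA ⟩
      e2 low + 2 * tA           ≤⟨ +-monoʳ-≤ (e2 low) fewTouched ⟩
      e2 low + E                ∎)
      where
      open ≤-Reasoning
      x y y′ : V → V → ℕ
      x i j = 𝟙 (low i ∧ (low j ∧ adj G i j))
      y i j = 𝟙 (Big j ∧ adj G i j)
      y′ i j = 𝟙 (Big i ∧ adj G j i)
      lem : ∀ e t → e + t + t ≡ e + 2 * t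
      lem = solve-∀
      pt : ∀ ai aj e e′ → e ≡ e′ → 𝟙 e ≤ 𝟙 (not ai ∧ (not aj ∧ e)) + 𝟙 (aj ∧ e) + 𝟙 (ai ∧ e′)
      pt false false e _ refl = ≤-trans (m≤m+n _ _) (m≤m+n _ _)
      pt false true e _ refl = m≤m+n _ _
      pt true false e _ refl = ≤-refl
      pt true true e _ refl = m≤m+n _ _

    low-dense : 2 * d * # low vs < e2 low
    low-dense = begin-strict
      2 * d * # low vs         ≤⟨ *-monoʳ-≤ (2 * d) (≤-trans (#≤length low vs) (≤-reflexive lengthvs)) ⟩
      2 * d * n                <⟨ *-monoˡ-< n (*-monoˡ-< d {{>-nonZero d>0}} (s≤s (s≤s (s≤s (z≤n {5}))))) ⟩
      8 * d * n                ≡⟨ lem d n ⟩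
      8 * n * d                ≤⟨ 8nd≤E ⟩
      E                        ≤⟨ E≤e2 ⟩
      e2 low                   ∎
      where
      open ≤-Reasoning
      lem : ∀ d n → 8 * d * n ≡ 8 * n * d
      lem = solve-∀

    core : ∃[ S ] (∀ v → S v ≡ true → low v ≡ true) × (∃[ v ] S v ≡ true) × (∀ v → S v ≡ true → d ≤ degIn S v) → ⊥
    core (S , sub , (v , Sv) , big) = regular (induced S) d m>0
      (λ i → ≤-trans (big (at′ i) (inS i)) (≤-reflexive (sym (induced-degree S i))))
      (λ i → ≤-trans (≤-reflexive (induced-degree S i)) (≤-trans (degIn≤ S (at′ i)) (≮⇒≥ (λ h →
        true≢false (true-does (K * d <? length (nbrs (at′ i))) h) (not-true (sub (at′ i) (inS i)))))))
      (≤-<-trans (*-monoʳ-≤ C′ (^-mono q m≤n)) (≤-<-trans (*-monoˡ-≤ (n ^ q) (m≤m+n C′ (b ^ p))) d-dense))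
      (hereditary G S free)
      where
      at′ : Fin (length (members S)) → V
      at′ = lookup (members S)
      inS : ∀ i → S (at′ i) ≡ true
      inS i = proj₂ (∈-filterᵇ⁻ S vs (∈-lookup {xs = members S} i))
      m>0 : 0 < length (members S)
      m>0 = ≤-trans (#-∈ (∈-allFin v) Sv) (≤-reflexive (sym (order S)))
      m≤n : length (members S) ≤ n
      m≤n = ≤-trans (≤-reflexive (order S)) (≤-trans (#≤length S vs) (≤-reflexive lengthvs))

    contradiction : ⊥
    contradiction = core (minDegree (# low vs) d low ≤-refl low-dense)

  bounded : ∀ n → Bounded n
  bounded = <-rec Bounded step
    where
    step : ∀ n → (∀ {m} → m < n → Bounded m) → Bounded n
    step zero _ G _ = ≤-trans (≤-reflexive (0^ p p≥1)) z≤n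
      where
      0^ : ∀ p → 1 ≤ p → 0 ^ p ≡ 0
      0^ (suc p) _ = refl
    step (suc n) IH G free with edgeCount G ^ p ≤? C * suc n ^ (p + q)
    ... | yes le = le
    ... | no ≰ = ⊥-elim (Step.contradiction (s≤s z≤n) IH G free (≰⇒> ≰))

-- Choice of the constants and conclusion

RegularBound : (s t κ K C′ : ℕ) → Set
RegularBound s t κ K C′ = ∀ {n} (G : SimpleGraph n) d → 0 < n → (∀ v → d ≤ length (Graph.nbrs G v)) →
  (∀ v → length (Graph.nbrs G v) ≤ K * d) → C′ * n ^ (s ∸ 1) < d ^ (s * suc κ) → ContainsSubdivKst G s t (suc κ)

-- All lower bounds on `d` are encoded in the density constant: the summand `D ^ e` forces `D < d`,
-- since the power of `n` is at least 1. The summand `D₄` is the one required for the count of leaf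
-- tuples.
regularBound : ∀ s t κ K → 1 ≤ s → 1 ≤ κ → 0 < K → ∃[ C′ ] RegularBound s t κ K C′
regularBound s t κ K s≥1 κ≥1 K>0 = withConstants _ _ _ _ _ _ refl refl refl refl ≤-refl ≤-refl
  where
  e = s * suc κ
  withConstants : ∀ Γ₀ Γ₁ b₀ Θ b B →
    Γ₀ ≡ suc (2 * ((3 + s) * (K ^ e * (2 ^ e * suc (2 * (innerCount s κ * 2 ^ suc e)))))) →
    Γ₁ ≡ Γ₀ * K ^ suc e → b₀ ≡ 2 * (Γ₁ * (s * K ^ 2)) → Θ ≡ 2 * Γ₁ * 2 ^ b₀ →
    s * κ + suc (t * suc (s * κ) + s) ≤ b →
    K * b * Θ + b + (b₀ + suc (κ + b)) + (s * κ + (s + (t * suc (s * κ) + s))) ≤ B →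
    ∃[ C′ ] RegularBound s t κ K C′
  withConstants Γ₀ Γ₁ b₀ Θ b B Γ₀≡ Γ₁≡ b₀≡ Θ≡ b≥ B≥ = D ^ e + D₄ , λ {n} G d n>0 deg≥ deg≤ dense →
    let n^>0 = m^n>0 n {{>-nonZero n>0}} (s ∸ 1)
        D<d : D < d
        D<d = ≰⇒> (λ d≤D → <⇒≱ dense (≤-trans (^-mono e d≤D) (≤-trans (m≤m+n (D ^ e) D₄)
          (≤-trans (≤-reflexive (sym (*-identityʳ _))) (*-monoʳ-≤ (D ^ e + D₄) n^>0)))))
    in RegularGraph.contains s t κ (record { G = G ; d = d ; K = K ; deg≥ = deg≥ ; deg≤ = deg≤ })
         s≥1 κ≥1 K>0 Γ₀ Γ₁ b₀ Θ b B Γ₀≡ Γ₁≡ b₀≡ Θ≡ b≥ B≥ n>0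
         (≤-trans (≤-trans (m≤m+n D₁ D₂) (m≤m+n _ D₃)) (<⇒≤ D<d))
         (≤-<-trans (≤-trans (m≤n+m D₂ D₁) (m≤m+n _ D₃)) D<d)
         (≤-<-trans (m≤n+m D₃ (D₁ + D₂)) D<d)
         (≤-<-trans (*-monoˡ-≤ (n ^ (s ∸ 1)) (m≤n+m D₄ (D ^ e))) dense)
    where
    D₁ D₂ D₃ D D₄ : ℕ
    D₁ = 2 * suc e
    D₂ = Γ₀ * (suc e * B * K ^ e)
    D₃ = Θ * (2 * b * K)
    D = D₁ + D₂ + D₃
    D₄ = 2 ^ e * (2 * (2 * thresholds (suc e) B (innerCount s κ)))

induced-free : ∀ s t k {n} (G : SimpleGraph n) S → ¬ ContainsSubdivKst G s t k →
               ¬ ContainsSubdivKst (Subgraphs.induced G S) s t k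
induced-free s t k {n} G S free (f , f-inj , f-edge) = free (lookup xs ∘ f , (λ h → f-inj (at-injective xs refl xs! _ _ h)) , f-edge)
  where
  xs = Subgraphs.members G S
  xs! = filterᵇ! _≟F_ S (allFin⁺ n)

-- Raising the bound to the power s k makes its exponents integers; the constant in the original
-- form is the (s k)-th root of `C`.
theorem1p4 : (s t k : ℕ) → 2 ≤ s → 2 ≤ t → 2 ≤ k →
    ∃[ C ] ((n : ℕ) (G : SimpleGraph n) → ¬ ContainsSubdivKst G s t k →
    edgeCount G ^ (s * k) ≤ C * n ^ (s * k + (s ∸ 1)))
theorem1p4 s t (suc κ) s≥2 t≥2 (s≤s κ≥1) = fromRegular (regularBound s t κ (16 * b) s≥1 κ≥1 K>0)
  where
  p = s * suc κ
  q = s ∸ 1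
  b = 4 ^ (p + p + q)
  s≥1 : 1 ≤ s
  s≥1 = ≤-trans (n≤1+n 1) s≥2
  K>0 : 0 < 16 * b
  K>0 = *-mono-≤ {1} {16} (s≤s z≤n) (m^n>0 4 (p + p + q))
  fromRegular : ∃[ C′ ] RegularBound s t κ (16 * b) C′ → _
  fromRegular (C′ , contains) = C , bounded
    where
    open Regularise p q C′ b (*-mono-≤ s≥1 (s≤s z≤n)) (∸-monoˡ-≤ 1 s≥2) refl
      (λ G → ¬ ContainsSubdivKst G s t (suc κ)) (induced-free s t (suc κ))
      (λ G d m>0 lo hi dense free → free (contains G d m>0 lo hi dense))
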